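{- Let $W$ be an irreducible $T$-module with endpoint $r$ and diameter $d=D-2r$. Then the following hold for $0\le i,j\le d$ and nonzero vectors $u\in E_rW$, $u^*\in E^*_rW$, $u^{\varepsilon}\in E^{\varepsilon}_rW$. (i) $$\langle E_{r+i}u^{\varepsilon},E^*_{r+j}u\rangle=\mathbf{i}^i\,2^{ -d}\langle u^{\varepsilon},u\rangle\binom{d}{i}\binom{d}{j}\;{}_2F_1\Big({ -i,-j\atop -d};2\Big).$$ (ii) $$\langle E^*_{r+i}u,E^{\varepsilon}_{r+j}u^*\rangle=\mathbf{i}^i\,2^{ -d}\langle u,u^*\rangle\binom{d}{i}\binom{d}{j}\;{}_2F_1\Big({ -i,-j\atop -d};2\Big).$$ (iii) $$\langle E^{\varepsilon}_{r+i}u^*,E_{r+j}u^{\varepsilon}\rangle=\mathbf{i}^i\,2^{ -d}\langle u^*,u^{\varepsilon}\rangle\binom{d}{i}\binom{d}{j}\;{}_2F_1\Big({ -i,-j\atop -d};2\Big).$$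
   Context: Let $D$ be a positive integer and let $Q_D$ be the $D$-cube: the graph with vertex set $X=\{0,1\}^D$, two vertices being adjacent iff they differ in exactly one coordinate; $\partial$ denotes path-length distance. $\mathrm{Mat}_X(\mathbb{C})$ is the algebra of complex matrices with rows and columns indexed by $X$, acting on $V=\mathbb{C}^X$ (column vectors) by left multiplication. $V$ carries the Hermitian inner product $\langle v,w\rangle=v^t\overline{w}$ (linear in the first argument). Write $\mathbf{i}^2=-1$ (the bold $\mathbf{i}$ is the imaginary unit; the plain $i$ is an index). Let $A$ be the adjacency matrix of $Q_D$. Fix $x=(0,0,\ldots,0)\in X$. Let $A^*$ be the diagonal matrix in $\mathrm{Mat}_X(\mathbb{C})$ with $(y,y)$-entry $D-2\partial(x,y)$ for $y\in X$, and let $A^{\varepsilon}=-\mathbf{i}(AA^*-A^*A)/2$. Let $T$ be the subalgebra of $\mathrm{Mat}_X(\mathbb{C})$ generated by $A$ and $A^*$. The eigenvalues of $A$ are $\theta_i=D-2i$ $(0\le i\le D)$. For $0\le i\le D$: $E_i=\prod_{0\le j\le D,\,j\ne i}\frac{A-\theta_jI}{\theta_i-\theta_j}$ is the primitive idempotent of $A$ for $\theta_i$ (the orthogonal projection onto the $\theta_i$-eigenspace of $A$); $E_i^*$ is the diagonal matrix with $(y,y)$-entry $1$ if $\partial(x,y)=i$ and $0$ otherwise; and $E_i^{\varepsilon}=P^{ -1}E_iP$, where $P=P_1^{\otimes D}$ (Kronecker power, $P_{yz}=\prod_{k=1}^D(P_1)_{y_kz_k}$, invertible) with $P_1=\begin{pmatrix}1&1\\-\mathbf{i}&\mathbf{i}\end{pmatrix}$,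 rows and columns indexed by $0,1$ in that order. ($E_i^*$ and $E_i^{\varepsilon}$ are the primitive idempotents of $A^*$ and $A^{\varepsilon}$ for the eigenvalue $D-2i$.) A $T$-module is a subspace $W\subseteq V$ with $BW\subseteq W$ for all $B\in T$; it is irreducible if $W\ne0$ and it contains no $T$-modules other than $0$ and $W$. The endpoint of an irreducible $T$-module $W$ is $r=\min\{i\mid 0\le i\le D,\ E_i^*W\neq0\}$ (it is known that also $r=\min\{i\mid E_iW\ne0\}$), and its diameter is $d=|\{i\mid 0\le i\le D,\ E_i^*W\ne0\}|-1$; it is known that $d=D-2r$ and $0\le r\le D/2$. For $a\in\mathbb{C}$ and an integer $n\ge0$, $(a)_n=a(a+1)\cdots(a+n-1)$ with $(a)_0=1$. For integers $0\le i,j\le d$, ${}_2F_1\big({ -i,-j\atop -d};2\big)=\sum_{n=0}^d\frac{(-i)_n(-j)_n}{(-d)_n\,n!}2^n$. -}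

module Defs where

open import Algebra.Bundles using (CommutativeRing; Semiring)
open import Data.Bool.Base using (if_then_else_)
open import Data.Fin.Base using (Fin; toℕ)
open import Data.Fin.Patterns using (0F; 1F)
import Data.Fin.Properties as Fin
open import Data.Fin.Subset using (Subset; ∣_∣) renaming (_∈_ to _∈ˢ_)
open import Data.Integer.Base using (+_)
open import Data.List.Base using (map; foldr; filter; upTo)
open import Data.Nat.Base as ℕ using (ℕ; zero; suc; z≤n; s≤s; _!)
import Data.Nat.Properties as ℕ
open import Data.Product.Base using (Σ; ∃; _×_; _,_; proj₁; proj₂)
open import Data.Rational.Base as ℚ using (ℚ; 0ℚ; 1ℚ; ½)
import Data.Rational.Properties as ℚ
import Data.Rational.Solver as ℚ
open import Data.Vec.Base using (Vec; []; _∷_; zip; count; replicate)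
import Data.Vec.Properties as Vec
open import Function.Bundles using (_⇔_)
open import Level using (0ℓ)
open import Relation.Binary.PropositionalEquality
  using (_≡_; refl; sym; trans; cong; subst)
open import Relation.Nullary using (¬_; Dec; yes; no; does; ¬?)
open import Relation.Unary using (Pred; _∈_; _⊆_; _≐_)

------------------------------------------------------------------------
-- Real numbers: Cauchy sequences of rationals modulo null sequences

Cauchy : (ℕ → ℚ) → Set
Cauchy s = ∀ ε → 0ℚ ℚ.< ε →
  ∃ λ N → ∀ m n → N ℕ.≤ m → N ℕ.≤ n → ℚ.∣ s m ℚ.- s n ∣ ℚ.< ε

record ℝ : Set where
  constructor mkℝ
  field
    seq    : ℕ → ℚ
    cauchy : Cauchy seq
open ℝ public

infix 4 _≈ʳ_
record _≈ʳ_ (x y : ℝ) : Set where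
  constructor mk≈
  field
    close : ∀ ε → 0ℚ ℚ.< ε →
      ∃ λ N → ∀ n → N ℕ.≤ n → ℚ.∣ seq x n ℚ.- seq y n ∣ ℚ.< ε
open _≈ʳ_ public

private
  open ℚ.+-*-Solver using (solve; _:=_; _:+_; _:*_; _:-_; :-_; con)

  half : ∀ {ε} → 0ℚ ℚ.< ε → 0ℚ ℚ.< ½ ℚ.* ε
  half {ε} 0<ε = subst (ℚ._< ½ ℚ.* ε) (ℚ.*-zeroʳ ½) (ℚ.*-monoʳ-<-pos ½ 0<ε)

  half+half : ∀ ε → ½ ℚ.* ε ℚ.+ ½ ℚ.* ε ≡ ε
  half+half ε = trans (sym (ℚ.*-distribʳ-+ ε ½ ½)) (ℚ.*-identityˡ ε)

  ∣∣-self : ∀ p → ℚ.∣ p ℚ.- p ∣ ≡ 0ℚ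
  ∣∣-self p = cong ℚ.∣_∣ (ℚ.+-inverseʳ p)

  ∣∣-swap : ∀ p q → ℚ.∣ p ℚ.- q ∣ ≡ ℚ.∣ q ℚ.- p ∣
  ∣∣-swap p q = trans (cong ℚ.∣_∣ (lemma p q)) (ℚ.∣-p∣≡∣p∣ (q ℚ.- p))
    where
    lemma : ∀ p q → p ℚ.- q ≡ ℚ.- (q ℚ.- p)
    lemma = solve 2 (λ p q → p :- q := :- (q :- p)) refl

  ∣∣-triangle : ∀ {ε} p q {r} → r ≡ p ℚ.+ q →
    ℚ.∣ p ∣ ℚ.< ½ ℚ.* ε → ℚ.∣ q ∣ ℚ.< ½ ℚ.* ε → ℚ.∣ r ∣ ℚ.< ε
  ∣∣-triangle {ε} p q refl p< q< = ℚ.≤-<-trans (ℚ.∣p+q∣≤∣p∣+∣q∣ p q)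
    (subst (ℚ.∣ p ∣ ℚ.+ ℚ.∣ q ∣ ℚ.<_) (half+half ε) (ℚ.+-mono-< p< q<))

  ⊔-split : ∀ k l {n} → k ℕ.⊔ l ℕ.≤ n → k ℕ.≤ n × l ℕ.≤ n
  ⊔-split k l p = ℕ.≤-trans (ℕ.m≤m⊔n k l) p , ℕ.≤-trans (ℕ.m≤n⊔m k l) p

  scaled : (B ε : ℚ) → 0ℚ ℚ.< B → 0ℚ ℚ.< ε →
    ∃ λ δ → 0ℚ ℚ.< δ × B ℚ.* δ ≡ ½ ℚ.* ε
  scaled B ε 0<B 0<ε = B⁻¹ ℚ.* (½ ℚ.* ε) ,
    subst (ℚ._< B⁻¹ ℚ.* (½ ℚ.* ε)) (ℚ.*-zeroʳ B⁻¹) (ℚ.*-monoʳ-<-pos B⁻¹ (half 0<ε)) ,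
    trans (sym (ℚ.*-assoc B B⁻¹ _))
      (trans (cong (ℚ._* (½ ℚ.* ε)) (ℚ.*-inverseʳ B)) (ℚ.*-identityˡ _))
    where
    instance
      B-pos : ℚ.Positive B
      B-pos = ℚ.positive 0<B
      B-nonZero : ℚ.NonZero B
      B-nonZero = ℚ.pos⇒nonZero B
    B⁻¹ : ℚ
    B⁻¹ = ℚ.1/ B
    instance
      B⁻¹-pos : ℚ.Positive B⁻¹
      B⁻¹-pos = ℚ.1/pos⇒pos B

  ∣∣-mul : ∀ {B δ} b q → 0ℚ ℚ.< B → ℚ.∣ b ∣ ℚ.≤ B → ℚ.∣ q ∣ ℚ.< δ →
    ℚ.∣ b ℚ.* q ∣ ℚ.< B ℚ.* δ
  ∣∣-mul {B} {δ} b q 0<B b≤ q< = subst (ℚ._< B ℚ.* δ) (sym (ℚ.∣p*q∣≡∣p∣*∣q∣ b q))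
    (ℚ.≤-<-trans (ℚ.*-monoʳ-≤-nonNeg ℚ.∣ q ∣ b≤) (ℚ.*-monoʳ-<-pos B q<))
    where
    instance
      B-pos : ℚ.Positive B
      B-pos = ℚ.positive 0<B
      q-nonNeg : ℚ.NonNegative ℚ.∣ q ∣
      q-nonNeg = ℚ.∣-∣-nonNeg q

  ∣∣-mul₂ : ∀ {B δ ε} a a′ b b′ → 0ℚ ℚ.< B → B ℚ.* δ ≡ ½ ℚ.* ε →
    ℚ.∣ a ∣ ℚ.≤ B → ℚ.∣ b′ ∣ ℚ.≤ B →
    ℚ.∣ a ℚ.- a′ ∣ ℚ.< δ → ℚ.∣ b ℚ.- b′ ∣ ℚ.< δ →
    ℚ.∣ a ℚ.* b ℚ.- a′ ℚ.* b′ ∣ ℚ.< ε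
  ∣∣-mul₂ a a′ b b′ 0<B eq a≤ b′≤ da db =
    ∣∣-triangle (a ℚ.* (b ℚ.- b′)) (b′ ℚ.* (a ℚ.- a′)) (lemma a a′ b b′)
      (subst (_ ℚ.<_) eq (∣∣-mul a _ 0<B a≤ db))
      (subst (_ ℚ.<_) eq (∣∣-mul b′ _ 0<B b′≤ da))
    where
    lemma : ∀ a a′ b b′ → a ℚ.* b ℚ.- a′ ℚ.* b′ ≡ a ℚ.* (b ℚ.- b′) ℚ.+ b′ ℚ.* (a ℚ.- a′)
    lemma = solve 4 (λ a a′ b b′ → a :* b :- a′ :* b′ := a :* (b :- b′) :+ b′ :* (a :- a′)) refl

  eventual-bound : (x : ℝ) →
    ∃ λ B → 0ℚ ℚ.< B × ∃ λ N → ∀ n → N ℕ.≤ n → ℚ.∣ seq x n ∣ ℚ.≤ B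
  eventual-bound x with cauchy x 1ℚ (ℚ.positive⁻¹ 1ℚ)
  ... | N , c = B , 0<B , N , bound
    where
    B : ℚ
    B = 1ℚ ℚ.+ ℚ.∣ seq x N ∣
    0<B : 0ℚ ℚ.< B
    0<B = ℚ.+-mono-<-≤ (ℚ.positive⁻¹ 1ℚ) (ℚ.0≤∣p∣ (seq x N))
    lemma : ∀ p q → p ≡ (p ℚ.- q) ℚ.+ q
    lemma = solve 2 (λ p q → p := (p :- q) :+ q) refl
    bound : ∀ n → N ℕ.≤ n → ℚ.∣ seq x n ∣ ℚ.≤ B
    bound n N≤n = subst (λ p → ℚ.∣ p ∣ ℚ.≤ B) (sym (lemma (seq x n) (seq x N)))
      (ℚ.≤-trans (ℚ.∣p+q∣≤∣p∣+∣q∣ (seq x n ℚ.- seq x N) (seq x N))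
        (ℚ.+-monoˡ-≤ ℚ.∣ seq x N ∣ (ℚ.<⇒≤ (c n N N≤n ℕ.≤-refl))))

  bound₂ : (x y : ℝ) → ∃ λ B → 0ℚ ℚ.< B × ∃ λ N → ∀ n → N ℕ.≤ n →
    ℚ.∣ seq x n ∣ ℚ.≤ B × ℚ.∣ seq y n ∣ ℚ.≤ B
  bound₂ x y = combine (eventual-bound x) (eventual-bound y)
    where
    combine : (∃ λ B → 0ℚ ℚ.< B × ∃ λ N → ∀ n → N ℕ.≤ n → ℚ.∣ seq x n ∣ ℚ.≤ B) →
      (∃ λ C → 0ℚ ℚ.< C × ∃ λ M → ∀ n → M ℕ.≤ n → ℚ.∣ seq y n ∣ ℚ.≤ C) → _
    combine (B , 0<B , N , b) (C , 0<C , M , c) =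
      B ℚ.+ C , ℚ.+-mono-< 0<B 0<C , N ℕ.⊔ M , λ n le →
        ℚ.≤-trans (b n (proj₁ (⊔-split N M le)))
          (subst (ℚ._≤ B ℚ.+ C) (ℚ.+-identityʳ B) (ℚ.+-monoʳ-≤ B (ℚ.<⇒≤ 0<C))) ,
        ℚ.≤-trans (c n (proj₂ (⊔-split N M le)))
          (subst (ℚ._≤ B ℚ.+ C) (ℚ.+-identityˡ C) (ℚ.+-monoˡ-≤ C (ℚ.<⇒≤ 0<B)))

infixl 6 _+ʳ_
infixl 7 _*ʳ_
infix  8 -ʳ_

ℚ→ℝ : ℚ → ℝ
ℚ→ℝ p = mkℝ (λ _ → p) λ ε 0<ε → 0 , λ _ _ _ _ → subst (ℚ._< ε) (sym (∣∣-self p)) 0<ε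

0ʳ 1ʳ : ℝ
0ʳ = ℚ→ℝ 0ℚ
1ʳ = ℚ→ℝ 1ℚ

-- Opaque only so that conversion checking does not unfold terms of ℂ down to
-- rational sequences; `unfolding _+ʳ_ -ʳ_ _*ʳ_` exposes the termwise operations.
opaque
  _+ʳ_ : ℝ → ℝ → ℝ
  x +ʳ y = mkℝ (λ n → seq x n ℚ.+ seq y n) λ ε 0<ε →
    let N , c = cauchy x (½ ℚ.* ε) (half 0<ε)
        M , d = cauchy y (½ ℚ.* ε) (half 0<ε)
    in N ℕ.⊔ M , λ m n p q →
      ∣∣-triangle (seq x m ℚ.- seq x n) (seq y m ℚ.- seq y n)
        (lemma (seq x m) (seq x n) (seq y m) (seq y n))
        (c m n (proj₁ (⊔-split N M p)) (proj₁ (⊔-split N M q)))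
        (d m n (proj₂ (⊔-split N M p)) (proj₂ (⊔-split N M q)))
    where
    lemma : ∀ a b c d → (a ℚ.+ c) ℚ.- (b ℚ.+ d) ≡ (a ℚ.- b) ℚ.+ (c ℚ.- d)
    lemma = solve 4 (λ a b c d → (a :+ c) :- (b :+ d) := (a :- b) :+ (c :- d)) refl

  -ʳ_ : ℝ → ℝ
  -ʳ x = mkℝ (λ n → ℚ.- seq x n) λ ε 0<ε →
    let N , c = cauchy x ε 0<ε
    in N , λ m n p q → subst (ℚ._< ε)
      (trans (∣∣-swap (seq x m) (seq x n)) (cong ℚ.∣_∣ (lemma (seq x m) (seq x n)))) (c m n p q)
    where
    lemma : ∀ a b → b ℚ.- a ≡ ℚ.- a ℚ.- ℚ.- b
    lemma = solve 2 (λ a b → b :- a := (:- a) :- (:- b)) refl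

  _*ʳ_ : ℝ → ℝ → ℝ
  x *ʳ y = mkℝ (λ n → seq x n ℚ.* seq y n) λ ε 0<ε →
    let B , 0<B , K , b = bound₂ x y
        δ , 0<δ , eq = scaled B ε 0<B 0<ε
        N , c = cauchy x δ 0<δ
        M , d = cauchy y δ 0<δ
    in K ℕ.⊔ (N ℕ.⊔ M) , λ m n p q →
      let p₁ , p₂ = ⊔-split K (N ℕ.⊔ M) p
          q₁ , q₂ = ⊔-split K (N ℕ.⊔ M) q
      in ∣∣-mul₂ (seq x m) (seq x n) (seq y m) (seq y n) 0<B eq
           (proj₁ (b m p₁)) (proj₂ (b n q₁))
           (c m n (proj₁ (⊔-split N M p₂)) (proj₁ (⊔-split N M q₂)))
           (d m n (proj₂ (⊔-split N M p₂)) (proj₂ (⊔-split N M q₂)))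

private
  pointwise : ∀ {x y} → (∀ n → seq x n ≡ seq y n) → x ≈ʳ y
  pointwise {x} {y} eq = mk≈ λ ε 0<ε → 0 , λ n _ →
    subst (λ p → ℚ.∣ seq x n ℚ.- p ∣ ℚ.< ε) (eq n)
      (subst (ℚ._< ε) (sym (∣∣-self (seq x n))) 0<ε)

  ≈ʳ-sym : ∀ {x y} → x ≈ʳ y → y ≈ʳ x
  ≈ʳ-sym {x} {y} x≈y = mk≈ λ ε 0<ε →
    let N , c = close x≈y ε 0<ε
    in N , λ n p → subst (ℚ._< ε) (∣∣-swap (seq x n) (seq y n)) (c n p)

  ≈ʳ-trans : ∀ {x y z} → x ≈ʳ y → y ≈ʳ z → x ≈ʳ z
  ≈ʳ-trans {x} {y} {z} x≈y y≈z = mk≈ λ ε 0<ε →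
    let N , c = close x≈y (½ ℚ.* ε) (half 0<ε)
        M , d = close y≈z (½ ℚ.* ε) (half 0<ε)
    in N ℕ.⊔ M , λ n p →
      ∣∣-triangle (seq x n ℚ.- seq y n) (seq y n ℚ.- seq z n)
        (lemma (seq x n) (seq y n) (seq z n))
        (c n (proj₁ (⊔-split N M p))) (d n (proj₂ (⊔-split N M p)))
    where
    lemma : ∀ a b c → a ℚ.- c ≡ (a ℚ.- b) ℚ.+ (b ℚ.- c)
    lemma = solve 3 (λ a b c → a :- c := (a :- b) :+ (b :- c)) refl

  opaque
    unfolding _+ʳ_ -ʳ_ _*ʳ_

    +ʳ-cong : ∀ {x x′ y y′} → x ≈ʳ x′ → y ≈ʳ y′ → x +ʳ y ≈ʳ x′ +ʳ y′
    +ʳ-cong {x} {x′} {y} {y′} x≈ y≈ = mk≈ λ ε 0<ε →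
      let N , c = close x≈ (½ ℚ.* ε) (half 0<ε)
          M , d = close y≈ (½ ℚ.* ε) (half 0<ε)
      in N ℕ.⊔ M , λ n p →
        ∣∣-triangle (seq x n ℚ.- seq x′ n) (seq y n ℚ.- seq y′ n)
          (lemma (seq x n) (seq x′ n) (seq y n) (seq y′ n))
          (c n (proj₁ (⊔-split N M p))) (d n (proj₂ (⊔-split N M p)))
      where
      lemma : ∀ a b c d → (a ℚ.+ c) ℚ.- (b ℚ.+ d) ≡ (a ℚ.- b) ℚ.+ (c ℚ.- d)
      lemma = solve 4 (λ a b c d → (a :+ c) :- (b :+ d) := (a :- b) :+ (c :- d)) refl

    -ʳ-cong : ∀ {x y} → x ≈ʳ y → -ʳ x ≈ʳ -ʳ y
    -ʳ-cong {x} {y} x≈y = mk≈ λ ε 0<ε →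
      let N , c = close x≈y ε 0<ε
      in N , λ n p → subst (ℚ._< ε)
        (trans (∣∣-swap (seq x n) (seq y n)) (cong ℚ.∣_∣ (lemma (seq x n) (seq y n)))) (c n p)
      where
      lemma : ∀ a b → b ℚ.- a ≡ ℚ.- a ℚ.- ℚ.- b
      lemma = solve 2 (λ a b → b :- a := (:- a) :- (:- b)) refl

    *ʳ-cong : ∀ {x x′ y y′} → x ≈ʳ x′ → y ≈ʳ y′ → x *ʳ y ≈ʳ x′ *ʳ y′
    *ʳ-cong {x} {x′} {y} {y′} x≈ y≈ = mk≈ λ ε 0<ε →
      let B , 0<B , K , b = bound₂ x y′
          δ , 0<δ , eq = scaled B ε 0<B 0<ε
          N , c = close x≈ δ 0<δ
          M , d = close y≈ δ 0<δ
      in K ℕ.⊔ (N ℕ.⊔ M) , λ n p →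
        let p₁ , p₂ = ⊔-split K (N ℕ.⊔ M) p
        in ∣∣-mul₂ (seq x n) (seq x′ n) (seq y n) (seq y′ n) 0<B eq
             (proj₁ (b n p₁)) (proj₂ (b n p₁))
             (c n (proj₁ (⊔-split N M p₂))) (d n (proj₂ (⊔-split N M p₂)))

  ≈ʳ-refl : ∀ {x} → x ≈ʳ x
  ≈ʳ-refl = pointwise λ _ → refl

  opaque
    unfolding _+ʳ_ -ʳ_ _*ʳ_

    +ʳ-assoc : ∀ x y z → (x +ʳ y) +ʳ z ≈ʳ x +ʳ (y +ʳ z)
    +ʳ-assoc x y z = pointwise λ n → ℚ.+-assoc (seq x n) (seq y n) (seq z n)

    +ʳ-identityˡ : ∀ x → 0ʳ +ʳ x ≈ʳ x
    +ʳ-identityˡ x = pointwise λ n → ℚ.+-identityˡ (seq x n)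

    +ʳ-identityʳ : ∀ x → x +ʳ 0ʳ ≈ʳ x
    +ʳ-identityʳ x = pointwise λ n → ℚ.+-identityʳ (seq x n)

    -ʳ-inverseˡ : ∀ x → (-ʳ x) +ʳ x ≈ʳ 0ʳ
    -ʳ-inverseˡ x = pointwise λ n → ℚ.+-inverseˡ (seq x n)

    -ʳ-inverseʳ : ∀ x → x +ʳ (-ʳ x) ≈ʳ 0ʳ
    -ʳ-inverseʳ x = pointwise λ n → ℚ.+-inverseʳ (seq x n)

    +ʳ-comm : ∀ x y → x +ʳ y ≈ʳ y +ʳ x
    +ʳ-comm x y = pointwise λ n → ℚ.+-comm (seq x n) (seq y n)

    *ʳ-assoc : ∀ x y z → (x *ʳ y) *ʳ z ≈ʳ x *ʳ (y *ʳ z)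
    *ʳ-assoc x y z = pointwise λ n → ℚ.*-assoc (seq x n) (seq y n) (seq z n)

    *ʳ-identityˡ : ∀ x → 1ʳ *ʳ x ≈ʳ x
    *ʳ-identityˡ x = pointwise λ n → ℚ.*-identityˡ (seq x n)

    *ʳ-identityʳ : ∀ x → x *ʳ 1ʳ ≈ʳ x
    *ʳ-identityʳ x = pointwise λ n → ℚ.*-identityʳ (seq x n)

    *ʳ-distribˡ : ∀ x y z → x *ʳ (y +ʳ z) ≈ʳ x *ʳ y +ʳ x *ʳ z
    *ʳ-distribˡ x y z = pointwise λ n → ℚ.*-distribˡ-+ (seq x n) (seq y n) (seq z n)

    *ʳ-distribʳ : ∀ x y z → (y +ʳ z) *ʳ x ≈ʳ y *ʳ x +ʳ z *ʳ x
    *ʳ-distribʳ x y z = pointwise λ n → ℚ.*-distribʳ-+ (seq x n) (seq y n) (seq z n)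

    *ʳ-comm : ∀ x y → x *ʳ y ≈ʳ y *ʳ x
    *ʳ-comm x y = pointwise λ n → ℚ.*-comm (seq x n) (seq y n)

ℝ-commutativeRing : CommutativeRing 0ℓ 0ℓ
ℝ-commutativeRing = record
  { Carrier = ℝ
  ; _≈_ = _≈ʳ_
  ; _+_ = _+ʳ_
  ; _*_ = _*ʳ_
  ; -_ = -ʳ_
  ; 0# = 0ʳ
  ; 1# = 1ʳ
  ; isCommutativeRing = record
    { isRing = record
      { +-isAbelianGroup = record
        { isGroup = record
          { isMonoid = record
            { isSemigroup = record
              { isMagma = record
                { isEquivalence = record
                  { refl = ≈ʳ-refl
                  ; sym = ≈ʳ-sym
                  ; trans = ≈ʳ-trans
                  }
                ; ∙-cong = +ʳ-cong
                }
              ; assoc = +ʳ-assoc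
              }
            ; identity = +ʳ-identityˡ , +ʳ-identityʳ
            }
          ; inverse = -ʳ-inverseˡ , -ʳ-inverseʳ
          ; ⁻¹-cong = -ʳ-cong
          }
        ; comm = +ʳ-comm
        }
      ; *-cong = *ʳ-cong
      ; *-assoc = *ʳ-assoc
      ; *-identity = *ʳ-identityˡ , *ʳ-identityʳ
      ; distrib = *ʳ-distribˡ , *ʳ-distribʳ
      }
    ; *-comm = *ʳ-comm
    }
  }

------------------------------------------------------------------------
-- Complex numbers

infix 5 _+i_

record ℂ : Set where
  constructor _+i_
  field
    re im : ℝ
open ℂ public

infix 4 _≈ᶜ_
record _≈ᶜ_ (z w : ℂ) : Set where
  constructor _,_
  field
    re≈ : re z ≈ʳ re w
    im≈ : im z ≈ʳ im w
open _≈ᶜ_ public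

infixl 6 _-ʳ_
_-ʳ_ : ℝ → ℝ → ℝ
x -ʳ y = x +ʳ (-ʳ y)

infixl 6 _+ᶜ_
infixl 7 _*ᶜ_
infix  8 -ᶜ_

_+ᶜ_ _*ᶜ_ : ℂ → ℂ → ℂ
(a +i b) +ᶜ (c +i d) = (a +ʳ c) +i (b +ʳ d)
(a +i b) *ᶜ (c +i d) = (a *ʳ c -ʳ b *ʳ d) +i (a *ʳ d +ʳ b *ʳ c)

-ᶜ_ conj : ℂ → ℂ
-ᶜ (a +i b) = (-ʳ a) +i (-ʳ b)
conj (a +i b) = a +i (-ʳ b)

private
  opaque
    unfolding _+ʳ_ -ʳ_ _*ʳ_

    assoc-re : ∀ a b c d e f →
      (a *ʳ c -ʳ b *ʳ d) *ʳ e -ʳ (a *ʳ d +ʳ b *ʳ c) *ʳ f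
        ≈ʳ a *ʳ (c *ʳ e -ʳ d *ʳ f) -ʳ b *ʳ (c *ʳ f +ʳ d *ʳ e)
    assoc-re a b c d e f = pointwise λ n → solve 6
      (λ a b c d e f →
        (a :* c :- b :* d) :* e :- (a :* d :+ b :* c) :* f
          := a :* (c :* e :- d :* f) :- b :* (c :* f :+ d :* e)) refl
      (seq a n) (seq b n) (seq c n) (seq d n) (seq e n) (seq f n)

    assoc-im : ∀ a b c d e f →
      (a *ʳ c -ʳ b *ʳ d) *ʳ f +ʳ (a *ʳ d +ʳ b *ʳ c) *ʳ e
        ≈ʳ a *ʳ (c *ʳ f +ʳ d *ʳ e) +ʳ b *ʳ (c *ʳ e -ʳ d *ʳ f)
    assoc-im a b c d e f = pointwise λ n → solve 6
      (λ a b c d e f →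
        (a :* c :- b :* d) :* f :+ (a :* d :+ b :* c) :* e
          := a :* (c :* f :+ d :* e) :+ b :* (c :* e :- d :* f)) refl
      (seq a n) (seq b n) (seq c n) (seq d n) (seq e n) (seq f n)

    idˡ-re : ∀ a b → 1ʳ *ʳ a -ʳ 0ʳ *ʳ b ≈ʳ a
    idˡ-re a b = pointwise λ n → solve 2
      (λ a b → con 1ℚ :* a :- con 0ℚ :* b := a) refl
      (seq a n) (seq b n)

    idˡ-im : ∀ a b → 1ʳ *ʳ b +ʳ 0ʳ *ʳ a ≈ʳ b
    idˡ-im a b = pointwise λ n → solve 2
      (λ a b → con 1ℚ :* b :+ con 0ℚ :* a := b) refl
      (seq a n) (seq b n)

    idʳ-re : ∀ a b → a *ʳ 1ʳ -ʳ b *ʳ 0ʳ ≈ʳ a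
    idʳ-re a b = pointwise λ n → solve 2
      (λ a b → a :* con 1ℚ :- b :* con 0ℚ := a) refl
      (seq a n) (seq b n)

    idʳ-im : ∀ a b → a *ʳ 0ʳ +ʳ b *ʳ 1ʳ ≈ʳ b
    idʳ-im a b = pointwise λ n → solve 2
      (λ a b → a :* con 0ℚ :+ b :* con 1ℚ := b) refl
      (seq a n) (seq b n)

    distribˡ-re : ∀ a b c d e f →
      a *ʳ (c +ʳ e) -ʳ b *ʳ (d +ʳ f)
        ≈ʳ (a *ʳ c -ʳ b *ʳ d) +ʳ (a *ʳ e -ʳ b *ʳ f)
    distribˡ-re a b c d e f = pointwise λ n → solve 6
      (λ a b c d e f →
        a :* (c :+ e) :- b :* (d :+ f)
          := (a :* c :- b :* d) :+ (a :* e :- b :* f)) refl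
      (seq a n) (seq b n) (seq c n) (seq d n) (seq e n) (seq f n)

    distribˡ-im : ∀ a b c d e f →
      a *ʳ (d +ʳ f) +ʳ b *ʳ (c +ʳ e)
        ≈ʳ (a *ʳ d +ʳ b *ʳ c) +ʳ (a *ʳ f +ʳ b *ʳ e)
    distribˡ-im a b c d e f = pointwise λ n → solve 6
      (λ a b c d e f →
        a :* (d :+ f) :+ b :* (c :+ e)
          := (a :* d :+ b :* c) :+ (a :* f :+ b :* e)) refl
      (seq a n) (seq b n) (seq c n) (seq d n) (seq e n) (seq f n)

    distribʳ-re : ∀ a b c d e f →
      (c +ʳ e) *ʳ a -ʳ (d +ʳ f) *ʳ b
        ≈ʳ (c *ʳ a -ʳ d *ʳ b) +ʳ (e *ʳ a -ʳ f *ʳ b)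
    distribʳ-re a b c d e f = pointwise λ n → solve 6
      (λ a b c d e f →
        (c :+ e) :* a :- (d :+ f) :* b
          := (c :* a :- d :* b) :+ (e :* a :- f :* b)) refl
      (seq a n) (seq b n) (seq c n) (seq d n) (seq e n) (seq f n)

    distribʳ-im : ∀ a b c d e f →
      (c +ʳ e) *ʳ b +ʳ (d +ʳ f) *ʳ a
        ≈ʳ (c *ʳ b +ʳ d *ʳ a) +ʳ (e *ʳ b +ʳ f *ʳ a)
    distribʳ-im a b c d e f = pointwise λ n → solve 6
      (λ a b c d e f →
        (c :+ e) :* b :+ (d :+ f) :* a
          := (c :* b :+ d :* a) :+ (e :* b :+ f :* a)) refl
      (seq a n) (seq b n) (seq c n) (seq d n) (seq e n) (seq f n)

    comm-re : ∀ a b c d → a *ʳ c -ʳ b *ʳ d ≈ʳ c *ʳ a -ʳ d *ʳ b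
    comm-re a b c d = pointwise λ n → solve 4
      (λ a b c d → a :* c :- b :* d := c :* a :- d :* b) refl
      (seq a n) (seq b n) (seq c n) (seq d n)

    comm-im : ∀ a b c d → a *ʳ d +ʳ b *ʳ c ≈ʳ c *ʳ b +ʳ d *ʳ a
    comm-im a b c d = pointwise λ n → solve 4
      (λ a b c d → a :* d :+ b :* c := c :* b :+ d :* a) refl
      (seq a n) (seq b n) (seq c n) (seq d n)

ℂ-commutativeRing : CommutativeRing 0ℓ 0ℓ
ℂ-commutativeRing = record
  { Carrier = ℂ
  ; _≈_ = _≈ᶜ_
  ; _+_ = _+ᶜ_
  ; _*_ = _*ᶜ_
  ; -_ = -ᶜ_
  ; 0# = 0ʳ +i 0ʳ
  ; 1# = 1ʳ +i 0ʳ
  ; isCommutativeRing = record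
    { isRing = record
      { +-isAbelianGroup = record
        { isGroup = record
          { isMonoid = record
            { isSemigroup = record
              { isMagma = record
                { isEquivalence = record
                  { refl = ≈ʳ-refl , ≈ʳ-refl
                  ; sym = λ p → ≈ʳ-sym (re≈ p) , ≈ʳ-sym (im≈ p)
                  ; trans = λ p q → ≈ʳ-trans (re≈ p) (re≈ q) , ≈ʳ-trans (im≈ p) (im≈ q)
                  }
                ; ∙-cong = λ p q → +ʳ-cong (re≈ p) (re≈ q) , +ʳ-cong (im≈ p) (im≈ q)
                }
              ; assoc = λ x y z → +ʳ-assoc _ _ _ , +ʳ-assoc _ _ _
              }
            ; identity = (λ x → +ʳ-identityˡ _ , +ʳ-identityˡ _)
                       , (λ x → +ʳ-identityʳ _ , +ʳ-identityʳ _)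
            }
          ; inverse = (λ x → -ʳ-inverseˡ _ , -ʳ-inverseˡ _)
                    , (λ x → -ʳ-inverseʳ _ , -ʳ-inverseʳ _)
          ; ⁻¹-cong = λ p → -ʳ-cong (re≈ p) , -ʳ-cong (im≈ p)
          }
        ; comm = λ x y → +ʳ-comm _ _ , +ʳ-comm _ _
        }
      ; *-cong = λ p q →
          +ʳ-cong (*ʳ-cong (re≈ p) (re≈ q)) (-ʳ-cong (*ʳ-cong (im≈ p) (im≈ q))) ,
          +ʳ-cong (*ʳ-cong (re≈ p) (im≈ q)) (*ʳ-cong (im≈ p) (re≈ q))
      ; *-assoc = λ (a +i b) (c +i d) (e +i f) →
          assoc-re a b c d e f , assoc-im a b c d e f
      ; *-identity = (λ (a +i b) → idˡ-re a b , idˡ-im a b)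
                   , (λ (a +i b) → idʳ-re a b , idʳ-im a b)
      ; distrib = (λ (a +i b) (c +i d) (e +i f) →
                    distribˡ-re a b c d e f , distribˡ-im a b c d e f)
                , (λ (a +i b) (c +i d) (e +i f) →
                    distribʳ-re a b c d e f , distribʳ-im a b c d e f)
      }
    ; *-comm = λ (a +i b) (c +i d) → comm-re a b c d , comm-im a b c d
    }
  }

open CommutativeRing ℂ-commutativeRing public
  using (_≈_; _+_; _*_; -_; _-_; 0#; 1#)
open import Algebra.Definitions.RawSemiring
  (Semiring.rawSemiring (CommutativeRing.semiring ℂ-commutativeRing)) public using (_^_)

ℚ→ℂ : ℚ → ℂ
ℚ→ℂ p = ℚ→ℝ p +i 0ʳ

𝐢 : ℂ
𝐢 = 0ʳ +i 1ʳ

ℕ→ℚ : ℕ → ℚ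
ℕ→ℚ n = + n ℚ./ 1

ℕ→ℂ : ℕ → ℂ
ℕ→ℂ n = ℚ→ℂ (ℕ→ℚ n)

-- Totalised by 0⁻¹ = 0; every use below is at a nonzero argument.
infix 9 _⁻¹
_⁻¹ : ℚ → ℚ
p ⁻¹ with p ℚ.≟ 0ℚ
... | yes _   = 0ℚ
... | no  p≢0 = ℚ.1/_ p {{ℚ.≢-nonZero p≢0}}

------------------------------------------------------------------------
-- The D-cube

X : ℕ → Set
X D = Vec (Fin 2) D

differences : ∀ {D} → X D → X D → ℕ
differences y z = count (λ (a , b) → ¬? (a Fin.≟ b)) (zip y z)

Adjacent : ∀ {D} → X D → X D → Set
Adjacent y z = differences y z ≡ 1

adjacent? : ∀ {D} (y z : X D) → Dec (Adjacent y z)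
adjacent? y z = differences y z ℕ.≟ 1

data Path {D : ℕ} : X D → X D → ℕ → Set where
  []  : ∀ {y} → Path y y 0
  _∷_ : ∀ {y z w n} → Adjacent y z → Path z w n → Path y w (suc n)

IsDistance : ∀ {D} → X D → X D → ℕ → Set
IsDistance y z n = Path y z n × (∀ m → Path y z m → n ℕ.≤ m)

private
  differences-refl : ∀ {D} (y : X D) → differences y y ≡ 0
  differences-refl []       = refl
  differences-refl (0F ∷ y) = differences-refl y
  differences-refl (1F ∷ y) = differences-refl y

  differences-triangle : ∀ {D} (y z w : X D) →
    differences y w ℕ.≤ differences y z ℕ.+ differences z w
  differences-triangle [] [] [] = z≤n
  differences-triangle (0F ∷ y) (0F ∷ z) (0F ∷ w) = differences-triangle y z w
  differences-triangle (0F ∷ y) (0F ∷ z) (1F ∷ w) =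
    ℕ.≤-trans (s≤s (differences-triangle y z w)) (ℕ.≤-reflexive (sym (ℕ.+-suc _ _)))
  differences-triangle (0F ∷ y) (1F ∷ z) (0F ∷ w) =
    ℕ.m≤n⇒m≤1+n (ℕ.≤-trans (differences-triangle y z w) (ℕ.+-monoʳ-≤ _ (ℕ.n≤1+n _)))
  differences-triangle (0F ∷ y) (1F ∷ z) (1F ∷ w) = s≤s (differences-triangle y z w)
  differences-triangle (1F ∷ y) (0F ∷ z) (0F ∷ w) = s≤s (differences-triangle y z w)
  differences-triangle (1F ∷ y) (0F ∷ z) (1F ∷ w) =
    ℕ.m≤n⇒m≤1+n (ℕ.≤-trans (differences-triangle y z w) (ℕ.+-monoʳ-≤ _ (ℕ.n≤1+n _)))
  differences-triangle (1F ∷ y) (1F ∷ z) (0F ∷ w) =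
    ℕ.≤-trans (s≤s (differences-triangle y z w)) (ℕ.≤-reflexive (sym (ℕ.+-suc _ _)))
  differences-triangle (1F ∷ y) (1F ∷ z) (1F ∷ w) = differences-triangle y z w

  extend : ∀ {D} (a : Fin 2) {y z : X D} {n} → Path y z n → Path (a ∷ y) (a ∷ z) n
  extend a []       = []
  extend 0F (e ∷ p) = e ∷ extend 0F p
  extend 1F (e ∷ p) = e ∷ extend 1F p

  shortest : ∀ {D} (y z : X D) → Path y z (differences y z)
  shortest [] []             = []
  shortest (0F ∷ y) (0F ∷ z) = extend 0F (shortest y z)
  shortest (0F ∷ y) (1F ∷ z) = cong suc (differences-refl y) ∷ extend 1F (shortest y z)
  shortest (1F ∷ y) (0F ∷ z) = cong suc (differences-refl y) ∷ extend 0F (shortest y z)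
  shortest (1F ∷ y) (1F ∷ z) = extend 1F (shortest y z)

  differences-minimal : ∀ {D} {y z : X D} m → Path y z m → differences y z ℕ.≤ m
  differences-minimal {y = y} .0 [] = ℕ.≤-reflexive (differences-refl y)
  differences-minimal {y = y} {w} (suc m) (_∷_ {z = z} e p) =
    ℕ.≤-trans (differences-triangle y z w)
      (ℕ.+-mono-≤ (ℕ.≤-reflexive e) (differences-minimal m p))

distance : ∀ {D} (y z : X D) → ∃ (IsDistance y z)
distance y z = differences y z , shortest y z , differences-minimal

∂ : ∀ {D} → X D → X D → ℕ
∂ y z = proj₁ (distance y z)

x₀ : ∀ {D} → X D
x₀ = replicate _ 0F

------------------------------------------------------------------------
-- Vectors and matrices indexed by X

V : ℕ → Set
V D = X D → ℂ

Mat : ℕ → Set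
Mat D = X D → X D → ℂ

∑ : ∀ {D} → (X D → ℂ) → ℂ
∑ {zero}  f = f []
∑ {suc D} f = ∑ (λ y → f (0F ∷ y)) + ∑ (λ y → f (1F ∷ y))

infix  4 _≋_ _≋ᴹ_
infixl 6 _+ⱽ_ _+ᴹ_ _-ᴹ_
infixl 7 _·_ _∘ᴹ_
infixr 7 _•ⱽ_ _•ᴹ_

_≋_ : ∀ {D} → V D → V D → Set
v ≋ w = ∀ y → v y ≈ w y

_≋ᴹ_ : ∀ {D} → Mat D → Mat D → Set
M ≋ᴹ N = ∀ y z → M y z ≈ N y z

0ⱽ : ∀ {D} → V D
0ⱽ _ = 0#

_+ⱽ_ : ∀ {D} → V D → V D → V D
(v +ⱽ w) y = v y + w y

_•ⱽ_ : ∀ {D} → ℂ → V D → V D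
(a •ⱽ v) y = a * v y

_+ᴹ_ _-ᴹ_ _∘ᴹ_ : ∀ {D} → Mat D → Mat D → Mat D
(M +ᴹ N) y z = M y z + N y z
(M -ᴹ N) y z = M y z - N y z
(M ∘ᴹ N) y z = ∑ λ w → M y w * N w z

_•ᴹ_ : ∀ {D} → ℂ → Mat D → Mat D
(a •ᴹ M) y z = a * M y z

_·_ : ∀ {D} → Mat D → V D → V D
(M · v) y = ∑ λ z → M y z * v z

diagonal : ∀ {D} → (X D → ℂ) → Mat D
diagonal f y z = if does (Vec.≡-dec Fin._≟_ y z) then f y else 0#

Id : ∀ {D} → Mat D
Id = diagonal λ _ → 1#

⟨_,_⟩ : ∀ {D} → V D → V D → ℂ
⟨ v , w ⟩ = ∑ λ y → v y * conj (w y)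

------------------------------------------------------------------------
-- Adjacency matrix, dual adjacency matrix, primitive idempotents

A : ∀ {D} → Mat D
A y z = if does (adjacent? y z) then 1# else 0#

θ : ℕ → ℕ → ℚ
θ D i = ℕ→ℚ D ℚ.- ℕ→ℚ (2 ℕ.* i)

A* : ∀ {D} → Mat D
A* {D} = diagonal λ y → ℚ→ℂ (ℕ→ℚ D ℚ.- ℕ→ℚ (2 ℕ.* ∂ x₀ y))

E-factor : ∀ {D} → ℕ → ℕ → Mat D
E-factor {D} i j = ℚ→ℂ ((θ D i ℚ.- θ D j) ⁻¹) •ᴹ (A -ᴹ ℚ→ℂ (θ D j) •ᴹ Id)

E : ∀ {D} → ℕ → Mat D
E {D} i = foldr _∘ᴹ_ Id (map (E-factor i) (filter (λ j → ¬? (j ℕ.≟ i)) (upTo (suc D))))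

E* : ∀ {D} → ℕ → Mat D
E* i = diagonal λ y → if does (∂ x₀ y ℕ.≟ i) then 1# else 0#

kronecker : ∀ {D} → (Fin 2 → Fin 2 → ℂ) → Mat D
kronecker M []      []      = 1#
kronecker M (a ∷ y) (b ∷ z) = M a b * kronecker M y z

P₁ P₁⁻¹ : Fin 2 → Fin 2 → ℂ
P₁ 0F 0F = 1#
P₁ 0F 1F = 1#
P₁ 1F 0F = - 𝐢
P₁ 1F 1F = 𝐢

P₁⁻¹ 0F 0F = ℚ→ℂ ½
P₁⁻¹ 0F 1F = ℚ→ℂ ½ * 𝐢
P₁⁻¹ 1F 0F = ℚ→ℂ ½
P₁⁻¹ 1F 1F = - (ℚ→ℂ ½ * 𝐢)

P P⁻¹ : ∀ {D} → Mat D
P   = kronecker P₁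
P⁻¹ = kronecker P₁⁻¹

private
  module ℂ-ring = CommutativeRing ℂ-commutativeRing

  _∘₁_ : (M N : Fin 2 → Fin 2 → ℂ) → Fin 2 → Fin 2 → ℂ
  (M ∘₁ N) a b = M a 0F * N 0F b + M a 1F * N 1F b

  Id₁ : Fin 2 → Fin 2 → ℂ
  Id₁ 0F 0F = 1#
  Id₁ 0F 1F = 0#
  Id₁ 1F 0F = 0#
  Id₁ 1F 1F = 1#

  ∑-cong : ∀ {D} {f g : X D → ℂ} → (∀ y → f y ≈ g y) → ∑ f ≈ ∑ g
  ∑-cong {zero}  f≈g = f≈g []
  ∑-cong {suc D} f≈g = ℂ-ring.+-cong (∑-cong λ y → f≈g (0F ∷ y)) (∑-cong λ y → f≈g (1F ∷ y))

  *-distribˡ-∑ : ∀ {D} a (f : X D → ℂ) → ∑ (λ y → a * f y) ≈ a * ∑ f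
  *-distribˡ-∑ {zero}  a f = ℂ-ring.refl
  *-distribˡ-∑ {suc D} a f = ℂ-ring.trans
    (ℂ-ring.+-cong (*-distribˡ-∑ a λ y → f (0F ∷ y)) (*-distribˡ-∑ a λ y → f (1F ∷ y)))
    (ℂ-ring.sym (ℂ-ring.distribˡ a _ _))

  kronecker-∘ : ∀ {D} M N (a b : Fin 2) (y z : X D) →
    (kronecker M ∘ᴹ kronecker N) (a ∷ y) (b ∷ z)
      ≈ (M ∘₁ N) a b * (kronecker M ∘ᴹ kronecker N) y z
  kronecker-∘ M N a b y z = ℂ-ring.trans
    (ℂ-ring.+-cong (block 0F) (block 1F)) (ℂ-ring.sym (ℂ-ring.distribʳ _ _ _))
    where
    swap : ∀ p q s t → (p * q) * (s * t) ≈ (p * s) * (q * t)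
    swap p q s t = ℂ-ring.trans (ℂ-ring.*-assoc p q (s * t))
      (ℂ-ring.trans (ℂ-ring.*-congˡ (ℂ-ring.trans (ℂ-ring.sym (ℂ-ring.*-assoc q s t))
        (ℂ-ring.trans (ℂ-ring.*-congʳ (ℂ-ring.*-comm q s)) (ℂ-ring.*-assoc s q t))))
      (ℂ-ring.sym (ℂ-ring.*-assoc p s (q * t))))
    block : ∀ c →
      ∑ (λ w → kronecker M (a ∷ y) (c ∷ w) * kronecker N (c ∷ w) (b ∷ z))
        ≈ (M a c * N c b) * (kronecker M ∘ᴹ kronecker N) y z
    block c = ℂ-ring.trans
      (∑-cong λ w → swap (M a c) (kronecker M y w) (N c b) (kronecker N w z))
      (*-distribˡ-∑ (M a c * N c b) λ w → kronecker M y w * kronecker N w z)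

  kronecker-inverse : ∀ {D} M N → (∀ a b → (M ∘₁ N) a b ≈ Id₁ a b) →
    kronecker M ∘ᴹ kronecker N ≋ᴹ Id {D}
  kronecker-inverse M N inv []      []      = ℂ-ring.*-identityˡ 1#
  kronecker-inverse M N inv (a ∷ y) (b ∷ z) = ℂ-ring.trans (kronecker-∘ M N a b y z)
    (ℂ-ring.trans (ℂ-ring.*-cong (inv a b) (kronecker-inverse M N inv y z)) (step a b))
    where
    step : ∀ a b → Id₁ a b * Id y z ≈ Id (a ∷ y) (b ∷ z)
    step 0F 0F = ℂ-ring.*-identityˡ _
    step 0F 1F = ℂ-ring.zeroˡ _
    step 1F 0F = ℂ-ring.zeroˡ _
    step 1F 1F = ℂ-ring.*-identityˡ _

private
  opaque
    unfolding _+ʳ_ -ʳ_ _*ʳ_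

    P₁∘P₁⁻¹ : ∀ a b → (P₁ ∘₁ P₁⁻¹) a b ≈ Id₁ a b
    P₁∘P₁⁻¹ 0F 0F = pointwise (λ _ → refl) , pointwise (λ _ → refl)
    P₁∘P₁⁻¹ 0F 1F = pointwise (λ _ → refl) , pointwise (λ _ → refl)
    P₁∘P₁⁻¹ 1F 0F = pointwise (λ _ → refl) , pointwise (λ _ → refl)
    P₁∘P₁⁻¹ 1F 1F = pointwise (λ _ → refl) , pointwise (λ _ → refl)

    P₁⁻¹∘P₁ : ∀ a b → (P₁⁻¹ ∘₁ P₁) a b ≈ Id₁ a b
    P₁⁻¹∘P₁ 0F 0F = pointwise (λ _ → refl) , pointwise (λ _ → refl)
    P₁⁻¹∘P₁ 0F 1F = pointwise (λ _ → refl) , pointwise (λ _ → refl)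
    P₁⁻¹∘P₁ 1F 0F = pointwise (λ _ → refl) , pointwise (λ _ → refl)
    P₁⁻¹∘P₁ 1F 1F = pointwise (λ _ → refl) , pointwise (λ _ → refl)

P∘P⁻¹ : ∀ {D} → P ∘ᴹ P⁻¹ ≋ᴹ Id {D}
P∘P⁻¹ = kronecker-inverse P₁ P₁⁻¹ P₁∘P₁⁻¹

P⁻¹∘P : ∀ {D} → P⁻¹ ∘ᴹ P ≋ᴹ Id {D}
P⁻¹∘P = kronecker-inverse P₁⁻¹ P₁ P₁⁻¹∘P₁

Eᵋ : ∀ {D} → ℕ → Mat D
Eᵋ i = P⁻¹ ∘ᴹ E i ∘ᴹ P

------------------------------------------------------------------------
-- The subalgebra T and its modules

data T {D : ℕ} : Mat D → Set where
  A∈T   : T A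
  A*∈T  : T A*
  Id∈T  : T Id
  +∈T   : ∀ {M N} → T M → T N → T (M +ᴹ N)
  ∘∈T   : ∀ {M N} → T M → T N → T (M ∘ᴹ N)
  •∈T   : ∀ a {M} → T M → T (a •ᴹ M)
  resp  : ∀ {M N} → M ≋ᴹ N → T M → T N

record IsSubspace {D : ℕ} (W : Pred (V D) 0ℓ) : Set where
  field
    resp-≋   : ∀ {v w} → v ≋ w → v ∈ W → w ∈ W
    0-closed : 0ⱽ ∈ W
    +-closed : ∀ {v w} → v ∈ W → w ∈ W → v +ⱽ w ∈ W
    •-closed : ∀ a {v} → v ∈ W → a •ⱽ v ∈ W

record IsTModule {D : ℕ} (W : Pred (V D) 0ℓ) : Set where
  field
    isSubspace : IsSubspace W
    T-closed   : ∀ {B v} → T B → v ∈ W → B · v ∈ W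

𝟎 : ∀ {D} → Pred (V D) 0ℓ
𝟎 v = v ≋ 0ⱽ

-- "Contains no T-modules other than 0 and W" is the negation of the
-- existence of such a module.  The classically equivalent disjunction
-- "every submodule is 0 or W" would be too strong constructively: applied to
-- the submodules {v ∈ W | v ≋ 0 or Q} it decides every proposition Q.
record IsIrreducible {D : ℕ} (W : Pred (V D) 0ℓ) : Set₁ where
  field
    isTModule : IsTModule W
    nonzero   : ¬ (W ≐ 𝟎)
    simple    : ¬ (Σ (Pred (V D) 0ℓ) λ U →
                     IsTModule U × U ⊆ W × ¬ (U ≐ 𝟎) × ¬ (U ≐ W))

infix 8 _⟪_⟫
_⟪_⟫ : ∀ {D} → Mat D → Pred (V D) 0ℓ → Pred (V D) 0ℓ
(M ⟪ W ⟫) v = ∃ λ w → w ∈ W × v ≋ M · w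

IsEndpoint : ∀ {D} → Pred (V D) 0ℓ → ℕ → Set
IsEndpoint {D} W r =
  r ℕ.≤ D × ¬ (E* r ⟪ W ⟫ ≐ 𝟎) ×
  (∀ i → i ℕ.≤ D → ¬ (E* i ⟪ W ⟫ ≐ 𝟎) → r ℕ.≤ i)

-- S is the set {i ≤ D | E*ᵢ W ≠ 0}; it has d + 1 elements.
IsDiameter : ∀ {D} → Pred (V D) 0ℓ → ℕ → Set
IsDiameter {D} W d = Σ (Subset (suc D)) λ S →
  (∀ i → i ∈ˢ S ⇔ (¬ (E* (toℕ i) ⟪ W ⟫ ≐ 𝟎))) × ∣ S ∣ ≡ suc d

------------------------------------------------------------------------
-- The hypergeometric sum

pochhammer : ℚ → ℕ → ℚ
pochhammer a zero    = 1ℚ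
pochhammer a (suc n) = pochhammer a n ℚ.* (a ℚ.+ ℕ→ℚ n)

₂F₁-term : (d i j n : ℕ) → ℚ
₂F₁-term d i j n =
  pochhammer (ℚ.- ℕ→ℚ i) n ℚ.* pochhammer (ℚ.- ℕ→ℚ j) n
  ℚ.* (pochhammer (ℚ.- ℕ→ℚ d) n ℚ.* ℕ→ℚ (n !)) ⁻¹
  ℚ.* ℕ→ℚ (2 ℕ.^ n)

-- ₂F₁(-i, -j; -d; 2), truncated at n = d so that (-d)ₙ ≠ 0 throughout
₂F₁ : (d i j : ℕ) → ℚ
₂F₁ d i j = foldr ℚ._+_ 0ℚ (map (₂F₁-term d i j) (upTo (suc d)))

{-# OPTIONS --safe #-}

-- V is the D-th tensor power of ℂ², on which A, A* and Aᵋ act as the derivations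
-- Σₖ 1⊗…⊗σ⊗…⊗1 for the Pauli matrices σx, σz, σy.  The matrix P is P₁⊗…⊗P₁ and
-- permutes the three cyclically by conjugation; P is a scalar multiple of a unitary
-- matrix and lies in T, so that every T-module W is P-invariant.  Hence parts (ii) and
-- (iii) follow from (i), and E*ᵢW = 0 for i < r implies the same for Eᵢ and Eᵋᵢ.  So
-- u and P uᵋ are highest weight vectors for the sl₂-triple with Cartan element A:
-- raising and lowering the components E*_{r+j} u has explicit coefficients.
-- Since A is diagonal on the Eᵢ and tridiagonal on the E*ⱼ, the inner products f(i,j)
-- of (i) satisfy the three-term recurrence of the Krawtchouk polynomials in j; a similar
-- recurrence in i gives f(i,0) = 𝐢ⁱ C(d,i) f(0,0), and Σⱼ f(0,j) = ⟨uᵋ,u⟩ gives f(0,0).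
module Submission where

open import Defs
open import Algebra.Bundles using (CommutativeRing; RawRing)
import Algebra.Properties.AbelianGroup as AbelianGroupProperties
import Algebra.Solver.Ring
open import Algebra.Solver.Ring.AlmostCommutativeRing
  using (fromCommutativeRing; _-Raw-AlmostCommutative⟶_)
open import Data.Bool.Base using (if_then_else_)
open import Data.Fin.Base as Fin using (Fin; toℕ)
open import Data.Fin.Patterns using (0F; 1F)
open import Data.Fin.Subset using (Subset; ∣_∣; inside; outside) renaming (_∈_ to _∈ˢ_)
open import Data.Fin.Subset.Properties using (drop-there)
open import Data.Integer.Base as ℤ using (+_)
import Data.Integer.Properties as ℤ
open import Data.List.Base as List using (List; []; _∷_; foldr; applyUpTo; upTo; filter)
open import Data.List.Membership.Propositional using () renaming (_∈_ to _∈ˡ_)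
open import Data.List.Membership.Propositional.Properties using (∈-filter⁺; ∈-filter⁻; ∈-upTo⁺)
open import Data.List.Properties using (map-upTo)
open import Data.List.Relation.Unary.Any using (here; there)
open import Data.Maybe.Base using (Maybe; just; nothing)
open import Data.Nat.Base as ℕ using (ℕ; zero; suc; z≤n; s≤s; _!; NonZero)
open import Data.Nat.Combinatorics using (_C_; nCk+nC[k+1]≡[n+1]C[k+1]; nC1≡n; k>n⇒nCk≡0)
import Data.Nat.Properties as ℕ
open import Data.Product.Base using (_×_; _,_; proj₁; proj₂; ∃)
open import Data.Rational.Base as ℚ using (ℚ; 0ℚ; 1ℚ; ½)
import Data.Rational.Properties as ℚ
import Data.Rational.Solver as ℚ
open import Data.Rational.Unnormalised.Base as ℚᵘ using (mkℚᵘ; *≡*)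
import Data.Rational.Unnormalised.Properties as ℚᵘ
open import Data.Vec.Base as Vec using ([]; _∷_; here; there)
open import Function.Base using (_∘_; case_of_)
open import Function.Bundles using (_⇔_; mk⇔; Equivalence)
open import Level using (0ℓ)
open import Relation.Binary.PropositionalEquality as ≡ using (_≡_; _≢_; module ≡-Reasoning)
open import Relation.Nullary using (¬_; yes; no; does; ¬?)
open import Relation.Nullary.Decidable using (dec-true; dec-false)
open import Relation.Nullary.Negation using (contradiction)
open import Relation.Unary using (Pred; _∈_; _≐_)

-- Three obstacles shape the details. Equality in ℂ is undecidable and the hypotheses on endpoint
-- and diameter are negative, so nonvanishing can only be refuted; equations are recovered because
-- equality of Cauchy reals is stable under double negation. The idempotents Eᵢ are products of
-- Lagrange factors in a matrix of size 2ᴰ. They are never multiplied out: each factor is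
-- transported by P to a factor in the diagonal matrix A*, where the product is a scalar at every
-- vertex. The recurrence in j is not read off from the hypergeometric sum directly. The sum is
-- first shown to satisfy the simpler relations of the coefficients of (1 - t)ⁱ(1 + t)ᵈ⁻ⁱ, and the
-- three-term recurrence follows from these by induction on i. The period three of the symmetry is
-- the identity P₁³ = 2(1 - 𝐢). It makes P⁻¹ a multiple of P² and reduces the claims about Aᵋ to
-- products of 2 × 2 matrices.

module ℚ-Solver where
  open ℚ.+-*-Solver public renaming
    ( solve to solveℚ; con to conℚ; _:=_ to _==_; _:+_ to _⊕_; _:*_ to _⊛_; _:-_ to _⊖_
    ; :-_ to ⊖_)

module ℝᴿ = CommutativeRing ℝ-commutativeRing
module ℂᴿ = CommutativeRing ℂ-commutativeRing

-- Rational arithmetic and Krawtchouk numbers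

module _ where
  open ℚ.+-*-Solver
  open ≡ using (refl; sym; trans; cong; cong₂; subst)

  -- `ℕ→ℚ` reduces fractions by a gcd, which is stuck on a variable numerator. On unnormalised
  -- rationals with denominator 1 the claim is integer arithmetic.
  ℕ→ℚ-+ : ∀ m n → ℕ→ℚ (m ℕ.+ n) ≡ ℕ→ℚ m ℚ.+ ℕ→ℚ n
  ℕ→ℚ-+ m n = ℚ.toℚᵘ-injective (begin
    ℚ.toℚᵘ (ℕ→ℚ (m ℕ.+ n))                    ≈⟨ ℚ.toℚᵘ-fromℚᵘ (mkℚᵘ (+ (m ℕ.+ n)) 0) ⟩
    mkℚᵘ (+ (m ℕ.+ n)) 0                       ≈⟨ *≡* (cong (ℤ._* + 1)
      (sym (cong₂ ℤ._+_ (ℤ.*-identityʳ (+ m)) (ℤ.*-identityʳ (+ n))))) ⟩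
    mkℚᵘ (+ m) 0 ℚᵘ.+ mkℚᵘ (+ n) 0             ≈⟨ ℚᵘ.+-cong (ℚ.toℚᵘ-fromℚᵘ (mkℚᵘ (+ m) 0))
                                                            (ℚ.toℚᵘ-fromℚᵘ (mkℚᵘ (+ n) 0)) ⟨
    ℚ.toℚᵘ (ℕ→ℚ m) ℚᵘ.+ ℚ.toℚᵘ (ℕ→ℚ n)         ≈⟨ ℚ.toℚᵘ-homo-+ (ℕ→ℚ m) (ℕ→ℚ n) ⟨
    ℚ.toℚᵘ (ℕ→ℚ m ℚ.+ ℕ→ℚ n)                  ∎)
    where open ℚᵘ.≃-Reasoning

  ℕ→ℚ-* : ∀ m n → ℕ→ℚ (m ℕ.* n) ≡ ℕ→ℚ m ℚ.* ℕ→ℚ n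
  ℕ→ℚ-* zero    n = sym (ℚ.*-zeroˡ (ℕ→ℚ n))
  ℕ→ℚ-* (suc m) n = begin
    ℕ→ℚ (n ℕ.+ m ℕ.* n)                 ≡⟨ ℕ→ℚ-+ n (m ℕ.* n) ⟩
    ℕ→ℚ n ℚ.+ ℕ→ℚ (m ℕ.* n)            ≡⟨ cong₂ ℚ._+_ (sym (ℚ.*-identityˡ (ℕ→ℚ n))) (ℕ→ℚ-* m n) ⟩
    1ℚ ℚ.* ℕ→ℚ n ℚ.+ ℕ→ℚ m ℚ.* ℕ→ℚ n  ≡⟨ ℚ.*-distribʳ-+ (ℕ→ℚ n) 1ℚ (ℕ→ℚ m) ⟨
    (1ℚ ℚ.+ ℕ→ℚ m) ℚ.* ℕ→ℚ n           ≡⟨ cong (ℚ._* ℕ→ℚ n) (ℕ→ℚ-+ 1 m) ⟨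
    ℕ→ℚ (suc m) ℚ.* ℕ→ℚ n              ∎
    where open ≡-Reasoning

  ℕ→ℚ-injective : ∀ {m n} → ℕ→ℚ m ≡ ℕ→ℚ n → m ≡ n
  ℕ→ℚ-injective {m} {n} eq = ℤ.+-injective (trans (sym (ℤ.*-identityʳ (+ m)))
    (trans (ℚᵘ.drop-*≡* (begin
      mkℚᵘ (+ m) 0        ≈⟨ ℚ.toℚᵘ-fromℚᵘ (mkℚᵘ (+ m) 0) ⟨
      ℚ.toℚᵘ (ℕ→ℚ m)     ≡⟨ cong ℚ.toℚᵘ eq ⟩
      ℚ.toℚᵘ (ℕ→ℚ n)     ≈⟨ ℚ.toℚᵘ-fromℚᵘ (mkℚᵘ (+ n) 0) ⟩
      mkℚᵘ (+ n) 0        ∎)) (ℤ.*-identityʳ (+ n))))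
    where open ℚᵘ.≃-Reasoning

  p*p⁻¹≡1 : ∀ {p} → p ≢ 0ℚ → p ℚ.* p ⁻¹ ≡ 1ℚ
  p*p⁻¹≡1 {p} p≢0 with p ℚ.≟ 0ℚ
  ... | yes p≡0 = contradiction p≡0 p≢0
  ... | no  p≢0′ = ℚ.*-inverseʳ p {{ℚ.≢-nonZero p≢0′}}

  p⁻¹*p≡1 : ∀ {p} → p ≢ 0ℚ → p ⁻¹ ℚ.* p ≡ 1ℚ
  p⁻¹*p≡1 {p} p≢0 = trans (ℚ.*-comm (p ⁻¹) p) (p*p⁻¹≡1 p≢0)

  *-cancelˡ : ∀ {p q r} → p ≢ 0ℚ → p ℚ.* q ≡ p ℚ.* r → q ≡ r
  *-cancelˡ {p} {q} {r} p≢0 eq = begin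
    q                          ≡⟨ expand q ⟩
    p ⁻¹ ℚ.* (p ℚ.* q)       ≡⟨ cong (p ⁻¹ ℚ.*_) eq ⟩
    p ⁻¹ ℚ.* (p ℚ.* r)       ≡⟨ expand r ⟨
    r                          ∎
    where
    open ≡-Reasoning
    expand : ∀ q → q ≡ p ⁻¹ ℚ.* (p ℚ.* q)
    expand q = trans (sym (ℚ.*-identityˡ q))
      (trans (cong (ℚ._* q) (sym (p⁻¹*p≡1 p≢0))) (ℚ.*-assoc (p ⁻¹) p q))

  p*q≢0 : ∀ {p q} → p ≢ 0ℚ → q ≢ 0ℚ → p ℚ.* q ≢ 0ℚ
  p*q≢0 {p} p≢0 q≢0 pq≡0 = q≢0 (*-cancelˡ p≢0 (trans pq≡0 (sym (ℚ.*-zeroʳ p))))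

  ℕ→ℚ-suc≢0 : ∀ n → ℕ→ℚ (suc n) ≢ 0ℚ
  ℕ→ℚ-suc≢0 n eq with () ← ℕ→ℚ-injective {suc n} {0} eq

  2ℚ : ℚ
  2ℚ = 1ℚ ℚ.+ 1ℚ

  -- Induction along Pascal's rule. The copy of `b` split off from the factor `suc (suc k)` is the
  -- one that completes `suc n` to `suc (suc n)` at the end.
  C-absorption : ∀ n k → suc k ℕ.* (suc n C suc k) ≡ suc n ℕ.* (n C k)
  C-absorption zero zero = refl
  C-absorption zero (suc k) = trans
      (cong (suc (suc k) ℕ.*_) (k>n⇒nCk≡0 {1} {suc (suc k)} (s≤s (s≤s z≤n))))
    (trans (ℕ.*-zeroʳ k) (sym (cong (1 ℕ.*_) (k>n⇒nCk≡0 {0} {suc k} (s≤s z≤n)))))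
  C-absorption (suc n) zero = trans (ℕ.*-identityˡ (suc (suc n) C 1))
    (trans (nC1≡n (suc (suc n))) (sym (ℕ.*-identityʳ (suc (suc n)))))
  C-absorption (suc n) (suc k) = begin
    suc (suc k) ℕ.* (suc (suc n) C suc (suc k))
      ≡⟨ cong (suc (suc k) ℕ.*_) (nCk+nC[k+1]≡[n+1]C[k+1] (suc n) (suc k)) ⟨
    suc (suc k) ℕ.* (b ℕ.+ (suc n C suc (suc k)))
      ≡⟨ ℕ.*-distribˡ-+ (suc (suc k)) b _ ⟩
    (b ℕ.+ suc k ℕ.* b) ℕ.+ suc (suc k) ℕ.* (suc n C suc (suc k))
      ≡⟨ cong₂ ℕ._+_ (cong (b ℕ.+_) (C-absorption n k)) (C-absorption n (suc k)) ⟩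
    (b ℕ.+ suc n ℕ.* (n C k)) ℕ.+ suc n ℕ.* (n C suc k)
      ≡⟨ ℕ.+-assoc b _ _ ⟩
    b ℕ.+ (suc n ℕ.* (n C k) ℕ.+ suc n ℕ.* (n C suc k))
      ≡⟨ cong (b ℕ.+_) (ℕ.*-distribˡ-+ (suc n) (n C k) _) ⟨
    b ℕ.+ suc n ℕ.* ((n C k) ℕ.+ (n C suc k))
      ≡⟨ cong (λ c → b ℕ.+ suc n ℕ.* c) (nCk+nC[k+1]≡[n+1]C[k+1] n k) ⟩
    b ℕ.+ suc n ℕ.* b ∎
    where
    open ≡-Reasoning
    b = suc n C suc k

  pochhammer-suc : ∀ a n → pochhammer a (suc n) ≡ a ℚ.* pochhammer (1ℚ ℚ.+ a) n
  pochhammer-suc a zero = solve 1 (λ a → con 1ℚ :* (a :+ con 0ℚ) := a :* con 1ℚ) refl a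
  pochhammer-suc a (suc n) = begin
    pochhammer a (suc n) ℚ.* (a ℚ.+ ℕ→ℚ (suc n))
      ≡⟨ cong₂ (λ p q → p ℚ.* (a ℚ.+ q)) (pochhammer-suc a n) (ℕ→ℚ-+ 1 n) ⟩
    a ℚ.* p ℚ.* (a ℚ.+ (1ℚ ℚ.+ ℕ→ℚ n))
      ≡⟨ solve 3 (λ a p n → a :* p :* (a :+ (con 1ℚ :+ n)) := a :* (p :* (con 1ℚ :+ a :+ n)))
           refl a p (ℕ→ℚ n) ⟩
    a ℚ.* (p ℚ.* (1ℚ ℚ.+ a ℚ.+ ℕ→ℚ n)) ∎
    where
    open ≡-Reasoning
    p = pochhammer (1ℚ ℚ.+ a) n

  1-[1+m]≡-m : ∀ m → 1ℚ ℚ.+ ℚ.- ℕ→ℚ (suc m) ≡ ℚ.- ℕ→ℚ m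
  1-[1+m]≡-m m = trans (cong (λ p → 1ℚ ℚ.+ ℚ.- p) (ℕ→ℚ-+ 1 m))
    (solve 1 (λ m → con 1ℚ :+ :- (con 1ℚ :+ m) := :- m) refl (ℕ→ℚ m))

  pochhammer-neg-suc : ∀ m n →
    pochhammer (ℚ.- ℕ→ℚ (suc m)) (suc n) ≡ ℚ.- ℕ→ℚ (suc m) ℚ.* pochhammer (ℚ.- ℕ→ℚ m) n
  pochhammer-neg-suc m n = trans (pochhammer-suc _ n)
    (cong (λ a → ℚ.- ℕ→ℚ (suc m) ℚ.* pochhammer a n) (1-[1+m]≡-m m))

  -- Up to sign (-m)ₙ is the falling factorial of m, and differencing in m lowers its degree by one.
  -- This is what makes a shift of i in the hypergeometric sum manageable.
  pochhammer-difference : ∀ m n →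
    pochhammer (ℚ.- ℕ→ℚ (suc m)) (suc n)
      ≡ pochhammer (ℚ.- ℕ→ℚ m) (suc n) ℚ.- ℕ→ℚ (suc n) ℚ.* pochhammer (ℚ.- ℕ→ℚ m) n
  pochhammer-difference m n = begin
    pochhammer (ℚ.- ℕ→ℚ (suc m)) (suc n)
      ≡⟨ pochhammer-neg-suc m n ⟩
    ℚ.- ℕ→ℚ (suc m) ℚ.* p
      ≡⟨ cong (λ q → ℚ.- q ℚ.* p) (ℕ→ℚ-+ 1 m) ⟩
    ℚ.- (1ℚ ℚ.+ ℕ→ℚ m) ℚ.* p
      ≡⟨ solve 3 (λ m n p → :- (con 1ℚ :+ m) :* p := p :* (:- m :+ n) :- (con 1ℚ :+ n) :* p)
           refl (ℕ→ℚ m) (ℕ→ℚ n) p ⟩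
    p ℚ.* (ℚ.- ℕ→ℚ m ℚ.+ ℕ→ℚ n) ℚ.- (1ℚ ℚ.+ ℕ→ℚ n) ℚ.* p
      ≡⟨ cong (λ q → p ℚ.* (ℚ.- ℕ→ℚ m ℚ.+ ℕ→ℚ n) ℚ.- q ℚ.* p) (ℕ→ℚ-+ 1 n) ⟨
    p ℚ.* (ℚ.- ℕ→ℚ m ℚ.+ ℕ→ℚ n) ℚ.- ℕ→ℚ (suc n) ℚ.* p ∎
    where
    open ≡-Reasoning
    p = pochhammer (ℚ.- ℕ→ℚ m) n

  -p≢0 : ∀ {p} → p ≢ 0ℚ → ℚ.- p ≢ 0ℚ
  -p≢0 p≢0 -p≡0 = p≢0 (ℚ.neg-injective -p≡0)

  -- The bound keeps all factors -m, ..., -m + n - 1 away from 0, so that `_⁻¹` is a true inverse in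
  -- the denominators of the truncated sum.
  pochhammer-neg≢0 : ∀ {m n} → n ℕ.≤ m → pochhammer (ℚ.- ℕ→ℚ m) n ≢ 0ℚ
  pochhammer-neg≢0 z≤n ()
  pochhammer-neg≢0 {suc m} {suc n} (s≤s n≤m) eq =
    p*q≢0 (-p≢0 (ℕ→ℚ-suc≢0 m)) (pochhammer-neg≢0 n≤m) (trans (sym (pochhammer-neg-suc m n)) eq)

  !≢0 : ∀ n → ℕ→ℚ (n !) ≢ 0ℚ
  !≢0 zero ()
  !≢0 (suc n) eq = p*q≢0 (ℕ→ℚ-suc≢0 n) (!≢0 n) (trans (sym (ℕ→ℚ-* (suc n) (n !))) eq)

  -- Hypergeometric sums and the Krawtchouk recurrences

  sumUpTo : (ℕ → ℚ) → ℕ → ℚ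
  sumUpTo f n = foldr ℚ._+_ 0ℚ (applyUpTo f n)

  -- The termwise identity is asked for k < n only, since `₂F₁-term-suc` is available just where the
  -- denominators are invertible.
  sumUpTo-combination : ∀ a b c (f g h : ℕ → ℚ) n →
    (∀ k → k ℕ.< n → a ℚ.* f k ≡ b ℚ.* g k ℚ.+ c ℚ.* h k) →
    a ℚ.* sumUpTo f n ≡ b ℚ.* sumUpTo g n ℚ.+ c ℚ.* sumUpTo h n
  sumUpTo-combination a b c f g h zero eq =
    solve 3 (λ a b c → a :* con 0ℚ := b :* con 0ℚ :+ c :* con 0ℚ) refl a b c
  sumUpTo-combination a b c f g h (suc n) eq = begin
    a ℚ.* (f 0 ℚ.+ F)                                  ≡⟨ ℚ.*-distribˡ-+ a (f 0) F ⟩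
    a ℚ.* f 0 ℚ.+ a ℚ.* F                              ≡⟨ cong₂ ℚ._+_ (eq 0 (s≤s z≤n))
      (sumUpTo-combination a b c (f ∘ suc) (g ∘ suc) (h ∘ suc) n λ k k<n → eq (suc k) (s≤s k<n)) ⟩
    b ℚ.* g 0 ℚ.+ c ℚ.* h 0 ℚ.+ (b ℚ.* G ℚ.+ c ℚ.* H)  ≡⟨ solve 6 (λ b g G c h H →
        b :* g :+ c :* h :+ (b :* G :+ c :* H) := b :* (g :+ G) :+ c :* (h :+ H))
        refl b (g 0) G c (h 0) H ⟩
    b ℚ.* (g 0 ℚ.+ G) ℚ.+ c ℚ.* (h 0 ℚ.+ H)            ∎
    where
    open ≡-Reasoning
    F = sumUpTo (f ∘ suc) n
    G = sumUpTo (g ∘ suc) n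
    H = sumUpTo (h ∘ suc) n

  sumUpTo-zero : ∀ {f} n → (∀ k → f k ≡ 0ℚ) → sumUpTo f n ≡ 0ℚ
  sumUpTo-zero zero    eq = refl
  sumUpTo-zero (suc n) eq = cong₂ ℚ._+_ (eq 0) (sumUpTo-zero n (eq ∘ suc))

  ₂F₁-sumUpTo : ∀ d i j → ₂F₁ d i j ≡ 1ℚ ℚ.+ sumUpTo (₂F₁-term d i j ∘ suc) d
  ₂F₁-sumUpTo d i j = cong (foldr ℚ._+_ 0ℚ) (map-upTo (₂F₁-term d i j) (suc d))

  pochhammer-0 : ∀ n → pochhammer 0ℚ (suc n) ≡ 0ℚ
  pochhammer-0 n = trans (pochhammer-suc 0ℚ n) (ℚ.*-zeroˡ (pochhammer (1ℚ ℚ.+ 0ℚ) n))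

  ₂F₁-zeroˡ : ∀ d j → ₂F₁ d 0 j ≡ 1ℚ
  ₂F₁-zeroˡ d j = trans (₂F₁-sumUpTo d 0 j) (cong (1ℚ ℚ.+_) (sumUpTo-zero d λ n →
    vanish (pochhammer-0 n) (pochhammer (ℚ.- ℕ→ℚ j) (suc n))
      ((pochhammer (ℚ.- ℕ→ℚ d) (suc n) ℚ.* ℕ→ℚ (suc n !)) ⁻¹) (ℕ→ℚ (2 ℕ.^ suc n))))
    where
    vanish : ∀ {z} → z ≡ 0ℚ → ∀ a b c → z ℚ.* a ℚ.* b ℚ.* c ≡ 0ℚ
    vanish refl = solve 3 (λ a b c → con 0ℚ :* a :* b :* c := con 0ℚ) refl

  ₂F₁-zeroʳ : ∀ d i → ₂F₁ d i 0 ≡ 1ℚ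
  ₂F₁-zeroʳ d i = trans (₂F₁-sumUpTo d i 0) (cong (1ℚ ℚ.+_) (sumUpTo-zero d λ n →
    vanish (pochhammer-0 n) (pochhammer (ℚ.- ℕ→ℚ i) (suc n))
      ((pochhammer (ℚ.- ℕ→ℚ d) (suc n) ℚ.* ℕ→ℚ (suc n !)) ⁻¹) (ℕ→ℚ (2 ℕ.^ suc n))))
    where
    vanish : ∀ {z} → z ≡ 0ℚ → ∀ a b c → a ℚ.* z ℚ.* b ℚ.* c ≡ 0ℚ
    vanish refl = solve 3 (λ a b c → a :* con 0ℚ :* b :* c := con 0ℚ) refl

  -- The coefficient of tʲ in (1 - t)ⁱ (1 + t)ᵈ⁻ⁱ; krawtchouk-suc and krawtchouk-pascal
  -- below are the resulting relations between generating functions.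
  krawtchouk : (d i j : ℕ) → ℚ
  krawtchouk d i j = ℕ→ℚ (d C j) ℚ.* ₂F₁ d i j

  krawtchouk-zeroˡ : ∀ d j → krawtchouk d 0 j ≡ ℕ→ℚ (d C j)
  krawtchouk-zeroˡ d j = trans (cong (ℕ→ℚ (d C j) ℚ.*_) (₂F₁-zeroˡ d j)) (ℚ.*-identityʳ _)

  krawtchouk-zeroʳ : ∀ d i → krawtchouk d i 0 ≡ 1ℚ
  krawtchouk-zeroʳ d i = trans (cong (ℕ→ℚ (d C 0) ℚ.*_) (₂F₁-zeroʳ d i)) (ℚ.*-identityʳ _)

  -- `pochhammer-difference` in i leaves over a term of index n, once a factor is peeled off
  -- everything else: `suc j` from the symbol in j, `suc d` and `suc n` from the denominator, 2 from
  -- the power. Absorption trades `suc j` against `suc d`, and only -2 survives.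
  ₂F₁-term-suc : ∀ d i j n → n ℕ.≤ d →
    ℕ→ℚ (suc d C suc j) ℚ.* ₂F₁-term (suc d) (suc i) (suc j) (suc n)
      ≡ ℕ→ℚ (suc d C suc j) ℚ.* ₂F₁-term (suc d) i (suc j) (suc n)
        ℚ.+ ℚ.- (2ℚ ℚ.* ℕ→ℚ (d C j)) ℚ.* ₂F₁-term d i j n
  ₂F₁-term-suc d i j n n≤d = begin
    c′ ℚ.* (pochhammer (ℚ.- ℕ→ℚ (suc i)) (suc n) ℚ.* pochhammer (ℚ.- ℕ→ℚ (suc j)) (suc n)
      ℚ.* q′⁻¹ ℚ.* ℕ→ℚ (2 ℕ.^ suc n))
      ≡⟨ cong (λ p → c′ ℚ.* (p ℚ.* pochhammer (ℚ.- ℕ→ℚ (suc j)) (suc n)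
           ℚ.* q′⁻¹ ℚ.* ℕ→ℚ (2 ℕ.^ suc n))) (pochhammer-difference i n) ⟩
    c′ ℚ.* ((a′ ℚ.- N ℚ.* a) ℚ.* pochhammer (ℚ.- ℕ→ℚ (suc j)) (suc n)
      ℚ.* q′⁻¹ ℚ.* ℕ→ℚ (2 ℕ.^ suc n))
      ≡⟨ solve 7 (λ c′ N a a′ b′ q′⁻¹ t → c′ :* ((a′ :- N :* a) :* b′ :* q′⁻¹ :* t)
           := c′ :* (a′ :* b′ :* q′⁻¹ :* t) :- c′ :* (N :* a :* b′ :* q′⁻¹ :* t)) refl
           c′ N a a′ (pochhammer (ℚ.- ℕ→ℚ (suc j)) (suc n)) q′⁻¹ (ℕ→ℚ (2 ℕ.^ suc n)) ⟩
    S ℚ.- c′ ℚ.* (N ℚ.* a ℚ.* pochhammer (ℚ.- ℕ→ℚ (suc j)) (suc n) ℚ.* q′⁻¹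
      ℚ.* ℕ→ℚ (2 ℕ.^ suc n))
      ≡⟨ cong₂ (λ p t → S ℚ.- c′ ℚ.* (N ℚ.* a ℚ.* p ℚ.* q′⁻¹ ℚ.* t))
           (pochhammer-neg-suc j n) (ℕ→ℚ-* 2 (2 ℕ.^ n)) ⟩
    S ℚ.- c′ ℚ.* (N ℚ.* a ℚ.* (ℚ.- J ℚ.* b) ℚ.* q′⁻¹ ℚ.* (2ℚ ℚ.* t))
      ≡⟨ solve 8 (λ S c′ N a J b q′⁻¹ t → S :- c′ :* (N :* a :* (:- J :* b) :* q′⁻¹ :* (con 2ℚ :* t))
           := S :+ con 2ℚ :* (J :* c′) :* (N :* a :* b :* q′⁻¹ :* t)) refl S c′ N a J b q′⁻¹ t ⟩
    S ℚ.+ 2ℚ ℚ.* (J ℚ.* c′) ℚ.* (N ℚ.* a ℚ.* b ℚ.* q′⁻¹ ℚ.* t)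
      ≡⟨ cong (λ p → S ℚ.+ 2ℚ ℚ.* p ℚ.* (N ℚ.* a ℚ.* b ℚ.* q′⁻¹ ℚ.* t)) absorb ⟩
    S ℚ.+ 2ℚ ℚ.* (M ℚ.* c) ℚ.* (N ℚ.* a ℚ.* b ℚ.* q′⁻¹ ℚ.* t)
      ≡⟨ solve 8 (λ S M c N a b q′⁻¹ t → S :+ con 2ℚ :* (M :* c) :* (N :* a :* b :* q′⁻¹ :* t)
           := S :+ :- (con 2ℚ :* c) :* (a :* b :* (:- M :* N :* q′⁻¹) :* t))
           refl S M c N a b q′⁻¹ t ⟩
    S ℚ.+ ℚ.- (2ℚ ℚ.* c) ℚ.* (a ℚ.* b ℚ.* (ℚ.- M ℚ.* N ℚ.* q′⁻¹) ℚ.* t)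
      ≡⟨ cong (λ p → S ℚ.+ ℚ.- (2ℚ ℚ.* c) ℚ.* (a ℚ.* b ℚ.* p ℚ.* t)) q′⁻¹-step ⟩
    S ℚ.+ ℚ.- (2ℚ ℚ.* c) ℚ.* (a ℚ.* b ℚ.* q ⁻¹ ℚ.* t) ∎
    where
    open ≡-Reasoning
    c c′ a a′ b t N J M q q′ q′⁻¹ S : ℚ
    c    = ℕ→ℚ (d C j)
    c′   = ℕ→ℚ (suc d C suc j)
    a    = pochhammer (ℚ.- ℕ→ℚ i) n
    a′   = pochhammer (ℚ.- ℕ→ℚ i) (suc n)
    b    = pochhammer (ℚ.- ℕ→ℚ j) n
    t    = ℕ→ℚ (2 ℕ.^ n)
    N    = ℕ→ℚ (suc n)
    J    = ℕ→ℚ (suc j)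
    M    = ℕ→ℚ (suc d)
    q    = pochhammer (ℚ.- ℕ→ℚ d) n ℚ.* ℕ→ℚ (n !)
    q′   = pochhammer (ℚ.- ℕ→ℚ (suc d)) (suc n) ℚ.* ℕ→ℚ (suc n !)
    q′⁻¹ = q′ ⁻¹
    S    = c′ ℚ.* ₂F₁-term (suc d) i (suc j) (suc n)
    absorb : J ℚ.* c′ ≡ M ℚ.* c
    absorb = trans (sym (ℕ→ℚ-* (suc j) (suc d C suc j)))
      (trans (cong ℕ→ℚ (C-absorption d j)) (ℕ→ℚ-* (suc d) (d C j)))
    q≢0 : q ≢ 0ℚ
    q≢0 = p*q≢0 (pochhammer-neg≢0 {d} {n} n≤d) (!≢0 n)
    q′≡ : q′ ≡ ℚ.- M ℚ.* N ℚ.* q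
    q′≡ = trans (cong₂ ℚ._*_ (pochhammer-neg-suc d n) (ℕ→ℚ-* (suc n) (n !)))
      (solve 4 (λ M N p f → :- M :* p :* (N :* f) := :- M :* N :* (p :* f)) refl
        M N (pochhammer (ℚ.- ℕ→ℚ d) n) (ℕ→ℚ (n !)))
    q′⁻¹-step : ℚ.- M ℚ.* N ℚ.* q′⁻¹ ≡ q ⁻¹
    q′⁻¹-step = *-cancelˡ q≢0 (trans
      (solve 4 (λ q M N r → q :* (:- M :* N :* r) := :- M :* N :* q :* r) refl q M N q′⁻¹)
      (trans (cong (ℚ._* q′⁻¹) (sym q′≡))
        (trans (p*p⁻¹≡1 λ q′≡0 → p*q≢0 (p*q≢0 (-p≢0 (ℕ→ℚ-suc≢0 d)) (ℕ→ℚ-suc≢0 n)) q≢0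
                  (trans (sym q′≡) q′≡0))
          (sym (p*p⁻¹≡1 q≢0)))))

  -- In generating functions: 1 - t = (1 + t) - 2t, multiplied by (1 - t)ⁱ(1 + t)ᵈ⁻ⁱ.
  krawtchouk-suc : ∀ d i j →
    krawtchouk (suc d) (suc i) (suc j) ≡ krawtchouk (suc d) i (suc j) ℚ.- 2ℚ ℚ.* krawtchouk d i j
  krawtchouk-suc d i j = begin
    c′ ℚ.* ₂F₁ (suc d) (suc i) (suc j)
      ≡⟨ cong (c′ ℚ.*_) (₂F₁-sumUpTo (suc d) (suc i) (suc j)) ⟩
    c′ ℚ.* (1ℚ ℚ.+ F)
      ≡⟨ solve 2 (λ c′ F → c′ :* (con 1ℚ :+ F) := c′ :+ c′ :* F) refl c′ F ⟩
    c′ ℚ.+ c′ ℚ.* F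
      -- The shift of n matches the ranges: the `suc d` terms of positive index for `suc d` face all
      -- terms of `₂F₁ d i j`, and the term of index 0 is the 1 split off before.
      ≡⟨ cong (c′ ℚ.+_) (sumUpTo-combination c′ c′ (ℚ.- (2ℚ ℚ.* c)) _ _ _ (suc d) λ n n<1+d →
           ₂F₁-term-suc d i j n (ℕ.s≤s⁻¹ n<1+d)) ⟩
    c′ ℚ.+ (c′ ℚ.* G ℚ.+ ℚ.- (2ℚ ℚ.* c) ℚ.* H)
      ≡⟨ solve 4 (λ c′ c G H → c′ :+ (c′ :* G :+ :- (con 2ℚ :* c) :* H)
           := c′ :* (con 1ℚ :+ G) :- con 2ℚ :* (c :* H)) refl c′ c G H ⟩
    c′ ℚ.* (1ℚ ℚ.+ G) ℚ.- 2ℚ ℚ.* (c ℚ.* H)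
      ≡⟨ cong₂ (λ p q → c′ ℚ.* p ℚ.- 2ℚ ℚ.* (c ℚ.* q)) (₂F₁-sumUpTo (suc d) i (suc j))
           (₂F₁-sumUpTo d i j) ⟨
    c′ ℚ.* ₂F₁ (suc d) i (suc j) ℚ.- 2ℚ ℚ.* (c ℚ.* ₂F₁ d i j) ∎
    where
    open ≡-Reasoning
    c′ = ℕ→ℚ (suc d C suc j)
    c  = ℕ→ℚ (d C j)
    F  = sumUpTo (₂F₁-term (suc d) (suc i) (suc j) ∘ suc) (suc d)
    G  = sumUpTo (₂F₁-term (suc d) i (suc j) ∘ suc) (suc d)
    H  = sumUpTo (₂F₁-term d i j) (suc d)

  -- Multiplication of the generating function by 1 + t. Both sides obey `krawtchouk-suc`, which
  -- reduces the claim to i = 0, that is, to Pascal's rule for binomial coefficients.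
  krawtchouk-pascal : ∀ d i j → i ℕ.≤ d →
    krawtchouk (suc d) i (suc j) ≡ krawtchouk d i (suc j) ℚ.+ krawtchouk d i j
  krawtchouk-pascal d zero j _ = begin
    krawtchouk (suc d) 0 (suc j)                ≡⟨ krawtchouk-zeroˡ (suc d) (suc j) ⟩
    ℕ→ℚ (suc d C suc j)                        ≡⟨ cong ℕ→ℚ (nCk+nC[k+1]≡[n+1]C[k+1] d j) ⟨
    ℕ→ℚ ((d C j) ℕ.+ (d C suc j))              ≡⟨ ℕ→ℚ-+ (d C j) (d C suc j) ⟩
    ℕ→ℚ (d C j) ℚ.+ ℕ→ℚ (d C suc j)           ≡⟨ ℚ.+-comm (ℕ→ℚ (d C j)) _ ⟩
    ℕ→ℚ (d C suc j) ℚ.+ ℕ→ℚ (d C j)           ≡⟨ cong₂ ℚ._+_ (krawtchouk-zeroˡ d (suc j))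
        (krawtchouk-zeroˡ d j) ⟨
    krawtchouk d 0 (suc j) ℚ.+ krawtchouk d 0 j ∎
    where open ≡-Reasoning
  krawtchouk-pascal (suc d) (suc i) zero (s≤s i≤d) = begin
    k (suc (suc d)) (suc i) 1
      ≡⟨ krawtchouk-suc (suc d) i 0 ⟩
    k (suc (suc d)) i 1 ℚ.- 2ℚ ℚ.* k (suc d) i 0
      ≡⟨ cong₂ (λ p q → p ℚ.- 2ℚ ℚ.* q) (krawtchouk-pascal (suc d) i 0 (ℕ.m≤n⇒m≤1+n i≤d))
           (krawtchouk-zeroʳ (suc d) i) ⟩
    k (suc d) i 1 ℚ.+ k (suc d) i 0 ℚ.- 2ℚ ℚ.* 1ℚ
      ≡⟨ cong (λ p → k (suc d) i 1 ℚ.+ p ℚ.- 2ℚ ℚ.* 1ℚ) (krawtchouk-zeroʳ (suc d) i) ⟩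
    k (suc d) i 1 ℚ.+ 1ℚ ℚ.- 2ℚ ℚ.* 1ℚ
      ≡⟨ solve 1 (λ x → x :+ con 1ℚ :- con 2ℚ :* con 1ℚ := x :- con 2ℚ :* con 1ℚ :+ con 1ℚ) refl
           (k (suc d) i 1) ⟩
    k (suc d) i 1 ℚ.- 2ℚ ℚ.* 1ℚ ℚ.+ 1ℚ
      ≡⟨ cong₂ (λ p q → k (suc d) i 1 ℚ.- 2ℚ ℚ.* p ℚ.+ q) (krawtchouk-zeroʳ d i)
           (krawtchouk-zeroʳ (suc d) (suc i)) ⟨
    k (suc d) i 1 ℚ.- 2ℚ ℚ.* k d i 0 ℚ.+ k (suc d) (suc i) 0
      ≡⟨ cong (ℚ._+ k (suc d) (suc i) 0) (krawtchouk-suc d i 0) ⟨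
    k (suc d) (suc i) 1 ℚ.+ k (suc d) (suc i) 0 ∎
    where
    open ≡-Reasoning
    k = krawtchouk
  krawtchouk-pascal (suc d) (suc i) (suc j) (s≤s i≤d) = begin
    k (suc (suc d)) (suc i) (suc (suc j))
      ≡⟨ krawtchouk-suc (suc d) i (suc j) ⟩
    k (suc (suc d)) i (suc (suc j)) ℚ.- 2ℚ ℚ.* k (suc d) i (suc j)
      ≡⟨ cong₂ (λ p q → p ℚ.- 2ℚ ℚ.* q) (krawtchouk-pascal (suc d) i (suc j) (ℕ.m≤n⇒m≤1+n i≤d))
           (krawtchouk-pascal d i j i≤d) ⟩
    a ℚ.+ b ℚ.- 2ℚ ℚ.* (e ℚ.+ f)
      ≡⟨ solve 4 (λ a b e f → a :+ b :- con 2ℚ :* (e :+ f)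
           := (a :- con 2ℚ :* e) :+ (b :- con 2ℚ :* f)) refl a b e f ⟩
    (a ℚ.- 2ℚ ℚ.* e) ℚ.+ (b ℚ.- 2ℚ ℚ.* f)
      ≡⟨ cong₂ ℚ._+_ (krawtchouk-suc d i (suc j)) (krawtchouk-suc d i j) ⟨
    k (suc d) (suc i) (suc (suc j)) ℚ.+ k (suc d) (suc i) (suc j) ∎
    where
    open ≡-Reasoning
    k = krawtchouk
    a = k (suc d) i (suc (suc j))
    b = k (suc d) i (suc j)
    e = k d i (suc j)
    f = k d i j

  -- Absorption minus (k + 1) times `n C k`. Over ℚ no subtraction is truncated, so the identity
  -- also covers k ≥ n, where both sides are 0.
  C-step : ∀ n k → ℕ→ℚ (suc k) ℚ.* ℕ→ℚ (n C suc k) ≡ (ℕ→ℚ n ℚ.- ℕ→ℚ k) ℚ.* ℕ→ℚ (n C k)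
  C-step n k = begin
    ℕ→ℚ (suc k) ℚ.* b
      ≡⟨ solve 3 (λ K a b → K :* b := K :* (a :+ b) :- K :* a) refl (ℕ→ℚ (suc k)) a b ⟩
    ℕ→ℚ (suc k) ℚ.* (a ℚ.+ b) ℚ.- ℕ→ℚ (suc k) ℚ.* a
      ≡⟨ cong₂ (λ p q → p ℚ.- q ℚ.* a) absorb (ℕ→ℚ-+ 1 k) ⟩
    (1ℚ ℚ.+ ℕ→ℚ n) ℚ.* a ℚ.- (1ℚ ℚ.+ ℕ→ℚ k) ℚ.* a
      ≡⟨ solve 3 (λ N K a → (con 1ℚ :+ N) :* a :- (con 1ℚ :+ K) :* a := (N :- K) :* a) refl
           (ℕ→ℚ n) (ℕ→ℚ k) a ⟩
    (ℕ→ℚ n ℚ.- ℕ→ℚ k) ℚ.* a ∎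
    where
    open ≡-Reasoning
    a = ℕ→ℚ (n C k)
    b = ℕ→ℚ (n C suc k)
    absorb : ℕ→ℚ (suc k) ℚ.* (a ℚ.+ b) ≡ (1ℚ ℚ.+ ℕ→ℚ n) ℚ.* a
    absorb = begin
      ℕ→ℚ (suc k) ℚ.* (a ℚ.+ b)
        ≡⟨ cong (ℕ→ℚ (suc k) ℚ.*_) (ℕ→ℚ-+ (n C k) (n C suc k)) ⟨
      ℕ→ℚ (suc k) ℚ.* ℕ→ℚ ((n C k) ℕ.+ (n C suc k))
        ≡⟨ ℕ→ℚ-* (suc k) ((n C k) ℕ.+ (n C suc k)) ⟨
      ℕ→ℚ (suc k ℕ.* ((n C k) ℕ.+ (n C suc k)))
        ≡⟨ cong (λ c → ℕ→ℚ (suc k ℕ.* c)) (nCk+nC[k+1]≡[n+1]C[k+1] n k) ⟩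
      ℕ→ℚ (suc k ℕ.* (suc n C suc k))
        ≡⟨ cong ℕ→ℚ (C-absorption n k) ⟩
      ℕ→ℚ (suc n ℕ.* (n C k))
        ≡⟨ ℕ→ℚ-* (suc n) (n C k) ⟩
      ℕ→ℚ (suc n) ℚ.* a
        ≡⟨ cong (ℚ._* a) (ℕ→ℚ-+ 1 n) ⟩
      (1ℚ ℚ.+ ℕ→ℚ n) ℚ.* a ∎

  krawtchouk-one : ∀ d i → i ℕ.≤ d →
    krawtchouk d i 1 ≡ ℕ→ℚ d ℚ.- 2ℚ ℚ.* ℕ→ℚ i
  krawtchouk-one d zero _ = trans (krawtchouk-zeroˡ d 1) (trans (cong ℕ→ℚ (nC1≡n d))
    (solve 1 (λ d → d := d :- con 2ℚ :* con 0ℚ) refl (ℕ→ℚ d)))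
  krawtchouk-one (suc d) (suc i) (s≤s i≤d) = begin
    krawtchouk (suc d) (suc i) 1
      ≡⟨ krawtchouk-suc d i 0 ⟩
    krawtchouk (suc d) i 1 ℚ.- 2ℚ ℚ.* krawtchouk d i 0
      ≡⟨ cong₂ (λ p q → p ℚ.- 2ℚ ℚ.* q) (krawtchouk-one (suc d) i (ℕ.m≤n⇒m≤1+n i≤d))
           (krawtchouk-zeroʳ d i) ⟩
    ℕ→ℚ (suc d) ℚ.- 2ℚ ℚ.* ℕ→ℚ i ℚ.- 2ℚ ℚ.* 1ℚ
      ≡⟨ solve 2 (λ d i → d :- con 2ℚ :* i :- con 2ℚ :* con 1ℚ := d :- con 2ℚ :* (con 1ℚ :+ i)) refl
           (ℕ→ℚ (suc d)) (ℕ→ℚ i) ⟩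
    ℕ→ℚ (suc d) ℚ.- 2ℚ ℚ.* (1ℚ ℚ.+ ℕ→ℚ i)
      ≡⟨ cong (λ p → ℕ→ℚ (suc d) ℚ.- 2ℚ ℚ.* p) (ℕ→ℚ-+ 1 i) ⟨
    ℕ→ℚ (suc d) ℚ.- 2ℚ ℚ.* ℕ→ℚ (suc i) ∎
    where open ≡-Reasoning

  -- The coefficient of tʲ⁺¹ in (1 - t²)G' = (d - 2i - dt)G, an equation satisfied by G = (1 - t)ⁱ(1
  -- + t)ᵈ⁻ⁱ. The induction on i starts from `C-step`.
  krawtchouk-recurrence : ∀ d i j → i ℕ.≤ d →
    (ℕ→ℚ d ℚ.- 2ℚ ℚ.* ℕ→ℚ i) ℚ.* krawtchouk d i (suc j)
      ≡ ℕ→ℚ (suc (suc j)) ℚ.* krawtchouk d i (suc (suc j))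
        ℚ.+ (ℕ→ℚ d ℚ.- ℕ→ℚ j) ℚ.* krawtchouk d i j
  krawtchouk-recurrence d zero j _ = begin
    (D ℚ.- 2ℚ ℚ.* 0ℚ) ℚ.* krawtchouk d 0 (suc j)
      ≡⟨ cong ((D ℚ.- 2ℚ ℚ.* 0ℚ) ℚ.*_) (krawtchouk-zeroˡ d (suc j)) ⟩
    (D ℚ.- 2ℚ ℚ.* 0ℚ) ℚ.* b
      ≡⟨ solve 3 (λ D J b → (D :- con 2ℚ :* con 0ℚ) :* b
           := (D :- (con 1ℚ :+ J)) :* b :+ (con 1ℚ :+ J) :* b) refl D (ℕ→ℚ j) b ⟩
    (D ℚ.- (1ℚ ℚ.+ ℕ→ℚ j)) ℚ.* b ℚ.+ (1ℚ ℚ.+ ℕ→ℚ j) ℚ.* b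
      ≡⟨ cong (λ p → (D ℚ.- p) ℚ.* b ℚ.+ p ℚ.* b) (ℕ→ℚ-+ 1 j) ⟨
    (D ℚ.- ℕ→ℚ (suc j)) ℚ.* b ℚ.+ ℕ→ℚ (suc j) ℚ.* b
      ≡⟨ cong₂ ℚ._+_ (sym (C-step d (suc j))) (C-step d j) ⟩
    ℕ→ℚ (suc (suc j)) ℚ.* ℕ→ℚ (d C suc (suc j)) ℚ.+ (D ℚ.- ℕ→ℚ j) ℚ.* ℕ→ℚ (d C j)
      ≡⟨ cong₂ (λ p q → ℕ→ℚ (suc (suc j)) ℚ.* p ℚ.+ (D ℚ.- ℕ→ℚ j) ℚ.* q)
           (krawtchouk-zeroˡ d (suc (suc j))) (krawtchouk-zeroˡ d j) ⟨
    ℕ→ℚ (suc (suc j)) ℚ.* krawtchouk d 0 (suc (suc j)) ℚ.+ (D ℚ.- ℕ→ℚ j) ℚ.* krawtchouk d 0 j ∎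
    where
    open ≡-Reasoning
    D = ℕ→ℚ d
    b = ℕ→ℚ (d C suc j)
  -- The coefficient of t⁰ is out of reach of `krawtchouk-suc`; here the coefficients of t⁰ and t¹
  -- are used in closed form.
  krawtchouk-recurrence (suc d) (suc i) zero (s≤s i≤d) = begin
    (ℕ→ℚ (suc d) ℚ.- 2ℚ ℚ.* ℕ→ℚ (suc i)) ℚ.* krawtchouk (suc d) (suc i) 1
      ≡⟨ cong₂ (λ p q → (p ℚ.- 2ℚ ℚ.* q) ℚ.* krawtchouk (suc d) (suc i) 1) (ℕ→ℚ-+ 1 d) (ℕ→ℚ-+ 1 i) ⟩
    (1ℚ ℚ.+ D ℚ.- 2ℚ ℚ.* (1ℚ ℚ.+ I)) ℚ.* krawtchouk (suc d) (suc i) 1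
      ≡⟨ cong ((1ℚ ℚ.+ D ℚ.- 2ℚ ℚ.* (1ℚ ℚ.+ I)) ℚ.*_) (trans (krawtchouk-one (suc d) (suc i) (s≤s i≤d))
           (cong₂ (λ p q → p ℚ.- 2ℚ ℚ.* q) (ℕ→ℚ-+ 1 d) (ℕ→ℚ-+ 1 i))) ⟩
    (1ℚ ℚ.+ D ℚ.- 2ℚ ℚ.* (1ℚ ℚ.+ I)) ℚ.* (1ℚ ℚ.+ D ℚ.- 2ℚ ℚ.* (1ℚ ℚ.+ I))
      ≡⟨ solve 2 (λ D I → (con 1ℚ :+ D :- con 2ℚ :* (con 1ℚ :+ I)) :*
          (con 1ℚ :+ D :- con 2ℚ :* (con 1ℚ :+ I))
           := (con 1ℚ :+ D :- con 2ℚ :* I) :* (con 1ℚ :+ D :- con 2ℚ :* I)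
              :- con 2ℚ :* (con 2ℚ :* (D :- con 2ℚ :* I))) refl D I ⟩
    (1ℚ ℚ.+ D ℚ.- 2ℚ ℚ.* I) ℚ.* (1ℚ ℚ.+ D ℚ.- 2ℚ ℚ.* I) ℚ.- 2ℚ ℚ.* (2ℚ ℚ.* (D ℚ.- 2ℚ ℚ.* I))
      ≡⟨ cong₂ (λ p q → p ℚ.- 2ℚ ℚ.* (2ℚ ℚ.* q)) square (sym (krawtchouk-one d i i≤d)) ⟩
    (2ℚ ℚ.* a ℚ.+ (ℕ→ℚ (suc d) ℚ.- 0ℚ) ℚ.* krawtchouk (suc d) i 0) ℚ.- 2ℚ ℚ.* (2ℚ ℚ.* b)
      ≡⟨ cong (λ p → (2ℚ ℚ.* a ℚ.+ (ℕ→ℚ (suc d) ℚ.- 0ℚ) ℚ.* p) ℚ.- 2ℚ ℚ.* (2ℚ ℚ.* b))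
           (trans (krawtchouk-zeroʳ (suc d) i) (sym (krawtchouk-zeroʳ (suc d) (suc i)))) ⟩
    (2ℚ ℚ.* a ℚ.+ (ℕ→ℚ (suc d) ℚ.- 0ℚ) ℚ.* krawtchouk (suc d) (suc i) 0) ℚ.- 2ℚ ℚ.* (2ℚ ℚ.* b)
      ≡⟨ solve 3 (λ a b c → (con 2ℚ :* a :+ c) :- con 2ℚ :* (con 2ℚ :* b)
           := con 2ℚ :* (a :- con 2ℚ :* b) :+ c) refl a b
           ((ℕ→ℚ (suc d) ℚ.- 0ℚ) ℚ.* krawtchouk (suc d) (suc i) 0) ⟩
    2ℚ ℚ.* (a ℚ.- 2ℚ ℚ.* b) ℚ.+ (ℕ→ℚ (suc d) ℚ.- 0ℚ) ℚ.* krawtchouk (suc d) (suc i) 0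
      ≡⟨ cong (λ p → 2ℚ ℚ.* p ℚ.+ (ℕ→ℚ (suc d) ℚ.- 0ℚ) ℚ.* krawtchouk (suc d) (suc i) 0)
           (krawtchouk-suc d i 1) ⟨
    2ℚ ℚ.* krawtchouk (suc d) (suc i) 2 ℚ.+ (ℕ→ℚ (suc d) ℚ.- 0ℚ) ℚ.* krawtchouk (suc d) (suc i) 0 ∎
    where
    open ≡-Reasoning
    D = ℕ→ℚ d
    I = ℕ→ℚ i
    a = krawtchouk (suc d) i 2
    b = krawtchouk d i 1
    square : (1ℚ ℚ.+ D ℚ.- 2ℚ ℚ.* I) ℚ.* (1ℚ ℚ.+ D ℚ.- 2ℚ ℚ.* I)
      ≡ 2ℚ ℚ.* a ℚ.+ (ℕ→ℚ (suc d) ℚ.- 0ℚ) ℚ.* krawtchouk (suc d) i 0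
    square = trans (cong (λ p → (p ℚ.- 2ℚ ℚ.* I) ℚ.* (p ℚ.- 2ℚ ℚ.* I)) (sym (ℕ→ℚ-+ 1 d)))
      (trans (cong ((ℕ→ℚ (suc d) ℚ.- 2ℚ ℚ.* I) ℚ.*_)
          (sym (krawtchouk-one (suc d) i (ℕ.m≤n⇒m≤1+n i≤d))))
        (krawtchouk-recurrence (suc d) i 0 (ℕ.m≤n⇒m≤1+n i≤d)))
  krawtchouk-recurrence (suc d) (suc i) (suc j) (s≤s i≤d) = begin
    (ℕ→ℚ (suc d) ℚ.- 2ℚ ℚ.* ℕ→ℚ (suc i)) ℚ.* krawtchouk (suc d) (suc i) (suc (suc j))
      ≡⟨ cong₂ ℚ._*_ (cong (λ p → ℕ→ℚ (suc d) ℚ.- 2ℚ ℚ.* p) (ℕ→ℚ-+ 1 i)) (krawtchouk-suc d i (suc j)) ⟩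
    (ℕ→ℚ (suc d) ℚ.- 2ℚ ℚ.* (1ℚ ℚ.+ I)) ℚ.* (a₁ ℚ.- 2ℚ ℚ.* b₁)
      ≡⟨ solve 4 (λ D I a b → (D :- con 2ℚ :* (con 1ℚ :+ I)) :* (a :- con 2ℚ :* b)
           := (D :- con 2ℚ :* I) :* a :- con 2ℚ :* a
              :- con 2ℚ :* ((D :- con 1ℚ :- con 2ℚ :* I) :* b) :+ con 2ℚ :* b) refl
           (ℕ→ℚ (suc d)) I a₁ b₁ ⟩
    (ℕ→ℚ (suc d) ℚ.- 2ℚ ℚ.* I) ℚ.* a₁ ℚ.- 2ℚ ℚ.* a₁
      ℚ.- 2ℚ ℚ.* ((ℕ→ℚ (suc d) ℚ.- 1ℚ ℚ.- 2ℚ ℚ.* I) ℚ.* b₁) ℚ.+ 2ℚ ℚ.* b₁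
      ≡⟨ cong (λ p → (ℕ→ℚ (suc d) ℚ.- 2ℚ ℚ.* I) ℚ.* a₁ ℚ.- 2ℚ ℚ.* a₁
           ℚ.- 2ℚ ℚ.* ((p ℚ.- 2ℚ ℚ.* I) ℚ.* b₁) ℚ.+ 2ℚ ℚ.* b₁) d-1 ⟩
    (ℕ→ℚ (suc d) ℚ.- 2ℚ ℚ.* I) ℚ.* a₁ ℚ.- 2ℚ ℚ.* a₁
      ℚ.- 2ℚ ℚ.* ((D ℚ.- 2ℚ ℚ.* I) ℚ.* b₁) ℚ.+ 2ℚ ℚ.* b₁
      -- Pascal's rule trades the stray `a₁` for `b₂` plus `b₁`: then `b₁` cancels, and `b₂` lifts
      -- the coefficient j + 2 from the recurrence for `d` to the required j + 3.
      ≡⟨ cong₂ (λ p q → p ℚ.- 2ℚ ℚ.* q ℚ.- 2ℚ ℚ.* ((D ℚ.- 2ℚ ℚ.* I) ℚ.* b₁) ℚ.+ 2ℚ ℚ.* b₁)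
           (krawtchouk-recurrence (suc d) i (suc j) (ℕ.m≤n⇒m≤1+n i≤d))
           (krawtchouk-pascal d i (suc j) i≤d) ⟩
    (ℕ→ℚ (3 ℕ.+ j) ℚ.* a₂ ℚ.+ (ℕ→ℚ (suc d) ℚ.- ℕ→ℚ (suc j)) ℚ.* a₀) ℚ.- 2ℚ ℚ.* (b₂ ℚ.+ b₁)
      ℚ.- 2ℚ ℚ.* ((D ℚ.- 2ℚ ℚ.* I) ℚ.* b₁) ℚ.+ 2ℚ ℚ.* b₁
      ≡⟨ cong (λ p → (ℕ→ℚ (3 ℕ.+ j) ℚ.* a₂ ℚ.+ (ℕ→ℚ (suc d) ℚ.- ℕ→ℚ (suc j)) ℚ.* a₀)
           ℚ.- 2ℚ ℚ.* (b₂ ℚ.+ b₁) ℚ.- 2ℚ ℚ.* p ℚ.+ 2ℚ ℚ.* b₁)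
           (krawtchouk-recurrence d i j i≤d) ⟩
    (ℕ→ℚ (3 ℕ.+ j) ℚ.* a₂ ℚ.+ (ℕ→ℚ (suc d) ℚ.- ℕ→ℚ (suc j)) ℚ.* a₀) ℚ.- 2ℚ ℚ.* (b₂ ℚ.+ b₁)
      ℚ.- 2ℚ ℚ.* (ℕ→ℚ (2 ℕ.+ j) ℚ.* b₂ ℚ.+ (D ℚ.- ℕ→ℚ j) ℚ.* b₀) ℚ.+ 2ℚ ℚ.* b₁
      ≡⟨ cong₂ (λ p q → (ℕ→ℚ (3 ℕ.+ j) ℚ.* a₂ ℚ.+ (ℕ→ℚ (suc d) ℚ.- ℕ→ℚ (suc j)) ℚ.* a₀)
           ℚ.- 2ℚ ℚ.* (b₂ ℚ.+ b₁) ℚ.- 2ℚ ℚ.* (p ℚ.* b₂ ℚ.+ q ℚ.* b₀) ℚ.+ 2ℚ ℚ.* b₁)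
           j+2 d-j ⟩
    (ℕ→ℚ (3 ℕ.+ j) ℚ.* a₂ ℚ.+ (ℕ→ℚ (suc d) ℚ.- ℕ→ℚ (suc j)) ℚ.* a₀) ℚ.- 2ℚ ℚ.* (b₂ ℚ.+ b₁)
      ℚ.- 2ℚ ℚ.* ((ℕ→ℚ (3 ℕ.+ j) ℚ.- 1ℚ) ℚ.* b₂ ℚ.+ (ℕ→ℚ (suc d) ℚ.- ℕ→ℚ (suc j)) ℚ.* b₀)
      ℚ.+ 2ℚ ℚ.* b₁
      ≡⟨ solve 7 (λ J M a₀ a₂ b₀ b₁ b₂ → (J :* a₂ :+ M :* a₀) :- con 2ℚ :* (b₂ :+ b₁)
           :- con 2ℚ :* ((J :- con 1ℚ) :* b₂ :+ M :* b₀) :+ con 2ℚ :* b₁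
           := J :* (a₂ :- con 2ℚ :* b₂) :+ M :* (a₀ :- con 2ℚ :* b₀)) refl
           (ℕ→ℚ (3 ℕ.+ j)) (ℕ→ℚ (suc d) ℚ.- ℕ→ℚ (suc j)) a₀ a₂ b₀ b₁ b₂ ⟩
    ℕ→ℚ (3 ℕ.+ j) ℚ.* (a₂ ℚ.- 2ℚ ℚ.* b₂)
      ℚ.+ (ℕ→ℚ (suc d) ℚ.- ℕ→ℚ (suc j)) ℚ.* (a₀ ℚ.- 2ℚ ℚ.* b₀)
      ≡⟨ cong₂ (λ p q → ℕ→ℚ (3 ℕ.+ j) ℚ.* p ℚ.+ (ℕ→ℚ (suc d) ℚ.- ℕ→ℚ (suc j)) ℚ.* q)
           (krawtchouk-suc d i (suc (suc j))) (krawtchouk-suc d i j) ⟨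
    ℕ→ℚ (3 ℕ.+ j) ℚ.* krawtchouk (suc d) (suc i) (3 ℕ.+ j)
      ℚ.+ (ℕ→ℚ (suc d) ℚ.- ℕ→ℚ (suc j)) ℚ.* krawtchouk (suc d) (suc i) (suc j) ∎
    where
    open ≡-Reasoning
    D = ℕ→ℚ d
    I = ℕ→ℚ i
    a₀ = krawtchouk (suc d) i (suc j)
    a₁ = krawtchouk (suc d) i (suc (suc j))
    a₂ = krawtchouk (suc d) i (3 ℕ.+ j)
    b₀ = krawtchouk d i j
    b₁ = krawtchouk d i (suc j)
    b₂ = krawtchouk d i (suc (suc j))
    d-1 : ℕ→ℚ (suc d) ℚ.- 1ℚ ≡ D
    d-1 = trans (cong (ℚ._- 1ℚ) (ℕ→ℚ-+ 1 d)) (solve 1 (λ D → con 1ℚ :+ D :- con 1ℚ := D) refl D)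
    j+2 : ℕ→ℚ (2 ℕ.+ j) ≡ ℕ→ℚ (3 ℕ.+ j) ℚ.- 1ℚ
    j+2 = trans (solve 1 (λ J → J := con 1ℚ :+ J :- con 1ℚ) refl (ℕ→ℚ (2 ℕ.+ j)))
      (cong (ℚ._- 1ℚ) (sym (ℕ→ℚ-+ 1 (2 ℕ.+ j))))
    d-j : D ℚ.- ℕ→ℚ j ≡ ℕ→ℚ (suc d) ℚ.- ℕ→ℚ (suc j)
    d-j = trans (solve 2 (λ D J → D :- J := con 1ℚ :+ D :- (con 1ℚ :+ J)) refl D (ℕ→ℚ j))
      (sym (cong₂ ℚ._-_ (ℕ→ℚ-+ 1 d) (ℕ→ℚ-+ 1 j)))

-- Complex numbers, with a ring solver over ℚ[𝐢]

module _ where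
  open ℚ.+-*-Solver
  open ≡ using (refl; sym; cong; subst)

  ≈ʳ-pointwise : ∀ {x y} → (∀ n → seq x n ≡ seq y n) → x ≈ʳ y
  ≈ʳ-pointwise {x} {y} eq = mk≈ λ ε 0<ε → 0 , λ n _ →
    subst (λ p → ℚ.∣ seq x n ℚ.- p ∣ ℚ.< ε) (eq n)
      (subst (ℚ._< ε) (sym (cong ℚ.∣_∣ (ℚ.+-inverseʳ (seq x n)))) 0<ε)

  -- The threshold is taken from the Cauchy moduli of x and y, which exist without any equality. At
  -- a fixed n the claim is a decidable inequality of rationals, and there the doubly negated
  -- equality may be used.
  ≈ʳ-stable : ∀ {x y} → ¬ ¬ (x ≈ʳ y) → x ≈ʳ y
  ≈ʳ-stable {x} {y} ¬¬x≈y = mk≈ λ ε 0<ε → bound ε 0<ε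
    where
    third = + 1 ℚ./ 3
    split : ∀ a b c d → (a ℚ.- b) ℚ.+ (b ℚ.- c) ℚ.+ (c ℚ.- d) ≡ a ℚ.- d
    split = solve 4 (λ a b c d → (a :- b) :+ (b :- c) :+ (c :- d) := a :- d) refl
    sum-δ : ∀ ε → third ℚ.* ε ℚ.+ third ℚ.* ε ℚ.+ third ℚ.* ε ≡ ε
    sum-δ = solve 1 (λ ε → con third :* ε :+ con third :* ε :+ con third :* ε := ε) refl
    bound : ∀ ε → 0ℚ ℚ.< ε →
      ∃ λ N → ∀ n → N ℕ.≤ n → ℚ.∣ seq x n ℚ.- seq y n ∣ ℚ.< ε
    bound ε 0<ε = N ℕ.⊔ M , λ n N⊔M≤n → near n N⊔M≤n
      where
      δ = third ℚ.* ε
      0<δ : 0ℚ ℚ.< δ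
      0<δ = subst (ℚ._< δ) (ℚ.*-zeroʳ third) (ℚ.*-monoʳ-<-pos third 0<ε)
      N = proj₁ (cauchy x δ 0<δ)
      M = proj₁ (cauchy y δ 0<δ)
      near : ∀ n → N ℕ.⊔ M ℕ.≤ n → ℚ.∣ seq x n ℚ.- seq y n ∣ ℚ.< ε
      near n N⊔M≤n with ℚ.∣ seq x n ℚ.- seq y n ∣ ℚ.<? ε
      ... | yes lt = lt
      ... | no ≮ε = contradiction (λ x≈y → ≮ε (close-to x≈y)) ¬¬x≈y
        where
        close-to : x ≈ʳ y → ℚ.∣ seq x n ℚ.- seq y n ∣ ℚ.< ε
        close-to x≈y = subst (ℚ.∣ seq x n ℚ.- seq y n ∣ ℚ.<_) (sum-δ ε)
          (ℚ.≤-<-trans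
            (subst (λ p → ℚ.∣ p ∣ ℚ.≤ ℚ.∣ a ∣ ℚ.+ ℚ.∣ b ∣ ℚ.+ ℚ.∣ c ∣)
              (split (seq x n) (seq x m) (seq y m) (seq y n))
              (ℚ.≤-trans (ℚ.∣p+q∣≤∣p∣+∣q∣ (a ℚ.+ b) c)
                (ℚ.+-monoˡ-≤ ℚ.∣ c ∣ (ℚ.∣p+q∣≤∣p∣+∣q∣ a b))))
            (ℚ.+-mono-< (ℚ.+-mono-< a< b<) c<))
          where
          K = proj₁ (close x≈y δ 0<δ)
          -- This index lives only inside the refutation, as `K` comes from the assumed equality.
          -- Passing from n to m and back costs δ for each sequence, hence the thirds.
          m = N ℕ.⊔ M ℕ.⊔ K
          N⊔M≤m = ℕ.m≤m⊔n (N ℕ.⊔ M) K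
          a = seq x n ℚ.- seq x m
          b = seq x m ℚ.- seq y m
          c = seq y m ℚ.- seq y n
          a< : ℚ.∣ a ∣ ℚ.< δ
          a< = proj₂ (cauchy x δ 0<δ) n m
            (ℕ.≤-trans (ℕ.m≤m⊔n N M) N⊔M≤n) (ℕ.≤-trans (ℕ.m≤m⊔n N M) N⊔M≤m)
          b< : ℚ.∣ b ∣ ℚ.< δ
          b< = proj₂ (close x≈y δ 0<δ) m (ℕ.m≤n⊔m (N ℕ.⊔ M) K)
          c< : ℚ.∣ c ∣ ℚ.< δ
          c< = proj₂ (cauchy y δ 0<δ) m n
            (ℕ.≤-trans (ℕ.m≤n⊔m N M) N⊔M≤m) (ℕ.≤-trans (ℕ.m≤n⊔m N M) N⊔M≤n)

  ≈-stable : ∀ {z w} → ¬ ¬ (z ≈ w) → z ≈ w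
  ≈-stable ¬¬z≈w = ≈ʳ-stable (λ ¬re → ¬¬z≈w λ z≈w → ¬re (re≈ z≈w))
                 , ≈ʳ-stable (λ ¬im → ¬¬z≈w λ z≈w → ¬im (im≈ z≈w))

  -- Coefficients for the ring solver, which has to compare constants: equality of pairs of
  -- rationals is decidable, equality in ℂ is not.
  ℚ[𝐢] : RawRing _ _
  ℚ[𝐢] = record
    { Carrier = ℚ × ℚ
    ; _≈_ = _≡_
    ; _+_ = λ (a , b) (c , d) → a ℚ.+ c , b ℚ.+ d
    ; _*_ = λ (a , b) (c , d) → a ℚ.* c ℚ.- b ℚ.* d , a ℚ.* d ℚ.+ b ℚ.* c
    ; -_  = λ (a , b) → ℚ.- a , ℚ.- b
    ; 0#  = 0ℚ , 0ℚ
    ; 1#  = 1ℚ , 0ℚ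
    }

  opaque
    unfolding _+ʳ_ -ʳ_ _*ʳ_

    ℚ→ℝ-+ : ∀ p q → ℚ→ℝ (p ℚ.+ q) ≈ʳ ℚ→ℝ p +ʳ ℚ→ℝ q
    ℚ→ℝ-+ p q = ≈ʳ-pointwise λ _ → refl

    ℚ→ℝ-* : ∀ p q → ℚ→ℝ (p ℚ.* q) ≈ʳ ℚ→ℝ p *ʳ ℚ→ℝ q
    ℚ→ℝ-* p q = ≈ʳ-pointwise λ _ → refl

    ℚ→ℝ-neg : ∀ p → ℚ→ℝ (ℚ.- p) ≈ʳ -ʳ ℚ→ℝ p
    ℚ→ℝ-neg p = ≈ʳ-pointwise λ _ → refl

  gaussian : ℚ × ℚ → ℂ
  gaussian (a , b) = ℚ→ℝ a +i ℚ→ℝ b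

  opaque
    gaussian-+ : ∀ z w → gaussian (RawRing._+_ ℚ[𝐢] z w) ≈ gaussian z + gaussian w
    gaussian-+ (a , b) (c , d) = ℚ→ℝ-+ a c , ℚ→ℝ-+ b d

    gaussian-* : ∀ z w → gaussian (RawRing._*_ ℚ[𝐢] z w) ≈ gaussian z * gaussian w
    gaussian-* (a , b) (c , d) =
      ℝᴿ.trans (ℚ→ℝ-+ _ _) (ℝᴿ.+-cong (ℚ→ℝ-* a c)
        (ℝᴿ.trans (ℚ→ℝ-neg _) (ℝᴿ.-‿cong (ℚ→ℝ-* b d)))) ,
      ℝᴿ.trans (ℚ→ℝ-+ _ _) (ℝᴿ.+-cong (ℚ→ℝ-* a d) (ℚ→ℝ-* b c))

  ℚ[𝐢]⟶ℂ : ℚ[𝐢] -Raw-AlmostCommutative⟶ fromCommutativeRing ℂ-commutativeRing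
  ℚ[𝐢]⟶ℂ = record
    { ⟦_⟧    = gaussian
    ; +-homo = gaussian-+
    ; *-homo = gaussian-*
    ; -‿homo = λ (a , b) → ℚ→ℝ-neg a , ℚ→ℝ-neg b
    ; 0-homo = ℂᴿ.refl
    ; 1-homo = ℂᴿ.refl
    }

  gaussian-≟ : (z w : ℚ × ℚ) → Maybe (gaussian z ≈ gaussian w)
  gaussian-≟ (a , b) (c , d) with a ℚ.≟ c | b ℚ.≟ d
  ... | yes refl | yes refl = just ℂᴿ.refl
  ... | _        | _        = nothing

open Algebra.Solver.Ring ℚ[𝐢] (fromCommutativeRing ℂ-commutativeRing) ℚ[𝐢]⟶ℂ gaussian-≟
  using (Polynomial; solve; _:=_; _:+_; _:*_; _:-_; :-_; con)

:𝐢 : ∀ {n} → Polynomial n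
:𝐢 = con (0ℚ , 1ℚ)

:0 :1 :½ : ∀ {n} → Polynomial n
:0 = con (0ℚ , 0ℚ)
:1 = con (1ℚ , 0ℚ)
:½ = con (½ , 0ℚ)

open import Relation.Binary.Reasoning.Setoid ℂᴿ.setoid
open ℂᴿ using
  ( refl; sym; trans; +-cong; *-cong; +-congˡ; +-congʳ; *-congˡ; *-congʳ; zeroˡ; zeroʳ
  ; *-identityˡ; *-identityʳ; +-identityˡ; +-identityʳ; *-assoc)

opaque
  unfolding _+ʳ_ -ʳ_ _*ʳ_

  conj-* : ∀ z w → conj (z * w) ≈ conj z * conj w
  conj-* (a +i b) (c +i d) =
    ≈ʳ-pointwise (λ n → solve₁ (seq a n) (seq b n) (seq c n) (seq d n)) ,
    ≈ʳ-pointwise (λ n → solve₂ (seq a n) (seq b n) (seq c n) (seq d n))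
    where
    open ℚ-Solver
    solve₁ : ∀ a b c d → a ℚ.* c ℚ.- b ℚ.* d ≡ a ℚ.* c ℚ.- (ℚ.- b) ℚ.* (ℚ.- d)
    solve₁ = solveℚ 4 (λ a b c d → a ⊛ c ⊖ b ⊛ d == a ⊛ c ⊖ (⊖ b) ⊛ (⊖ d)) ≡.refl
    solve₂ : ∀ a b c d → ℚ.- (a ℚ.* d ℚ.+ b ℚ.* c) ≡ a ℚ.* (ℚ.- d) ℚ.+ (ℚ.- b) ℚ.* c
    solve₂ = solveℚ 4 (λ a b c d → ⊖ (a ⊛ d ⊕ b ⊛ c) == a ⊛ (⊖ d) ⊕ (⊖ b) ⊛ c) ≡.refl

  conj-ℚ→ℂ : ∀ p → conj (ℚ→ℂ p) ≈ ℚ→ℂ p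
  conj-ℚ→ℂ p = ℝᴿ.refl , ≈ʳ-pointwise (λ _ → ≡.refl)

conj-+ : ∀ z w → conj (z + w) ≈ conj z + conj w
conj-+ (a +i b) (c +i d) = ℝᴿ.refl , ℝᴿ.sym (⁻¹-∙-comm b d)
  where open AbelianGroupProperties ℝᴿ.+-abelianGroup

conj-cong : ∀ {z w} → z ≈ w → conj z ≈ conj w
conj-cong z≈w = re≈ z≈w , ℝᴿ.-‿cong (im≈ z≈w)

≡⇒≈ : ∀ {z w : ℂ} → z ≡ w → z ≈ w
≡⇒≈ ≡.refl = refl

-- Tensor powers and derivations

∑-cong : ∀ {D} {f g : X D → ℂ} → (∀ y → f y ≈ g y) → ∑ f ≈ ∑ g
∑-cong {zero}  f≈g = f≈g []
∑-cong {suc D} f≈g = +-cong (∑-cong λ y → f≈g (0F ∷ y)) (∑-cong λ y → f≈g (1F ∷ y))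

∑-linear : ∀ {D} c d (f g : X D → ℂ) → ∑ (λ y → c * f y + d * g y) ≈ c * ∑ f + d * ∑ g
∑-linear {zero}  c d f g = refl
∑-linear {suc D} c d f g = trans
  (+-cong (∑-linear c d (f ∘ (0F ∷_)) (g ∘ (0F ∷_))) (∑-linear c d (f ∘ (1F ∷_)) (g ∘ (1F ∷_))))
  (solve 6 (λ c d p q s t → (c :* p :+ d :* q) :+ (c :* s :+ d :* t)
    := c :* (p :+ s) :+ d :* (q :+ t)) refl c d _ _ _ _)

∑-zero : ∀ {D} {f : X D → ℂ} → (∀ y → f y ≈ 0#) → ∑ f ≈ 0#
∑-zero {zero}  f≈0 = f≈0 []
∑-zero {suc D} f≈0 = trans (+-cong (∑-zero (f≈0 ∘ (0F ∷_))) (∑-zero (f≈0 ∘ (1F ∷_)))) (+-identityˡ 0#)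

Mat₂ : Set
Mat₂ = Fin 2 → Fin 2 → ℂ

infixl 7 _⊙_
_⊙_ : Mat₂ → Mat₂ → Mat₂
(g ⊙ h) a b = g a 0F * h 0F b + g a 1F * h 1F b

-- g ⊗ … ⊗ g
kron : ∀ {D} → Mat₂ → V D → V D
kron {zero}  g v []      = v []
kron {suc D} g v (a ∷ y) = g a 0F * kron g (v ∘ (0F ∷_)) y + g a 1F * kron g (v ∘ (1F ∷_)) y

-- Σₖ 1 ⊗ … ⊗ g ⊗ … ⊗ 1, with g in the k-th place
deriv : ∀ {D} → Mat₂ → V D → V D
deriv {zero}  g v []      = 0#
deriv {suc D} g v (a ∷ y) = g a 0F * v (0F ∷ y) + g a 1F * v (1F ∷ y) + deriv g (v ∘ (a ∷_)) y

module _ {D : ℕ} where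
  ≋-refl : {v : V D} → v ≋ v
  ≋-refl _ = refl
  ≋-sym : {v w : V D} → v ≋ w → w ≋ v
  ≋-sym p y = sym (p y)
  ≋-trans : {v w x : V D} → v ≋ w → w ≋ x → v ≋ x
  ≋-trans p q y = trans (p y) (q y)

lin : ∀ {D} → ℂ → V D → ℂ → V D → V D
lin c v d w y = c * v y + d * w y

kron-cong : ∀ {D} g {v w : V D} → v ≋ w → kron g v ≋ kron g w
kron-cong {zero}  g v≋w []      = v≋w []
kron-cong {suc D} g v≋w (a ∷ y) = +-cong (*-congˡ (kron-cong g (v≋w ∘ (0F ∷_)) y))
                                       (*-congˡ (kron-cong g (v≋w ∘ (1F ∷_)) y))

kron-congᴹ : ∀ {D} {g h} → (∀ a b → g a b ≈ h a b) → (v : V D) → kron g v ≋ kron h v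
kron-congᴹ {zero}  g≈h v []      = refl
kron-congᴹ {suc D} g≈h v (a ∷ y) = +-cong (*-cong (g≈h a 0F) (kron-congᴹ g≈h (v ∘ (0F ∷_)) y))
                                        (*-cong (g≈h a 1F) (kron-congᴹ g≈h (v ∘ (1F ∷_)) y))

kron-lin : ∀ {D} g c (v : V D) d w → kron g (lin c v d w) ≋ lin c (kron g v) d (kron g w)
kron-lin {zero}  g c v d w []      = refl
kron-lin {suc D} g c v d w (a ∷ y) = trans
  (+-cong (*-congˡ (kron-lin g c (v ∘ (0F ∷_)) d (w ∘ (0F ∷_)) y))
          (*-congˡ (kron-lin g c (v ∘ (1F ∷_)) d (w ∘ (1F ∷_)) y)))
  (solve 8 (λ c d g₀ g₁ v₀ v₁ w₀ w₁ →
    g₀ :* (c :* v₀ :+ d :* w₀) :+ g₁ :* (c :* v₁ :+ d :* w₁)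
      := c :* (g₀ :* v₀ :+ g₁ :* v₁) :+ d :* (g₀ :* w₀ :+ g₁ :* w₁)) refl
    c d (g a 0F) (g a 1F) _ _ _ _)

kron-kron : ∀ {D} g h (v : V D) → kron g (kron h v) ≋ kron (g ⊙ h) v
kron-kron {zero}  g h v []      = refl
kron-kron {suc D} g h v (a ∷ y) = trans
  (+-cong (*-congˡ (expand 0F)) (*-congˡ (expand 1F)))
  (solve 8 (λ g₀ g₁ h₀₀ h₀₁ h₁₀ h₁₁ v₀ v₁ →
    g₀ :* (h₀₀ :* v₀ :+ h₀₁ :* v₁) :+ g₁ :* (h₁₀ :* v₀ :+ h₁₁ :* v₁)
      := (g₀ :* h₀₀ :+ g₁ :* h₁₀) :* v₀ :+ (g₀ :* h₀₁ :+ g₁ :* h₁₁) :* v₁) refl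
    (g a 0F) (g a 1F) (h 0F 0F) (h 0F 1F) (h 1F 0F) (h 1F 1F) _ _)
  where
  v₀ = v ∘ (0F ∷_)
  v₁ = v ∘ (1F ∷_)
  expand : ∀ b → kron g (λ z → h b 0F * kron h v₀ z + h b 1F * kron h v₁ z) y
    ≈ h b 0F * kron (g ⊙ h) v₀ y + h b 1F * kron (g ⊙ h) v₁ y
  expand b = trans (kron-lin g (h b 0F) (kron h v₀) (h b 1F) (kron h v₁) y)
    (+-cong (*-congˡ (kron-kron g h v₀ y)) (*-congˡ (kron-kron g h v₁ y)))

I₂ : Mat₂
I₂ 0F 0F = 1#
I₂ 0F 1F = 0#
I₂ 1F 0F = 0#
I₂ 1F 1F = 1#

scale : ℂ → Mat₂ → Mat₂
scale c g a b = c * g a b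

kron-I₂ : ∀ {D} (v : V D) → kron I₂ v ≋ v
kron-I₂ {zero}  v []       = refl
kron-I₂ {suc D} v (0F ∷ y) = trans
  (solve 2 (λ p q → :1 :* p :+ :0 :* q := p) refl _ _) (kron-I₂ (v ∘ (0F ∷_)) y)
kron-I₂ {suc D} v (1F ∷ y) = trans
  (solve 2 (λ p q → :0 :* p :+ :1 :* q := q) refl _ _) (kron-I₂ (v ∘ (1F ∷_)) y)

kron-scale : ∀ {D} c g (v : V D) y → kron (scale c g) v y ≈ c ^ D * kron g v y
kron-scale {zero}  c g v []      = sym (*-identityˡ (v []))
kron-scale {suc D} c g v (a ∷ y) = trans
  (+-cong (*-congˡ (kron-scale c g (v ∘ (0F ∷_)) y)) (*-congˡ (kron-scale c g (v ∘ (1F ∷_)) y)))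
  (solve 6 (λ c C g₀ g₁ p q → c :* g₀ :* (C :* p) :+ c :* g₁ :* (C :* q)
    := c :* C :* (g₀ :* p :+ g₁ :* q)) refl c (c ^ D) (g a 0F) (g a 1F) _ _)

deriv-cong : ∀ {D} g {v w : V D} → v ≋ w → deriv g v ≋ deriv g w
deriv-cong {zero}  g v≋w []      = refl
deriv-cong {suc D} g v≋w (a ∷ y) = +-cong (+-cong (*-congˡ (v≋w (0F ∷ y))) (*-congˡ (v≋w (1F ∷ y))))
                                        (deriv-cong g (v≋w ∘ (a ∷_)) y)

deriv-congᴹ : ∀ {D} {g h} → (∀ a b → g a b ≈ h a b) → (v : V D) → deriv g v ≋ deriv h v
deriv-congᴹ {zero}  g≈h v []      = refl
deriv-congᴹ {suc D} g≈h v (a ∷ y) =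
  +-cong (+-cong (*-congʳ (g≈h a 0F)) (*-congʳ (g≈h a 1F))) (deriv-congᴹ g≈h (v ∘ (a ∷_)) y)

deriv-lin : ∀ {D} g c (v : V D) d w → deriv g (lin c v d w) ≋ lin c (deriv g v) d (deriv g w)
deriv-lin {zero}  g c v d w []      = solve 2 (λ c d → :0 := c :* :0 :+ d :* :0) refl c d
deriv-lin {suc D} g c v d w (a ∷ y) = trans
  (+-congˡ (deriv-lin g c (v ∘ (a ∷_)) d (w ∘ (a ∷_)) y))
  (solve 10 (λ c d g₀ g₁ v₀ v₁ w₀ w₁ p q →
    g₀ :* (c :* v₀ :+ d :* w₀) :+ g₁ :* (c :* v₁ :+ d :* w₁) :+ (c :* p :+ d :* q)
      := c :* (g₀ :* v₀ :+ g₁ :* v₁ :+ p) :+ d :* (g₀ :* w₀ :+ g₁ :* w₁ :+ q)) refl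
    c d (g a 0F) (g a 1F) _ _ _ _ _ _)

linᴹ : ℂ → Mat₂ → ℂ → Mat₂ → Mat₂
linᴹ c g d h a b = c * g a b + d * h a b

deriv-linᴹ : ∀ {D} c g d h (v : V D) → deriv (linᴹ c g d h) v ≋ lin c (deriv g v) d (deriv h v)
deriv-linᴹ {zero}  c g d h v []      = solve 2 (λ c d → :0 := c :* :0 :+ d :* :0) refl c d
deriv-linᴹ {suc D} c g d h v (a ∷ y) = trans
  (+-congˡ (deriv-linᴹ c g d h (v ∘ (a ∷_)) y))
  (solve 10 (λ c d g₀ g₁ h₀ h₁ v₀ v₁ p q →
    (c :* g₀ :+ d :* h₀) :* v₀ :+ (c :* g₁ :+ d :* h₁) :* v₁ :+ (c :* p :+ d :* q)
      := c :* (g₀ :* v₀ :+ g₁ :* v₁ :+ p) :+ d :* (h₀ :* v₀ :+ h₁ :* v₁ :+ q)) refl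
    c d (g a 0F) (g a 1F) (h a 0F) (h a 1F) _ _ _ _)

-- The tensor power of g intertwines the derivations as soon as g intertwines m and n. All later
-- identities between A, A*, Aᵋ and P thus become identities of 2 × 2 matrices.
kron-deriv : ∀ {D} g m n → (∀ a b → (g ⊙ m) a b ≈ (n ⊙ g) a b) →
  (v : V D) → kron g (deriv m v) ≋ deriv n (kron g v)
kron-deriv {zero}  g m n eq v []      = refl
kron-deriv {suc D} g m n eq v (a ∷ y) = begin
  g a 0F * kron g (λ z → m 0F 0F * v (0F ∷ z) + m 0F 1F * v (1F ∷ z) + deriv m v₀ z) y
    + g a 1F * kron g (λ z → m 1F 0F * v (0F ∷ z) + m 1F 1F * v (1F ∷ z) + deriv m v₁ z) y
    ≈⟨ +-cong (*-congˡ (expand 0F)) (*-congˡ (expand 1F)) ⟩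
  g a 0F * (m 0F 0F * p₀ + m 0F 1F * p₁ + q₀) + g a 1F * (m 1F 0F * p₀ + m 1F 1F * p₁ + q₁)
    ≈⟨ solve 10 (λ g₀ g₁ m₀₀ m₀₁ m₁₀ m₁₁ p₀ p₁ q₀ q₁ →
         g₀ :* (m₀₀ :* p₀ :+ m₀₁ :* p₁ :+ q₀) :+ g₁ :* (m₁₀ :* p₀ :+ m₁₁ :* p₁ :+ q₁)
           := (g₀ :* m₀₀ :+ g₁ :* m₁₀) :* p₀ :+ (g₀ :* m₀₁ :+ g₁ :* m₁₁) :* p₁
              :+ (g₀ :* q₀ :+ g₁ :* q₁)) refl
         (g a 0F) (g a 1F) (m 0F 0F) (m 0F 1F) (m 1F 0F) (m 1F 1F) p₀ p₁ q₀ q₁ ⟩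
  (g ⊙ m) a 0F * p₀ + (g ⊙ m) a 1F * p₁ + (g a 0F * q₀ + g a 1F * q₁)
    ≈⟨ +-congʳ (+-cong (*-congʳ (eq a 0F)) (*-congʳ (eq a 1F))) ⟩
  (n ⊙ g) a 0F * p₀ + (n ⊙ g) a 1F * p₁ + (g a 0F * q₀ + g a 1F * q₁)
    ≈⟨ solve 9 (λ n₀ n₁ g₀₀ g₀₁ g₁₀ g₁₁ p₀ p₁ q →
         (n₀ :* g₀₀ :+ n₁ :* g₁₀) :* p₀ :+ (n₀ :* g₀₁ :+ n₁ :* g₁₁) :* p₁ :+ q
           := n₀ :* (g₀₀ :* p₀ :+ g₀₁ :* p₁) :+ n₁ :* (g₁₀ :* p₀ :+ g₁₁ :* p₁) :+ q) refl
         (n a 0F) (n a 1F) (g 0F 0F) (g 0F 1F) (g 1F 0F) (g 1F 1F) p₀ p₁ _ ⟩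
  n a 0F * kron g v (0F ∷ y) + n a 1F * kron g v (1F ∷ y) + (g a 0F * q₀ + g a 1F * q₁)
    ≈⟨ +-congˡ (deriv-lin n (g a 0F) (kron g v₀) (g a 1F) (kron g v₁) y) ⟨
  deriv n (kron g v) (a ∷ y) ∎
  where
  v₀ = v ∘ (0F ∷_)
  v₁ = v ∘ (1F ∷_)
  p₀ = kron g v₀ y
  p₁ = kron g v₁ y
  q₀ = deriv n (kron g v₀) y
  q₁ = deriv n (kron g v₁) y
  q : Fin 2 → ℂ
  q b = deriv n (kron g (v ∘ (b ∷_))) y
  expand : ∀ b → kron g (λ z → m b 0F * v (0F ∷ z) + m b 1F * v (1F ∷ z) + deriv m (v ∘ (b ∷_)) z) y
    ≈ m b 0F * p₀ + m b 1F * p₁ + q b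
  expand b = begin
    kron g (λ z → m b 0F * v (0F ∷ z) + m b 1F * v (1F ∷ z) + deriv m (v ∘ (b ∷_)) z) y
      ≈⟨ kron-cong g (λ z → +-cong (*-identityˡ _) (*-identityˡ _)) y ⟨
    kron g (lin 1# (lin (m b 0F) v₀ (m b 1F) v₁) 1# (deriv m (v ∘ (b ∷_)))) y
      ≈⟨ kron-lin g 1# (lin (m b 0F) v₀ (m b 1F) v₁) 1# (deriv m (v ∘ (b ∷_))) y ⟩
    1# * kron g (lin (m b 0F) v₀ (m b 1F) v₁) y + 1# * kron g (deriv m (v ∘ (b ∷_))) y
      ≈⟨ +-cong (*-identityˡ _) (*-identityˡ _) ⟩
    kron g (lin (m b 0F) v₀ (m b 1F) v₁) y + kron g (deriv m (v ∘ (b ∷_))) y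
      ≈⟨ +-cong (kron-lin g (m b 0F) v₀ (m b 1F) v₁ y) (kron-deriv g m n eq (v ∘ (b ∷_)) y) ⟩
    m b 0F * p₀ + m b 1F * p₁ + q b ∎

⟨⟩-cong : ∀ {D} {v v′ w w′ : V D} → v ≋ v′ → w ≋ w′ → ⟨ v , w ⟩ ≈ ⟨ v′ , w′ ⟩
⟨⟩-cong v≋ w≋ = ∑-cong λ y → *-cong (v≋ y) (conj-cong (w≋ y))

⟨⟩-linˡ : ∀ {D} c (v : V D) d w x → ⟨ lin c v d w , x ⟩ ≈ c * ⟨ v , x ⟩ + d * ⟨ w , x ⟩
⟨⟩-linˡ c v d w x = trans
  (∑-cong λ y → solve 5 (λ c v d w x → (c :* v :+ d :* w) :* x := c :* (v :* x) :+ d :* (w :* x))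
    refl c (v y) d (w y) (conj (x y)))
  (∑-linear c d (λ y → v y * conj (x y)) (λ y → w y * conj (x y)))

⟨⟩-linʳ : ∀ {D} (x : V D) c v d w →
  ⟨ x , lin c v d w ⟩ ≈ conj c * ⟨ x , v ⟩ + conj d * ⟨ x , w ⟩
⟨⟩-linʳ x c v d w = trans
  (∑-cong λ y → trans (*-congˡ (trans (conj-+ _ _) (+-cong (conj-* c (v y)) (conj-* d (w y)))))
    (solve 5 (λ c v d w x → x :* (c :* v :+ d :* w) := c :* (x :* v) :+ d :* (x :* w))
      refl (conj c) (conj (v y)) (conj d) (conj (w y)) (x y)))
  (∑-linear (conj c) (conj d) (λ y → x y * conj (v y)) (λ y → x y * conj (w y)))

kron-adjoint : ∀ {D} g h → (∀ a b → g a b ≈ conj (h b a)) →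
  (v w : V D) → ⟨ kron g v , w ⟩ ≈ ⟨ v , kron h w ⟩
kron-adjoint {zero}  g h g≈h† v w = refl
kron-adjoint {suc D} g h g≈h† v w = begin
  ⟨ lin (g 0F 0F) (kron g v₀) (g 0F 1F) (kron g v₁) , w₀ ⟩
    + ⟨ lin (g 1F 0F) (kron g v₀) (g 1F 1F) (kron g v₁) , w₁ ⟩
    ≈⟨ +-cong (expandˡ 0F) (expandˡ 1F) ⟩
  (conj (h 0F 0F) * ⟨ v₀ , kron h w₀ ⟩ + conj (h 1F 0F) * ⟨ v₁ , kron h w₀ ⟩)
    + (conj (h 0F 1F) * ⟨ v₀ , kron h w₁ ⟩ + conj (h 1F 1F) * ⟨ v₁ , kron h w₁ ⟩)
    ≈⟨ solve 4 (λ p q s t → (p :+ q) :+ (s :+ t) := (p :+ s) :+ (q :+ t)) refl _ _ _ _ ⟩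
  (conj (h 0F 0F) * ⟨ v₀ , kron h w₀ ⟩ + conj (h 0F 1F) * ⟨ v₀ , kron h w₁ ⟩)
    + (conj (h 1F 0F) * ⟨ v₁ , kron h w₀ ⟩ + conj (h 1F 1F) * ⟨ v₁ , kron h w₁ ⟩)
    ≈⟨ +-cong (⟨⟩-linʳ v₀ (h 0F 0F) (kron h w₀) (h 0F 1F) (kron h w₁))
              (⟨⟩-linʳ v₁ (h 1F 0F) (kron h w₀) (h 1F 1F) (kron h w₁)) ⟨
  ⟨ v₀ , lin (h 0F 0F) (kron h w₀) (h 0F 1F) (kron h w₁) ⟩
    + ⟨ v₁ , lin (h 1F 0F) (kron h w₀) (h 1F 1F) (kron h w₁) ⟩ ∎
  where
  v₀ = v ∘ (0F ∷_)
  v₁ = v ∘ (1F ∷_)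
  w₀ = w ∘ (0F ∷_)
  w₁ = w ∘ (1F ∷_)
  expandˡ : ∀ a → ⟨ lin (g a 0F) (kron g v₀) (g a 1F) (kron g v₁) , w ∘ (a ∷_) ⟩
    ≈ conj (h 0F a) * ⟨ v₀ , kron h (w ∘ (a ∷_)) ⟩ + conj (h 1F a) * ⟨ v₁ , kron h (w ∘ (a ∷_)) ⟩
  expandˡ a = trans (⟨⟩-linˡ (g a 0F) (kron g v₀) (g a 1F) (kron g v₁) (w ∘ (a ∷_)))
    (+-cong (*-cong (g≈h† a 0F) (kron-adjoint g h g≈h† v₀ _))
            (*-cong (g≈h† a 1F) (kron-adjoint g h g≈h† v₁ _)))

deriv-adjoint : ∀ {D} g h → (∀ a b → g a b ≈ conj (h b a)) →
  (v w : V D) → ⟨ deriv g v , w ⟩ ≈ ⟨ v , deriv h w ⟩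
deriv-adjoint {zero}  g h g≈h† v w =
  trans (zeroˡ (conj (w []))) (sym (trans (*-congˡ (conj-ℚ→ℂ 0ℚ)) (zeroʳ (v []))))
deriv-adjoint {suc D} g h g≈h† v w = begin
  ⟨ (λ y → g 0F 0F * v (0F ∷ y) + g 0F 1F * v (1F ∷ y) + deriv g v₀ y) , w₀ ⟩
    + ⟨ (λ y → g 1F 0F * v (0F ∷ y) + g 1F 1F * v (1F ∷ y) + deriv g v₁ y) , w₁ ⟩
    ≈⟨ +-cong (expandˡ 0F) (expandˡ 1F) ⟩
  (conj (h 0F 0F) * ⟨ v₀ , w₀ ⟩ + conj (h 1F 0F) * ⟨ v₁ , w₀ ⟩ + ⟨ v₀ , deriv h w₀ ⟩)
    + (conj (h 0F 1F) * ⟨ v₀ , w₁ ⟩ + conj (h 1F 1F) * ⟨ v₁ , w₁ ⟩ + ⟨ v₁ , deriv h w₁ ⟩)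
    ≈⟨ solve 6 (λ p q r s t u → (p :+ q :+ r) :+ (s :+ t :+ u) := (p :+ s :+ r) :+ (q :+ t :+ u))
         refl _ _ _ _ _ _ ⟩
  (conj (h 0F 0F) * ⟨ v₀ , w₀ ⟩ + conj (h 0F 1F) * ⟨ v₀ , w₁ ⟩ + ⟨ v₀ , deriv h w₀ ⟩)
    + (conj (h 1F 0F) * ⟨ v₁ , w₀ ⟩ + conj (h 1F 1F) * ⟨ v₁ , w₁ ⟩ + ⟨ v₁ , deriv h w₁ ⟩)
    ≈⟨ +-cong (expandʳ 0F) (expandʳ 1F) ⟨
  ⟨ v₀ , (λ y → h 0F 0F * w (0F ∷ y) + h 0F 1F * w (1F ∷ y) + deriv h w₀ y) ⟩
    + ⟨ v₁ , (λ y → h 1F 0F * w (0F ∷ y) + h 1F 1F * w (1F ∷ y) + deriv h w₁ y) ⟩ ∎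
  where
  v₀ = v ∘ (0F ∷_)
  v₁ = v ∘ (1F ∷_)
  w₀ = w ∘ (0F ∷_)
  w₁ = w ∘ (1F ∷_)
  ⟨⟩-+ˡ : (p q x : V D) → ⟨ (λ y → p y + q y) , x ⟩ ≈ ⟨ p , x ⟩ + ⟨ q , x ⟩
  ⟨⟩-+ˡ p q x = trans (⟨⟩-cong {w = x} (λ y → sym (+-cong (*-identityˡ (p y)) (*-identityˡ (q y))))
      ≋-refl)
    (trans (⟨⟩-linˡ 1# p 1# q x) (+-cong (*-identityˡ _) (*-identityˡ _)))
  ⟨⟩-+ʳ : (x p q : V D) → ⟨ x , (λ y → p y + q y) ⟩ ≈ ⟨ x , p ⟩ + ⟨ x , q ⟩
  ⟨⟩-+ʳ x p q = trans (⟨⟩-cong {v = x} ≋-refl λ y → sym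
      (+-cong (*-identityˡ (p y)) (*-identityˡ (q y))))
    (trans (⟨⟩-linʳ x 1# p 1# q) (+-cong (1*) (1*)))
    where
    1* : ∀ {z} → conj 1# * z ≈ z
    1* {z} = trans (*-congʳ (conj-ℚ→ℂ 1ℚ)) (*-identityˡ z)
  expandˡ : ∀ a → ⟨ (λ y → g a 0F * v (0F ∷ y) + g a 1F * v (1F ∷ y) + deriv g (v ∘ (a ∷_)) y) , w ∘
      (a ∷_) ⟩
    ≈ conj (h 0F a) * ⟨ v₀ , w ∘ (a ∷_) ⟩ + conj (h 1F a) * ⟨ v₁ , w ∘ (a ∷_) ⟩
      + ⟨ v ∘ (a ∷_) , deriv h (w ∘ (a ∷_)) ⟩
  expandˡ a = trans (⟨⟩-+ˡ (lin (g a 0F) v₀ (g a 1F) v₁) (deriv g (v ∘ (a ∷_))) (w ∘ (a ∷_)))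
    (+-cong (trans (⟨⟩-linˡ (g a 0F) v₀ (g a 1F) v₁ (w ∘ (a ∷_)))
              (+-cong (*-congʳ (g≈h† a 0F)) (*-congʳ (g≈h† a 1F))))
            (deriv-adjoint g h g≈h† (v ∘ (a ∷_)) (w ∘ (a ∷_))))
  expandʳ : ∀ b → ⟨ v ∘ (b ∷_) , (λ y → h b 0F * w (0F ∷ y) + h b 1F * w (1F ∷ y) + deriv h
      (w ∘ (b ∷_)) y) ⟩
    ≈ conj (h b 0F) * ⟨ v ∘ (b ∷_) , w₀ ⟩ + conj (h b 1F) * ⟨ v ∘ (b ∷_) , w₁ ⟩
      + ⟨ v ∘ (b ∷_) , deriv h (w ∘ (b ∷_)) ⟩
  expandʳ b = trans (⟨⟩-+ʳ (v ∘ (b ∷_)) (lin (h b 0F) w₀ (h b 1F) w₁) (deriv h (w ∘ (b ∷_))))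
    (+-congʳ (⟨⟩-linʳ (v ∘ (b ∷_)) (h b 0F) w₀ (h b 1F) w₁))

ℚ→ℂ-+ : ∀ p q → ℚ→ℂ (p ℚ.+ q) ≈ ℚ→ℂ p + ℚ→ℂ q
ℚ→ℂ-+ p q = gaussian-+ (p , 0ℚ) (q , 0ℚ)

ℚ→ℂ-neg : ∀ p → ℚ→ℂ (ℚ.- p) ≈ - ℚ→ℂ p
ℚ→ℂ-neg p = ℚ→ℝ-neg p , ℚ→ℝ-neg 0ℚ

ℚ→ℂ-- : ∀ p q → ℚ→ℂ (p ℚ.- q) ≈ ℚ→ℂ p - ℚ→ℂ q
ℚ→ℂ-- p q = trans (ℚ→ℂ-+ p (ℚ.- q)) (+-congˡ (ℚ→ℂ-neg q))

ℚ→ℂ-* : ∀ p q → ℚ→ℂ (p ℚ.* q) ≈ ℚ→ℂ p * ℚ→ℂ q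
ℚ→ℂ-* p q = trans (≡⇒≈ (≡.cong₂ (λ a b → gaussian (a , b)) re≡ im≡)) (gaussian-* (p , 0ℚ) (q , 0ℚ))
  where
  open ℚ-Solver
  re≡ : p ℚ.* q ≡ p ℚ.* q ℚ.- 0ℚ ℚ.* 0ℚ
  re≡ = solveℚ 2 (λ p q → p ⊛ q == p ⊛ q ⊖ conℚ 0ℚ ⊛ conℚ 0ℚ) ≡.refl p q
  im≡ : 0ℚ ≡ p ℚ.* 0ℚ ℚ.+ 0ℚ ℚ.* q
  im≡ = solveℚ 2 (λ p q → conℚ 0ℚ == p ⊛ conℚ 0ℚ ⊕ conℚ 0ℚ ⊛ q) ≡.refl p q

ℕ→ℂ-+ : ∀ m n → ℕ→ℂ (m ℕ.+ n) ≈ ℕ→ℂ m + ℕ→ℂ n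
ℕ→ℂ-+ m n = trans (≡⇒≈ (≡.cong ℚ→ℂ (ℕ→ℚ-+ m n))) (ℚ→ℂ-+ (ℕ→ℚ m) (ℕ→ℚ n))

ℕ→ℂ-cancel : ∀ n {z w} → ℕ→ℂ (suc n) * z ≈ ℕ→ℂ (suc n) * w → z ≈ w
ℕ→ℂ-cancel n {z} {w} eq = trans (sym (cancel z)) (trans (*-congˡ eq) (cancel w))
  where
  cancel : ∀ z → ℚ→ℂ (ℕ→ℚ (suc n) ⁻¹) * (ℕ→ℂ (suc n) * z) ≈ z
  cancel z = begin
    ℚ→ℂ (ℕ→ℚ (suc n) ⁻¹) * (ℕ→ℂ (suc n) * z)      ≈⟨ *-assoc (ℚ→ℂ (ℕ→ℚ (suc n) ⁻¹)) (ℕ→ℂ (suc n)) z ⟨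
    ℚ→ℂ (ℕ→ℚ (suc n) ⁻¹) * ℕ→ℂ (suc n) * z        ≈⟨ *-congʳ (ℚ→ℂ-* (ℕ→ℚ (suc n) ⁻¹) (ℕ→ℚ (suc n))) ⟨
    ℚ→ℂ (ℕ→ℚ (suc n) ⁻¹ ℚ.* ℕ→ℚ (suc n)) * z      ≈⟨ *-congʳ
        (≡⇒≈ (≡.cong ℚ→ℂ (p⁻¹*p≡1 (ℕ→ℚ-suc≢0 n)))) ⟩
    1# * z                                           ≈⟨ *-identityˡ z ⟩
    z                                                ∎

-- Weights and the matrices A, A*, E*

-- `σy` is minus the usual Pauli matrix, as dictated by Aᵋ: -𝐢(σxσz - σzσx)/2 has 𝐢 in the upper
-- right corner.
σx σy σz e₀₁ e₁₀ : Mat₂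
σx 0F 0F = 0#
σx 0F 1F = 1#
σx 1F 0F = 1#
σx 1F 1F = 0#
σy 0F 0F = 0#
σy 0F 1F = 𝐢
σy 1F 0F = - 𝐢
σy 1F 1F = 0#
σz 0F 0F = 1#
σz 0F 1F = 0#
σz 1F 0F = 0#
σz 1F 1F = - 1#
e₀₁ 0F 1F = 1#
e₀₁ _  _  = 0#
e₁₀ 1F 0F = 1#
e₁₀ _  _  = 0#

-- The names refer to the weight, the number of ones; the eigenvalue D - 2k of A* moves in the
-- opposite direction.
raise lower : ∀ {D} → V D → V D
raise = deriv e₁₀
lower = deriv e₀₁

wt : ∀ {D} → X D → ℕ
wt = ∂ x₀

proj : ∀ {D} → ℕ → V D → V D
proj k v y = if does (wt y ℕ.≟ k) then v y else 0#

wt≤D : ∀ {D} (y : X D) → wt y ℕ.≤ D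
wt≤D []       = z≤n
wt≤D (0F ∷ y) = ℕ.m≤n⇒m≤1+n (wt≤D y)
wt≤D (1F ∷ y) = s≤s (wt≤D y)

proj-on : ∀ {D} k (v : V D) y → wt y ≡ k → proj k v y ≈ v y
proj-on k v y eq rewrite dec-true (wt y ℕ.≟ k) eq = refl

proj-off : ∀ {D} k (v : V D) y → wt y ≢ k → proj k v y ≈ 0#
proj-off k v y ≢k rewrite dec-false (wt y ℕ.≟ k) ≢k = refl

proj-cong-on : ∀ {D} k {v w : V D} → (∀ y → wt y ≡ k → v y ≈ w y) → proj k v ≋ proj k w
proj-cong-on k {v} {w} v≈w y = case wt y ℕ.≟ k of λ where
  (yes eq) → trans (proj-on k v y eq) (trans (v≈w y eq) (sym (proj-on k w y eq)))
  (no ≢k)  → trans (proj-off k v y ≢k) (sym (proj-off k w y ≢k))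

proj-cong : ∀ {D} k {v w : V D} → v ≋ w → proj k v ≋ proj k w
proj-cong k v≋w = proj-cong-on k λ y _ → v≋w y

proj-lin : ∀ {D} k c (v : V D) d w → proj k (lin c v d w) ≋ lin c (proj k v) d (proj k w)
proj-lin k c v d w y = case wt y ℕ.≟ k of λ where
  (yes eq) → trans (proj-on k (lin c v d w) y eq)
    (sym (+-cong (*-congˡ (proj-on k v y eq)) (*-congˡ (proj-on k w y eq))))
  (no ≢k)  → trans (proj-off k (lin c v d w) y ≢k)
    (trans (solve 2 (λ c d → :0 := c :* :0 :+ d :* :0) refl c d)
      (sym (+-cong (*-congˡ (proj-off k v y ≢k)) (*-congˡ (proj-off k w y ≢k)))))

proj-• : ∀ {D} k c (v : V D) → proj k (c •ⱽ v) ≋ c •ⱽ proj k v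
proj-• k c v y = case wt y ℕ.≟ k of λ where
  (yes eq) → trans (proj-on k (c •ⱽ v) y eq) (*-congˡ (sym (proj-on k v y eq)))
  (no ≢k)  → trans (proj-off k (c •ⱽ v) y ≢k)
    (trans (sym (zeroʳ c)) (*-congˡ (sym (proj-off k v y ≢k))))

proj-proj : ∀ {D} k (v : V D) → proj k (proj k v) ≋ proj k v
proj-proj k v = proj-cong-on k (proj-on k v)

proj-proj≢ : ∀ {D k l} (v : V D) → k ≢ l → proj k (proj l v) ≋ 0ⱽ
proj-proj≢ {k = k} {l} v k≢l y = case wt y ℕ.≟ k of λ where
  (yes eq) → trans (proj-on k (proj l v) y eq) (proj-off l v y (k≢l ∘ ≡.trans (≡.sym eq)))
  (no ≢k)  → proj-off k (proj l v) y ≢k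

0+0+ : ∀ p q s → 0# * p + 0# * q + s ≈ s
0+0+ = solve 3 (λ p q s → :0 :* p :+ :0 :* q :+ s := s) refl

1+0+ : ∀ p q s → 1# * p + 0# * q + s ≈ 1# * p + 1# * s
1+0+ = solve 3 (λ p q s → :1 :* p :+ :0 :* q :+ s := :1 :* p :+ :1 :* s) refl

0+1+ : ∀ p q s → 0# * p + 1# * q + s ≈ 1# * q + 1# * s
0+1+ = solve 3 (λ p q s → :0 :* p :+ :1 :* q :+ s := :1 :* q :+ :1 :* s) refl

raise-0F : ∀ {D} (v : V (suc D)) → raise v ∘ (0F ∷_) ≋ raise (v ∘ (0F ∷_))
raise-0F v y = 0+0+ (v (0F ∷ y)) (v (1F ∷ y)) (raise (v ∘ (0F ∷_)) y)

lower-1F : ∀ {D} (v : V (suc D)) → lower v ∘ (1F ∷_) ≋ lower (v ∘ (1F ∷_))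
lower-1F v y = 0+0+ (v (0F ∷ y)) (v (1F ∷ y)) (lower (v ∘ (1F ∷_)) y)

deriv-0ⱽ : ∀ {D} g → deriv {D} g 0ⱽ ≋ 0ⱽ
deriv-0ⱽ {zero}  g []      = refl
deriv-0ⱽ {suc D} g (a ∷ y) = trans (+-congˡ (deriv-0ⱽ g y))
  (solve 2 (λ p q → p :* :0 :+ q :* :0 :+ :0 := :0) refl (g a 0F) (g a 1F))

proj-0-raise : ∀ {D} (v : V D) → proj 0 (raise v) ≋ 0ⱽ
proj-0-raise v []       = refl
proj-0-raise v (0F ∷ y) = trans (proj-cong 0 (raise-0F v) y)
  (proj-0-raise (v ∘ (0F ∷_)) y)
proj-0-raise v (1F ∷ y) = refl

raise-proj : ∀ {D} k (v : V D) → raise (proj k v) ≋ proj (suc k) (raise v)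
raise-proj k v [] = refl
raise-proj k v (0F ∷ y) = trans (0+0+ (proj k v (0F ∷ y)) (proj k v (1F ∷ y)) _)
  (trans (raise-proj k (v ∘ (0F ∷_)) y)
    (sym (proj-cong (suc k) (raise-0F v) y)))
raise-proj k v (1F ∷ y) = begin
  1# * proj k v₀ y + 0# * proj k v (1F ∷ y) + raise (proj k v ∘ (1F ∷_)) y
    ≈⟨ 1+0+ (proj k v₀ y) (proj k v (1F ∷ y)) _ ⟩
  1# * proj k v₀ y + 1# * raise (proj k v ∘ (1F ∷_)) y
    ≈⟨ +-congˡ (*-congˡ (step k)) ⟩
  1# * proj k v₀ y + 1# * proj k (raise v₁) y
    ≈⟨ proj-lin k 1# v₀ 1# (raise v₁) y ⟨
  proj k (lin 1# v₀ 1# (raise v₁)) y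
    ≈⟨ proj-cong k (λ z → 1+0+ (v₀ z) (v₁ z) (raise v₁ z)) y ⟨
  proj (suc k) (raise v) (1F ∷ y) ∎
  where
  v₀ = v ∘ (0F ∷_)
  v₁ = v ∘ (1F ∷_)
  -- On words starting with 1 the tail has weight one less than the whole word, so the induction
  -- descends to k - 1. For k = 0 there is no such tail and both sides vanish.
  step : ∀ k → raise (proj k v ∘ (1F ∷_)) y ≈ proj k (raise v₁) y
  step zero    = trans (deriv-0ⱽ e₁₀ y) (sym (proj-0-raise v₁ y))
  step (suc k) = raise-proj k v₁ y

lower-proj-0 : ∀ {D} (v : V D) → lower (proj 0 v) ≋ 0ⱽ
lower-proj-0 v []       = refl
lower-proj-0 v (0F ∷ y) = trans (0+1+ (proj 0 v (0F ∷ y)) 0# (lower (proj 0 (v ∘ (0F ∷_))) y))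
  (trans (+-congˡ (*-congˡ (lower-proj-0 (v ∘ (0F ∷_)) y)))
    (solve 0 (:1 :* :0 :+ :1 :* :0 := :0) refl))
lower-proj-0 v (1F ∷ y) = trans (0+0+ (proj 0 v (0F ∷ y)) 0# _) (deriv-0ⱽ e₀₁ y)

lower-proj : ∀ {D} k (v : V D) → lower (proj (suc k) v) ≋ proj k (lower v)
lower-proj zero v [] = refl
lower-proj (suc k) v [] = refl
lower-proj k v (0F ∷ y) = begin
  0# * proj (suc k) v₀ y + 1# * proj k v₁ y + lower (proj (suc k) v₀) y
    ≈⟨ 0+1+ (proj (suc k) v₀ y) (proj k v₁ y) _ ⟩
  1# * proj k v₁ y + 1# * lower (proj (suc k) v₀) y
    ≈⟨ +-congˡ (*-congˡ (lower-proj k v₀ y)) ⟩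
  1# * proj k v₁ y + 1# * proj k (lower v₀) y
    ≈⟨ proj-lin k 1# v₁ 1# (lower v₀) y ⟨
  proj k (lin 1# v₁ 1# (lower v₀)) y
    ≈⟨ proj-cong k (λ z → 0+1+ (v₀ z) (v₁ z) (lower v₀ z)) y ⟨
  proj k (lower v) (0F ∷ y) ∎
  where
  v₀ = v ∘ (0F ∷_)
  v₁ = v ∘ (1F ∷_)
lower-proj zero v (1F ∷ y) = trans (0+0+ (proj 1 v (0F ∷ y)) (proj 1 v (1F ∷ y)) _)
  (lower-proj-0 (v ∘ (1F ∷_)) y)
lower-proj (suc k) v (1F ∷ y) = trans (0+0+ (proj (2 ℕ.+ k) v (0F ∷ y)) (proj (2 ℕ.+ k) v (1F ∷ y)) _)
  (trans (lower-proj k (v ∘ (1F ∷_)) y)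
    (sym (proj-cong k (lower-1F v) y)))

θ-sucˡ : ∀ D k → θ (suc D) k ≡ 1ℚ ℚ.+ θ D k
θ-sucˡ D k = ≡.trans (≡.cong (ℚ._- ℕ→ℚ (2 ℕ.* k)) (ℕ→ℚ-+ 1 D))
  (ℚ.+-assoc 1ℚ (ℕ→ℚ D) (ℚ.- ℕ→ℚ (2 ℕ.* k)))

θ-suc : ∀ D k → θ (suc D) (suc k) ≡ ℚ.- 1ℚ ℚ.+ θ D k
θ-suc D k = ≡.trans (≡.cong₂ ℚ._-_ (ℕ→ℚ-+ 1 D) (≡.trans (≡.cong ℕ→ℚ (ℕ.*-suc 2 k)) (ℕ→ℚ-+ 2 (2 ℕ.* k))))
  (solveℚ 2 (λ D K → conℚ 1ℚ ⊕ D ⊖ (conℚ (1ℚ ℚ.+ 1ℚ) ⊕ K) == conℚ (ℚ.- 1ℚ) ⊕ (D ⊖ K)) ≡.refl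
    (ℕ→ℚ D) (ℕ→ℚ (2 ℕ.* k)))
  where
  open ℚ-Solver

-- Every coordinate 0 of y contributes 1 and every coordinate 1 contributes -1.
deriv-σz : ∀ {D} (v : V D) y → deriv σz v y ≈ ℚ→ℂ (θ D (wt y)) * v y
deriv-σz v [] = sym (zeroˡ (v []))
deriv-σz {suc D} v (0F ∷ y) = begin
  1# * v (0F ∷ y) + 0# * v (1F ∷ y) + deriv σz (v ∘ (0F ∷_)) y
    ≈⟨ +-congˡ (deriv-σz (v ∘ (0F ∷_)) y) ⟩
  1# * v (0F ∷ y) + 0# * v (1F ∷ y) + ℚ→ℂ (θ D (wt y)) * v (0F ∷ y)
    ≈⟨ solve 3 (λ p q t → :1 :* p :+ :0 :* q :+ t :* p := (:1 :+ t) :* p) refl _ _ _ ⟩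
  (1# + ℚ→ℂ (θ D (wt y))) * v (0F ∷ y)
    ≈⟨ *-congʳ (ℚ→ℂ-+ 1ℚ (θ D (wt y))) ⟨
  ℚ→ℂ (1ℚ ℚ.+ θ D (wt y)) * v (0F ∷ y)
    ≈⟨ *-congʳ (≡⇒≈ (≡.cong ℚ→ℂ (θ-sucˡ D (wt y)))) ⟨
  ℚ→ℂ (θ (suc D) (wt y)) * v (0F ∷ y) ∎
deriv-σz {suc D} v (1F ∷ y) = begin
  0# * v (0F ∷ y) + - 1# * v (1F ∷ y) + deriv σz (v ∘ (1F ∷_)) y
    ≈⟨ +-congˡ (deriv-σz (v ∘ (1F ∷_)) y) ⟩
  0# * v (0F ∷ y) + - 1# * v (1F ∷ y) + ℚ→ℂ (θ D (wt y)) * v (1F ∷ y)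
    ≈⟨ solve 3 (λ q p t → :0 :* q :+ (:- :1) :* p :+ t :* p := (:- :1 :+ t) :* p) refl _ _ _ ⟩
  (- 1# + ℚ→ℂ (θ D (wt y))) * v (1F ∷ y)
    ≈⟨ *-congʳ (trans (ℚ→ℂ-+ (ℚ.- 1ℚ) (θ D (wt y))) (+-congʳ (ℚ→ℂ-neg 1ℚ))) ⟨
  ℚ→ℂ (ℚ.- 1ℚ ℚ.+ θ D (wt y)) * v (1F ∷ y)
    ≈⟨ *-congʳ (≡⇒≈ (≡.cong ℚ→ℂ (θ-suc D (wt y)))) ⟨
  ℚ→ℂ (θ (suc D) (suc (wt y))) * v (1F ∷ y) ∎

diagonal-· : ∀ {D} (f : X D → ℂ) (v : V D) y → (diagonal f · v) y ≈ f y * v y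
diagonal-· f v [] = refl
diagonal-· f v (0F ∷ y) = trans
  (+-cong (diagonal-· (f ∘ (0F ∷_)) (v ∘ (0F ∷_)) y) (∑-zero λ z → zeroˡ (v (1F ∷ z)))) (+-identityʳ _)
diagonal-· f v (1F ∷ y) = trans
  (+-cong (∑-zero λ z → zeroˡ (v (0F ∷ z))) (diagonal-· (f ∘ (1F ∷_)) (v ∘ (1F ∷_)) y)) (+-identityˡ _)

E*-· : ∀ {D} k (v : V D) → E* k · v ≋ proj k v
E*-· k v y = trans (diagonal-· (λ y → if does (wt y ℕ.≟ k) then 1# else 0#) v y) step
  where
  step : (if does (wt y ℕ.≟ k) then 1# else 0#) * v y ≈ proj k v y
  step = case wt y ℕ.≟ k of λ where
    (yes eq) → trans (*-congʳ (proj-on k (λ _ → 1#) y eq))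
      (trans (*-identityˡ (v y)) (sym (proj-on k v y eq)))
    (no ≢k)  → trans (*-congʳ (proj-off k (λ _ → 1#) y ≢k))
      (trans (zeroˡ (v y)) (sym (proj-off k v y ≢k)))

A*-· : ∀ {D} (v : V D) → A* · v ≋ deriv σz v
A*-· {D} v y = trans (diagonal-· (λ y → ℚ→ℂ (θ D (wt y))) v y) (sym (deriv-σz v y))

-- For the off-diagonal blocks of A: words that differ in the first coordinate are adjacent iff the
-- tails agree, so these blocks act as the identity.
differences-0 : ∀ {D} (v : V D) y →
  ∑ (λ z → (if does (differences y z ℕ.≟ 0) then 1# else 0#) * v z) ≈ v y
differences-0 v []       = *-identityˡ (v [])
differences-0 v (0F ∷ y) = trans
  (+-cong (differences-0 (v ∘ (0F ∷_)) y) (∑-zero λ z → zeroˡ (v (1F ∷ z)))) (+-identityʳ _)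
differences-0 v (1F ∷ y) = trans
  (+-cong (∑-zero λ z → zeroˡ (v (0F ∷ z))) (differences-0 (v ∘ (1F ∷_)) y)) (+-identityˡ _)

A-· : ∀ {D} (v : V D) → A · v ≋ deriv σx v
A-· v []       = zeroˡ (v [])
A-· v (0F ∷ y) = trans (+-cong (A-· (v ∘ (0F ∷_)) y) (differences-0 (v ∘ (1F ∷_)) y))
  (solve 3 (λ p q s → s :+ q := :0 :* p :+ :1 :* q :+ s) refl (v (0F ∷ y)) _ _)
A-· v (1F ∷ y) = trans (+-cong (differences-0 (v ∘ (0F ∷_)) y) (A-· (v ∘ (1F ∷_)) y))
  (solve 3 (λ p q s → p :+ s := :1 :* p :+ :0 :* q :+ s) refl _ (v (1F ∷ y)) _)

*-distribˡ-∑ : ∀ {D} a (f : X D → ℂ) → ∑ (λ y → a * f y) ≈ a * ∑ f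
*-distribˡ-∑ a f = trans (∑-cong λ y → sym (trans (+-congˡ (zeroˡ (f y))) (+-identityʳ (a * f y))))
  (trans (∑-linear a 0# f f) (trans (+-congˡ (zeroˡ (∑ f))) (+-identityʳ (a * ∑ f))))

kronecker-· : ∀ {D} g (v : V D) → kronecker g · v ≋ kron g v
kronecker-· g v []      = *-identityˡ (v [])
kronecker-· g v (a ∷ y) = +-cong (block 0F) (block 1F)
  where
  block : ∀ b → ∑ (λ z → g a b * kronecker g y z * v (b ∷ z)) ≈ g a b * kron g (v ∘ (b ∷_)) y
  block b = trans (∑-cong λ z → *-assoc (g a b) (kronecker g y z) (v (b ∷ z)))
    (trans (*-distribˡ-∑ (g a b) (λ z → kronecker g y z * v (b ∷ z)))
      (*-congˡ (kronecker-· g (v ∘ (b ∷_)) y)))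

∑-swap : ∀ {D E} (f : X D → X E → ℂ) → ∑ (λ y → ∑ (f y)) ≈ ∑ (λ z → ∑ (λ y → f y z))
∑-swap {zero}  f = refl
∑-swap {suc D} f = trans (+-cong (∑-swap (f ∘ (0F ∷_))) (∑-swap (f ∘ (1F ∷_))))
  (sym (∑-+ (λ z → ∑ (λ y → f (0F ∷ y) z)) (λ z → ∑ (λ y → f (1F ∷ y) z))))
  where
  ∑-+ : ∀ {E} (f g : X E → ℂ) → ∑ (λ y → f y + g y) ≈ ∑ f + ∑ g
  ∑-+ f g = trans (∑-cong λ y → sym (+-cong (*-identityˡ (f y)) (*-identityˡ (g y))))
    (trans (∑-linear 1# 1# f g) (+-cong (*-identityˡ _) (*-identityˡ _)))

∘ᴹ-· : ∀ {D} (M N : Mat D) v → (M ∘ᴹ N) · v ≋ M · (N · v)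
∘ᴹ-· M N v y = begin
  ∑ (λ z → ∑ (λ w → M y w * N w z) * v z)
    ≈⟨ ∑-cong (λ z → trans (ℂᴿ.*-comm _ (v z)) (trans (sym (*-distribˡ-∑ (v z) (λ w → M y w * N w z)))
         (∑-cong λ w → solve 3 (λ v m n → v :* (m :* n) := m :* (n :* v)) refl (v z) (M y w)
             (N w z)))) ⟩
  ∑ (λ z → ∑ (λ w → M y w * (N w z * v z)))
    ≈⟨ ∑-swap (λ z w → M y w * (N w z * v z)) ⟩
  ∑ (λ w → ∑ (λ z → M y w * (N w z * v z)))
    ≈⟨ ∑-cong (λ w → *-distribˡ-∑ (M y w) (λ z → N w z * v z)) ⟩
  ∑ (λ w → M y w * (N · v) w) ∎

·-cong : ∀ {D} (M : Mat D) {v w} → v ≋ w → M · v ≋ M · w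
·-cong M v≋w y = ∑-cong λ z → *-congˡ (v≋w z)

Id-· : ∀ {D} (v : V D) → Id · v ≋ v
Id-· v y = trans (diagonal-· (λ _ → 1#) v y) (*-identityˡ (v y))

-- Conjugation by P, primitive idempotents and T-modules

infix 4 _≈ᴹ_
_≈ᴹ_ : Mat₂ → Mat₂ → Set
g ≈ᴹ h = ∀ a b → g a b ≈ h a b

matrix-≈ : ∀ {g h} → g 0F 0F ≈ h 0F 0F → g 0F 1F ≈ h 0F 1F →
  g 1F 0F ≈ h 1F 0F → g 1F 1F ≈ h 1F 1F → g ≈ᴹ h
matrix-≈ p q s t 0F 0F = p
matrix-≈ p q s t 0F 1F = q
matrix-≈ p q s t 1F 0F = s
matrix-≈ p q s t 1F 1F = t

diag : ℂ → Mat₂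
diag b 0F 0F = 1#
diag b 0F 1F = 0#
diag b 1F 0F = 0#
diag b 1F 1F = b

P₁⊙P₁⁻¹ : P₁ ⊙ P₁⁻¹ ≈ᴹ I₂
P₁⊙P₁⁻¹ = matrix-≈
  (solve 0 (:1 :* :½ :+ :1 :* :½ := :1) refl)
  (solve 0 (:1 :* (:½ :* :𝐢) :+ :1 :* (:- (:½ :* :𝐢)) := :0) refl)
  (solve 0 ((:- :𝐢) :* :½ :+ :𝐢 :* :½ := :0) refl)
  (solve 0 ((:- :𝐢) :* (:½ :* :𝐢) :+ :𝐢 :* (:- (:½ :* :𝐢)) := :1) refl)

P₁⁻¹⊙P₁ : P₁⁻¹ ⊙ P₁ ≈ᴹ I₂
P₁⁻¹⊙P₁ = matrix-≈
  (solve 0 (:½ :* :1 :+ (:½ :* :𝐢) :* (:- :𝐢) := :1) refl)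
  (solve 0 (:½ :* :1 :+ (:½ :* :𝐢) :* :𝐢 := :0) refl)
  (solve 0 (:½ :* :1 :+ (:- (:½ :* :𝐢)) :* (:- :𝐢) := :0) refl)
  (solve 0 (:½ :* :1 :+ (:- (:½ :* :𝐢)) :* :𝐢 := :1) refl)

P₁⁻¹⊙σz : P₁⁻¹ ⊙ σz ≈ᴹ σx ⊙ P₁⁻¹
P₁⁻¹⊙σz = matrix-≈
  (solve 0 (:½ :* :1 :+ (:½ :* :𝐢) :* :0 := :0 :* :½ :+ :1 :* :½) refl)
  (solve 0 (:½ :* :0 :+ (:½ :* :𝐢) :* (:- :1) := :0 :* (:½ :* :𝐢) :+ :1 :* (:- (:½ :* :𝐢))) refl)
  (solve 0 (:½ :* :1 :+ (:- (:½ :* :𝐢)) :* :0 := :1 :* :½ :+ :0 :* :½) refl)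
  (solve 0 (:½ :* :0 :+ (:- (:½ :* :𝐢)) :* (:- :1) := :1 :* (:½ :* :𝐢) :+ :0 :* (:- (:½ :* :𝐢))) refl)

P₁⁻¹⊙σy : P₁⁻¹ ⊙ σy ≈ᴹ σz ⊙ P₁⁻¹
P₁⁻¹⊙σy = matrix-≈
  (solve 0 (:½ :* :0 :+ (:½ :* :𝐢) :* (:- :𝐢) := :1 :* :½ :+ :0 :* :½) refl)
  (solve 0 (:½ :* :𝐢 :+ (:½ :* :𝐢) :* :0 := :1 :* (:½ :* :𝐢) :+ :0 :* (:- (:½ :* :𝐢))) refl)
  (solve 0 (:½ :* :0 :+ (:- (:½ :* :𝐢)) :* (:- :𝐢) := :0 :* :½ :+ (:- :1) :* :½) refl)
  (solve 0 (:½ :* :𝐢 :+ (:- (:½ :* :𝐢)) :* :0 := :0 :* (:½ :* :𝐢) :+ (:- :1) :* (:- (:½ :* :𝐢))) refl)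

kron-P-P⁻¹ : ∀ {D} (v : V D) → kron P₁ (kron P₁⁻¹ v) ≋ v
kron-P-P⁻¹ v = ≋-trans (kron-kron P₁ P₁⁻¹ v) (≋-trans (kron-congᴹ P₁⊙P₁⁻¹ v) (kron-I₂ v))

kron-P⁻¹-P : ∀ {D} (v : V D) → kron P₁⁻¹ (kron P₁ v) ≋ v
kron-P⁻¹-P v = ≋-trans (kron-kron P₁⁻¹ P₁ v) (≋-trans (kron-congᴹ P₁⁻¹⊙P₁ v) (kron-I₂ v))

kron-diag : ∀ {D} b (v : V D) y → kron (diag b) v y ≈ b ^ wt y * v y
kron-diag b v []       = sym (*-identityˡ (v []))
kron-diag b v (0F ∷ y) = trans
  (solve 2 (λ p q → :1 :* p :+ :0 :* q := p) refl _ _) (kron-diag b (v ∘ (0F ∷_)) y)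
kron-diag b v (1F ∷ y) = trans
  (solve 3 (λ b p q → :0 :* p :+ b :* q := b :* q) refl b _ _)
  (trans (*-congˡ (kron-diag b (v ∘ (1F ∷_)) y)) (sym (*-assoc b (b ^ wt y) (v (1F ∷ y)))))

-- Primitive idempotents by Lagrange interpolation

θ-injective : ∀ D {i j} → θ D i ℚ.- θ D j ≡ 0ℚ → i ≡ j
θ-injective D {i} {j} eq = ℕ.*-cancelˡ-≡ i j 2 (ℕ→ℚ-injective (≡.sym (2j≡2i eq)))
  where
  open ℚ-Solver
  2j≡2i : θ D i ℚ.- θ D j ≡ 0ℚ → ℕ→ℚ (2 ℕ.* j) ≡ ℕ→ℚ (2 ℕ.* i)
  2j≡2i eq = ≡.trans (solveℚ 3 (λ d i j → j == (d ⊖ i) ⊖ (d ⊖ j) ⊕ i) ≡.refl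
      (ℕ→ℚ D) (ℕ→ℚ (2 ℕ.* i)) (ℕ→ℚ (2 ℕ.* j)))
    (≡.trans (≡.cong (ℚ._+ ℕ→ℚ (2 ℕ.* i)) eq) (ℚ.+-identityˡ (ℕ→ℚ (2 ℕ.* i))))

coeff : ℕ → ℕ → ℕ → ℂ
coeff D i j = ℚ→ℂ ((θ D i ℚ.- θ D j) ⁻¹)

-- `E-factor i j` with A* in place of A. As A* is diagonal, a product of such factors can be
-- evaluated separately at each vertex.
lagrangeStep : ∀ {D} → ℕ → ℕ → V D → V D
lagrangeStep {D} i j v = lin (coeff D i j) (deriv σz v) (- (coeff D i j * ℚ→ℂ (θ D j))) v

lagrange : ∀ {D} → ℕ → List ℕ → V D → V D
lagrange i js v = foldr (lagrangeStep i) v js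

lagrangeStep-≈ : ∀ {D} i j (v : V D) y →
  lagrangeStep i j v y ≈ ℚ→ℂ ((θ D i ℚ.- θ D j) ⁻¹ ℚ.* (θ D (wt y) ℚ.- θ D j)) * v y
lagrangeStep-≈ {D} i j v y = begin
  coeff D i j * deriv σz v y + - (coeff D i j * ℚ→ℂ (θ D j)) * v y
    ≈⟨ +-congʳ (*-congˡ (deriv-σz v y)) ⟩
  coeff D i j * (ℚ→ℂ (θ D (wt y)) * v y) + - (coeff D i j * ℚ→ℂ (θ D j)) * v y
    ≈⟨ solve 4 (λ c t s v → c :* (t :* v) :+ (:- (c :* s)) :* v := c :* (t :- s) :* v) refl
         (coeff D i j) (ℚ→ℂ (θ D (wt y))) (ℚ→ℂ (θ D j)) (v y) ⟩
  coeff D i j * (ℚ→ℂ (θ D (wt y)) - ℚ→ℂ (θ D j)) * v y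
    ≈⟨ *-congʳ (trans (ℚ→ℂ-* _ _) (*-congˡ (ℚ→ℂ-- (θ D (wt y)) (θ D j)))) ⟨
  ℚ→ℂ ((θ D i ℚ.- θ D j) ⁻¹ ℚ.* (θ D (wt y) ℚ.- θ D j)) * v y ∎

lagrange-on : ∀ {D} i js (v : V D) y → (∀ {j} → j ∈ˡ js → j ≢ i) → wt y ≡ i →
  lagrange i js v y ≈ v y
lagrange-on i []       v y ≢i eq = refl
lagrange-on {D} i (j ∷ js) v y ≢i ≡.refl = trans (lagrangeStep-≈ i j (lagrange i js v) y)
  (trans (*-congʳ (≡⇒≈ (≡.cong ℚ→ℂ (p⁻¹*p≡1 λ eq → ≢i (here ≡.refl) (≡.sym (θ-injective D eq))))))
    (trans (*-identityˡ _) (lagrange-on i js v y (≢i ∘ there) ≡.refl)))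

-- The factor for the node j = wt y contains θⱼ - θⱼ = 0, whatever inverse stands in front of it.
lagrange-off : ∀ {D} i js (v : V D) y → wt y ∈ˡ js → lagrange i js v y ≈ 0#
lagrange-off {D} i (_ ∷ js) v y (here ≡.refl) = trans (lagrangeStep-≈ i (wt y) (lagrange i js v) y)
  (trans (*-congʳ (≡⇒≈ (≡.cong ℚ→ℂ (≡.trans (≡.cong ((θ D i ℚ.- θ D (wt y)) ⁻¹ ℚ.*_)
      (ℚ.+-inverseʳ (θ D (wt y)))) (ℚ.*-zeroʳ ((θ D i ℚ.- θ D (wt y)) ⁻¹))))))
    (zeroˡ _))
lagrange-off {D} i (j ∷ js) v y (there y∈js) = trans (lagrangeStep-≈ i j (lagrange i js v) y)
  (trans (*-congˡ (lagrange-off i js v y y∈js)) (zeroʳ _))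

nodes : ℕ → ℕ → List ℕ
nodes D i = filter (λ j → ¬? (j ℕ.≟ i)) (upTo (suc D))

-- The Lagrange polynomial is 1 at θᵢ and 0 at the other eigenvalues, and `wt≤D` puts every weight
-- other than i among the nodes. For i > D both sides are 0.
lagrange-proj : ∀ {D} i (v : V D) → lagrange i (nodes D i) v ≋ proj i v
lagrange-proj {D} i v y = case wt y ℕ.≟ i of λ where
  (yes eq) → trans (lagrange-on i (nodes D i) v y
      (λ j∈ → proj₂ (∈-filter⁻ (λ j → ¬? (j ℕ.≟ i)) {xs = upTo (suc D)} j∈)) eq)
    (sym (proj-on i v y eq))
  (no ≢i) → trans (lagrange-off i (nodes D i) v y
      (∈-filter⁺ (λ j → ¬? (j ℕ.≟ i)) (∈-upTo⁺ (s≤s (wt≤D y))) ≢i))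
    (sym (proj-off i v y ≢i))

E-factor-· : ∀ {D} i j (v : V D) →
  E-factor i j · v ≋ lin (coeff D i j) (deriv σx v) (- (coeff D i j * ℚ→ℂ (θ D j))) v
E-factor-· {D} i j v y = begin
  ∑ (λ z → c * (A y z - t * Id y z) * v z)
    ≈⟨ ∑-cong (λ z → solve 5 (λ c a t d v → c :* (a :- t :* d) :* v
         := c :* (a :* v) :+ (:- (c :* t)) :* (d :* v)) refl c (A y z) t (Id y z) (v z)) ⟩
  ∑ (λ z → c * (A y z * v z) + - (c * t) * (Id y z * v z))
    ≈⟨ ∑-linear c (- (c * t)) (λ z → A y z * v z) (λ z → Id y z * v z) ⟩
  c * (A · v) y + - (c * t) * (Id · v) y
    ≈⟨ +-cong (*-congˡ (A-· v y)) (*-congˡ (Id-· v y)) ⟩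
  c * deriv σx v y + - (c * t) * v y ∎
  where
  c = coeff D i j
  t = ℚ→ℂ (θ D j)

lin-cong : ∀ {D} c d {v v′ w w′ : V D} → v ≋ v′ → w ≋ w′ → lin c v d w ≋ lin c v′ d w′
lin-cong c d v≋ w≋ y = +-cong (*-congˡ (v≋ y)) (*-congˡ (w≋ y))

E-factor-kron : ∀ {D} i j (v : V D) → E-factor i j · kron P₁⁻¹ v ≋ kron P₁⁻¹ (lagrangeStep i j v)
E-factor-kron {D} i j v = ≋-trans (E-factor-· i j (kron P₁⁻¹ v))
  (≋-trans (lin-cong c s {w = kron P₁⁻¹ v} (≋-sym (kron-deriv P₁⁻¹ σz σx P₁⁻¹⊙σz v)) ≋-refl)
    (≋-sym (kron-lin P₁⁻¹ c (deriv σz v) s v)))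
  where
  c = coeff D i j
  s = - (c * ℚ→ℂ (θ D j))

-- P⁻¹ is moved through one Lagrange factor at a time, turning each factor in A into the
-- corresponding factor in A*.
E-kron : ∀ {D} i (v : V D) → E i · kron P₁⁻¹ v ≋ kron P₁⁻¹ (proj i v)
E-kron {D} i v = ≋-trans (go (nodes D i)) (kron-cong P₁⁻¹ (lagrange-proj i v))
  where
  go : ∀ js → foldr _∘ᴹ_ Id (List.map (E-factor i) js) · kron P₁⁻¹ v ≋ kron P₁⁻¹ (lagrange i js v)
  go []       = Id-· (kron P₁⁻¹ v)
  go (j ∷ js) = ≋-trans (∘ᴹ-· (E-factor i j) _ (kron P₁⁻¹ v))
    (≋-trans (·-cong (E-factor i j) (go js)) (E-factor-kron i j (lagrange i js v)))

E-· : ∀ {D} i (v : V D) → E i · v ≋ kron P₁⁻¹ (proj i (kron P₁ v))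
E-· i v = ≋-trans (·-cong (E i) (≋-sym (kron-P⁻¹-P v))) (E-kron i (kron P₁ v))

Eᵋ-· : ∀ {D} i (v : V D) → Eᵋ i · v ≋ kron P₁⁻¹ (E i · kron P₁ v)
Eᵋ-· i v = ≋-trans (∘ᴹ-· (P⁻¹ ∘ᴹ E i) P v) (≋-trans (∘ᴹ-· P⁻¹ (E i) (P · v))
  (≋-trans (kronecker-· P₁⁻¹ (E i · (P · v))) (kron-cong P₁⁻¹ (·-cong (E i) (kronecker-· P₁ v)))))

-- Spectral form of a function of A* or of A, according to the projections that produce the vectors
-- `π k`. With the powers of b as weights it yields the tensor power of `diag b`, so closure of W
-- under projections is enough to reach `kron (diag b)`.
weightedSum : ∀ {D} → (ℕ → ℂ) → (ℕ → V D) → ℕ → V D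
weightedSum h π zero    = 0ⱽ
weightedSum h π (suc n) = lin 1# (weightedSum h π n) (h n) (π n)

lin-0 : ∀ {D} c d (y : X D) → lin c 0ⱽ d 0ⱽ y ≈ 0#
lin-0 c d y = solve 2 (λ c d → c :* :0 :+ d :* :0 := :0) refl c d

weightedSum-off : ∀ {D} h (v : V D) n y → n ℕ.≤ wt y →
  weightedSum h (λ k → proj k v) n y ≈ 0#
weightedSum-off h v zero    y _    = refl
weightedSum-off h v (suc n) y n<wt = trans
  (+-cong (*-congˡ (weightedSum-off h v n y (ℕ.<⇒≤ n<wt)))
          (*-congˡ (proj-off n v y λ eq → ℕ.<⇒≢ n<wt (≡.sym eq))))
  (lin-0 1# (h n) y)

weightedSum-on : ∀ {D} h (v : V D) n y → wt y ℕ.< n →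
  weightedSum h (λ k → proj k v) n y ≈ h (wt y) * v y
weightedSum-on h v (suc n) y (s≤s wt≤n) = case wt y ℕ.≟ n of λ where
  (yes ≡.refl) → trans (+-cong (*-congˡ (weightedSum-off h v n y ℕ.≤-refl))
      (*-congˡ (proj-on n v y ≡.refl)))
    (solve 2 (λ p q → :1 :* :0 :+ p :* q := p :* q) refl (h n) (v y))
  (no ≢n) → trans (+-cong (*-congˡ (weightedSum-on h v n y (ℕ.≤∧≢⇒< wt≤n ≢n)))
      (*-congˡ (proj-off n v y ≢n)))
    (solve 2 (λ p q → :1 :* p :+ q :* :0 := p) refl (h (wt y) * v y) (h n))

kron-• : ∀ {D} g c (v : V D) → kron g (c •ⱽ v) ≋ c •ⱽ kron g v
kron-• g c v y = trans (kron-cong g (λ z → sym (lin-• (v z))) y)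
    (trans (kron-lin g c v 0# v y) (lin-• (kron g v y)))
  where
  lin-• : ∀ x → c * x + 0# * x ≈ c * x
  lin-• = solve 2 (λ c x → c :* x :+ :0 :* x := c :* x) refl c

kron-0ⱽ : ∀ {D} g → kron {D} g 0ⱽ ≋ 0ⱽ
kron-0ⱽ g y = trans (kron-cong g (λ z → sym (lin-0 0# 0# z)) y) (trans (kron-lin g 0# 0ⱽ 0# 0ⱽ y)
  (solve 1 (λ p → :0 :* p :+ :0 :* p := :0) refl _))

kron-weightedSum : ∀ {D} g h (π : ℕ → V D) n →
  kron g (weightedSum h π n) ≋ weightedSum h (λ k → kron g (π k)) n
kron-weightedSum g h π zero    = kron-0ⱽ g
kron-weightedSum g h π (suc n) = ≋-trans (kron-lin g 1# (weightedSum h π n) (h n) (π n))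
  (lin-cong 1# (h n) {w = kron g (π n)} (kron-weightedSum g h π n) ≋-refl)

kron-diag-weightedSum : ∀ {D} b (v : V D) →
  weightedSum (b ^_) (λ k → proj k v) (suc D) ≋ kron (diag b) v
kron-diag-weightedSum {D} b v y = trans (weightedSum-on (b ^_) v (suc D) y (s≤s (wt≤D y)))
    (sym (kron-diag b v y))

-- `diag (- 1#)` is σz, but here its tensor power is meant, not its derivation: the antipodal map
-- becomes a function of A.
σx-decomposition : P₁⁻¹ ⊙ (diag (- 1#) ⊙ P₁) ≈ᴹ σx
σx-decomposition = matrix-≈
  (solve 0 (:½ :* (:1 :* :1 :+ :0 :* (:- :𝐢)) :+ :½ :* :𝐢 :* (:0 :* :1 :+ (:- :1) :* (:- :𝐢)) := :0)
      refl)
  (solve 0 (:½ :* (:1 :* :1 :+ :0 :* :𝐢) :+ :½ :* :𝐢 :* (:0 :* :1 :+ (:- :1) :* :𝐢) := :1) refl)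
  (solve 0 (:½ :* (:1 :* :1 :+ :0 :* (:- :𝐢)) :+ (:- (:½ :* :𝐢)) :* (:0 :* :1 :+ (:- :1) :* (:- :𝐢))
      := :1) refl)
  (solve 0 (:½ :* (:1 :* :1 :+ :0 :* :𝐢) :+ (:- (:½ :* :𝐢)) :* (:0 :* :1 :+ (:- :1) :* :𝐢) := :0) refl)

-- This is √2 exp(𝐢(π/4)σx), a quarter turn about the x-axis. P₁ is a rotation of order three up to
-- scalars, and it is decomposed into Euler angles about the axes z, x, z. The eigenvalues here are
-- 1 + 𝐢 and 1 - 𝐢 = (1 + 𝐢)(-𝐢), whence the scalar and the matrix `diag (- 𝐢)` below.
1+𝐢σx : Mat₂
1+𝐢σx 0F 0F = 1#
1+𝐢σx 0F 1F = 𝐢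
1+𝐢σx 1F 0F = 𝐢
1+𝐢σx 1F 1F = 1#

1+𝐢σx-decomposition : scale (1# + 𝐢) (P₁⁻¹ ⊙ (diag (- 𝐢) ⊙ P₁)) ≈ᴹ 1+𝐢σx
1+𝐢σx-decomposition = matrix-≈
  (solve 0 ((:1 :+ :𝐢) :* (:½ :* (:1 :* :1 :+ :0 :* (:- :𝐢))
    :+ :½ :* :𝐢 :* (:0 :* :1 :+ (:- :𝐢) :* (:- :𝐢))) := :1) refl)
  (solve 0 ((:1 :+ :𝐢) :* (:½ :* (:1 :* :1 :+ :0 :* :𝐢)
    :+ :½ :* :𝐢 :* (:0 :* :1 :+ (:- :𝐢) :* :𝐢)) := :𝐢) refl)
  (solve 0 ((:1 :+ :𝐢) :* (:½ :* (:1 :* :1 :+ :0 :* (:- :𝐢))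
    :+ (:- (:½ :* :𝐢)) :* (:0 :* :1 :+ (:- :𝐢) :* (:- :𝐢))) := :𝐢) refl)
  (solve 0 ((:1 :+ :𝐢) :* (:½ :* (:1 :* :1 :+ :0 :* :𝐢)
    :+ (:- (:½ :* :𝐢)) :* (:0 :* :1 :+ (:- :𝐢) :* :𝐢)) := :1) refl)

P₁-decomposition : diag (- 1#) ⊙ (1+𝐢σx ⊙ diag (- 𝐢)) ≈ᴹ P₁
P₁-decomposition = matrix-≈
  (solve 0 (:1 :* (:1 :* :1 :+ :𝐢 :* :0) :+ :0 :* (:𝐢 :* :1 :+ :1 :* :0) := :1) refl)
  (solve 0 (:1 :* (:1 :* :0 :+ :𝐢 :* (:- :𝐢)) :+ :0 :* (:𝐢 :* :0 :+ :1 :* (:- :𝐢)) := :1) refl)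
  (solve 0 (:0 :* (:1 :* :1 :+ :𝐢 :* :0) :+ (:- :1) :* (:𝐢 :* :1 :+ :1 :* :0) := :- :𝐢) refl)
  (solve 0 (:0 :* (:1 :* :0 :+ :𝐢 :* (:- :𝐢)) :+ (:- :1) :* (:𝐢 :* :0 :+ :1 :* (:- :𝐢)) := :𝐢) refl)

-- The scalar P₁³ = 2(1 - 𝐢) and its inverse.
¼[1+𝐢] 2[1-𝐢] : ℂ
¼[1+𝐢] = ℚ→ℂ ½ * ℚ→ℂ ½ * (1# + 𝐢)
2[1-𝐢] = (1# + 1#) * (1# - 𝐢)

P₁²-scaled : scale ¼[1+𝐢] (P₁ ⊙ P₁) ≈ᴹ P₁⁻¹
P₁²-scaled = matrix-≈
  (solve 0 (:½ :* :½ :* (:1 :+ :𝐢) :* (:1 :* :1 :+ :1 :* (:- :𝐢)) := :½) refl)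
  (solve 0 (:½ :* :½ :* (:1 :+ :𝐢) :* (:1 :* :1 :+ :1 :* :𝐢) := :½ :* :𝐢) refl)
  (solve 0 (:½ :* :½ :* (:1 :+ :𝐢) :* ((:- :𝐢) :* :1 :+ :𝐢 :* (:- :𝐢)) := :½) refl)
  (solve 0 (:½ :* :½ :* (:1 :+ :𝐢) :* ((:- :𝐢) :* :1 :+ :𝐢 :* :𝐢) := :- (:½ :* :𝐢)) refl)

kron-scale-≋ : ∀ {D g h} c → scale c g ≈ᴹ h → (v : V D) → c ^ D •ⱽ kron g v ≋ kron h v
kron-scale-≋ {g = g} c eq v y = trans (sym (kron-scale c g v y)) (kron-congᴹ eq v y)

kron-kron₃ : ∀ {D} {f} g h k → g ⊙ (h ⊙ k) ≈ᴹ f → (v : V D) → kron g (kron h (kron k v)) ≋ kron f v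
kron-kron₃ g h k eq v = ≋-trans (kron-cong g (kron-kron h k v))
    (≋-trans (kron-kron g (h ⊙ k) v) (kron-congᴹ eq v))

kron-σx : ∀ {D} (v : V D) → kron P₁⁻¹ (kron (diag (- 1#)) (kron P₁ v)) ≋ kron σx v
kron-σx = kron-kron₃ P₁⁻¹ (diag (- 1#)) P₁ σx-decomposition

-- Closure of T-modules under projections and P

module TModule {D} {W : Pred (V D) 0ℓ} (isTModule : IsTModule W) where
  open IsTModule isTModule
  open IsSubspace isSubspace

  lin-closed : ∀ c d {v w} → v ∈ W → w ∈ W → lin c v d w ∈ W
  lin-closed c d v∈W w∈W = +-closed (•-closed c v∈W) (•-closed d w∈W)

  σx-closed : ∀ {v} → v ∈ W → deriv σx v ∈ W
  σx-closed {v} v∈W = resp-≋ (A-· v) (T-closed A∈T v∈W)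

  σz-closed : ∀ {v} → v ∈ W → deriv σz v ∈ W
  σz-closed {v} v∈W = resp-≋ (A*-· v) (T-closed A*∈T v∈W)

  -- E*ᵢ acts on W as a polynomial in A*: each Lagrange factor is a combination of A* and the
  -- identity.
  proj-closed : ∀ i {v} → v ∈ W → proj i v ∈ W
  proj-closed i {v} v∈W = resp-≋ (lagrange-proj i v) (go (nodes D i))
    where
    go : ∀ js → lagrange i js v ∈ W
    go []       = v∈W
    go (j ∷ js) = lin-closed _ _ (σz-closed (go js)) (go js)

  E-closed : ∀ i {v} → v ∈ W → E i · v ∈ W
  E-closed i {v} v∈W = go (nodes D i)
    where
    go : ∀ js → foldr _∘ᴹ_ Id (List.map (E-factor i) js) · v ∈ W
    go []       = resp-≋ (≋-sym (Id-· v)) v∈W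
    go (j ∷ js) = resp-≋
      (≋-sym (≋-trans (∘ᴹ-· (E-factor i j) _ v) (E-factor-· i j _)))
      (lin-closed _ _ (σx-closed (go js)) (go js))

  weightedSum-closed : ∀ h {π} n → (∀ k → π k ∈ W) → weightedSum h π n ∈ W
  weightedSum-closed h zero    π∈W = 0-closed
  weightedSum-closed h (suc n) π∈W = lin-closed 1# (h n) (weightedSum-closed h n π∈W) (π∈W n)

  diag-closed : ∀ b {v} → v ∈ W → kron (diag b) v ∈ W
  diag-closed b {v} v∈W = resp-≋ (kron-diag-weightedSum b v)
    (weightedSum-closed (b ^_) (suc D) λ k → proj-closed k v∈W)

  P⁻¹-diag-P-closed : ∀ b {v} → v ∈ W → kron P₁⁻¹ (kron (diag b) (kron P₁ v)) ∈ W
  P⁻¹-diag-P-closed b {v} v∈W = resp-≋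
    (≋-trans (≋-sym (kron-weightedSum P₁⁻¹ (b ^_) (λ k → proj k (kron P₁ v)) (suc D)))
      (kron-cong P₁⁻¹ (kron-diag-weightedSum b (kron P₁ v))))
    (weightedSum-closed (b ^_) (suc D) λ k → resp-≋ (E-· k v) (E-closed k v∈W))

  -- Up to a scalar, P₁ is a product of diagonal matrices and P₁⁻¹-conjugates of diagonal
  -- matrices, whose tensor powers are polynomials in A* and in A.
  P-closed : ∀ {v} → v ∈ W → kron P₁ v ∈ W
  P-closed {v} v∈W = resp-≋ (kron-kron₃ (diag (- 1#)) 1+𝐢σx (diag (- 𝐢)) P₁-decomposition v)
    (diag-closed (- 1#) (1+𝐢σx-closed (diag-closed (- 𝐢) v∈W)))
    where
    1+𝐢σx-closed : ∀ {v} → v ∈ W → kron 1+𝐢σx v ∈ W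
    1+𝐢σx-closed {v} v∈W = resp-≋
      (≋-trans (λ y → *-congˡ (kron-kron₃ P₁⁻¹ (diag (- 𝐢)) P₁ (λ _ _ → refl) v y))
        (kron-scale-≋ (1# + 𝐢) 1+𝐢σx-decomposition v))
      (•-closed ((1# + 𝐢) ^ D) (P⁻¹-diag-P-closed (- 𝐢) v∈W))

  -- P⁻¹ is a multiple of P², so closure under P suffices.
  P⁻¹-closed : ∀ {v} → v ∈ W → kron P₁⁻¹ v ∈ W
  P⁻¹-closed {v} v∈W = resp-≋
    (≋-trans (λ y → *-congˡ (kron-kron P₁ P₁ v y)) (kron-scale-≋ ¼[1+𝐢] P₁²-scaled v))
    (•-closed (¼[1+𝐢] ^ D) (P-closed (P-closed v∈W)))

  σx-flip-closed : ∀ {v} → v ∈ W → kron σx v ∈ W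
  σx-flip-closed {v} v∈W = resp-≋ (kron-σx v) (P⁻¹-diag-P-closed (- 1#) v∈W)

-- Highest weight vectors

deriv-σx : ∀ {D} (v : V D) → deriv σx v ≋ lin 1# (lower v) 1# (raise v)
deriv-σx v = ≋-trans (deriv-congᴹ σx≈ v) (deriv-linᴹ 1# e₀₁ 1# e₁₀ v)
  where
  σx≈ : σx ≈ᴹ linᴹ 1# e₀₁ 1# e₁₀
  σx≈ = matrix-≈ (solve 0 (:0 := :1 :* :0 :+ :1 :* :0) refl) (solve 0 (:1 := :1 :* :1 :+ :1 :* :0) refl)
    (solve 0 (:1 := :1 :* :0 :+ :1 :* :1) refl) (solve 0 (:0 := :1 :* :0 :+ :1 :* :0) refl)

deriv-σy : ∀ {D} (v : V D) → deriv σy v ≋ lin 𝐢 (lower v) (- 𝐢) (raise v)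
deriv-σy v = ≋-trans (deriv-congᴹ σy≈ v) (deriv-linᴹ 𝐢 e₀₁ (- 𝐢) e₁₀ v)
  where
  σy≈ : σy ≈ᴹ linᴹ 𝐢 e₀₁ (- 𝐢) e₁₀
  σy≈ = matrix-≈ (solve 0 (:0 := :𝐢 :* :0 :+ (:- :𝐢) :* :0) refl)
      (solve 0 (:𝐢 := :𝐢 :* :1 :+ (:- :𝐢) :* :0) refl)
    (solve 0 (:- :𝐢 := :𝐢 :* :0 :+ (:- :𝐢) :* :1) refl) (solve 0 (:0 := :𝐢 :* :0 :+ (:- :𝐢) :* :0) refl)

σz+e₁₀-e₀₁ : Mat₂
σz+e₁₀-e₀₁ = linᴹ 1# σz 1# (linᴹ 1# e₁₀ (- 1#) e₀₁)

-- The lowering operator for A* becomes one for A.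
P₁⁻¹⊙e₀₁ : P₁⁻¹ ⊙ linᴹ 𝐢 e₀₁ 𝐢 e₀₁ ≈ᴹ σz+e₁₀-e₀₁ ⊙ P₁⁻¹
P₁⁻¹⊙e₀₁ = matrix-≈
  (solve 0 (:½ :* z :+ h :* z := (:1 :* :1 :+ :1 :* d) :* :½ :+ (:1 :* :0 :+ :1 :* l) :* :½) refl)
  (solve 0 (:½ :* t :+ h :* z := (:1 :* :1 :+ :1 :* d) :* h :+ (:1 :* :0 :+ :1 :* l) :* (:- h)) refl)
  (solve 0 (:½ :* z :+ (:- h) :* z := (:1 :* :0 :+ :1 :* u) :* :½ :+ (:1 :* (:- :1) :+ :1 :* d) :*
      :½) refl)
  (solve 0 (:½ :* t :+ (:- h) :* z := (:1 :* :0 :+ :1 :* u) :* h :+ (:1 :* (:- :1) :+ :1 :* d) :*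
      (:- h)) refl)
  where
  h z t d l u : Polynomial 0
  h = :½ :* :𝐢
  z = :𝐢 :* :0 :+ :𝐢 :* :0
  t = :𝐢 :* :1 :+ :𝐢 :* :1
  d = :1 :* :0 :+ (:- :1) :* :0
  l = :1 :* :0 :+ (:- :1) :* :1
  u = :1 :* :1 :+ (:- :1) :* :0

θ-≈ : ∀ D k → ℚ→ℂ (θ D k) ≈ ℕ→ℂ D - (ℕ→ℂ k + ℕ→ℂ k)
θ-≈ D k = trans (ℚ→ℂ-- (ℕ→ℚ D) (ℕ→ℚ (2 ℕ.* k))) (+-congˡ (ℂᴿ.-‿cong
  (trans (≡⇒≈ (≡.cong (λ n → ℕ→ℂ (k ℕ.+ n)) (ℕ.+-identityʳ k))) (ℕ→ℂ-+ k k))))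

σx-eigenvector : ∀ {D} r (v : V D) → deriv σx (kron P₁⁻¹ (proj r v)) ≋ ℚ→ℂ (θ D r) •ⱽ kron P₁⁻¹
    (proj r v)
σx-eigenvector {D} r v y = begin
  deriv σx (kron P₁⁻¹ (proj r v)) y
    ≈⟨ kron-deriv P₁⁻¹ σz σx P₁⁻¹⊙σz (proj r v) y ⟨
  kron P₁⁻¹ (deriv σz (proj r v)) y
    ≈⟨ kron-cong P₁⁻¹ eigen y ⟩
  kron P₁⁻¹ (ℚ→ℂ (θ D r) •ⱽ proj r v) y
    ≈⟨ kron-• P₁⁻¹ (ℚ→ℂ (θ D r)) (proj r v) y ⟩
  ℚ→ℂ (θ D r) * kron P₁⁻¹ (proj r v) y ∎
  where
  eigen : deriv σz (proj r v) ≋ ℚ→ℂ (θ D r) •ⱽ proj r v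
  eigen y = trans (deriv-σz (proj r v) y) (case wt y ℕ.≟ r of λ where
    (yes ≡.refl) → refl
    (no ≢r) → trans (*-congˡ (proj-off r v y ≢r))
      (trans (zeroʳ (ℚ→ℂ (θ D (wt y))))
          (sym (trans (*-congˡ (proj-off r v y ≢r)) (zeroʳ (ℚ→ℂ (θ D r)))))))

-- As raise + lower = A and raise - lower = 𝐢 Aᵋ, this says that A u = (D - 2r) u and
-- (A* + 𝐢 Aᵋ) u = 0.
record HighestWeight {D} (r : ℕ) (u : V D) : Set where
  field
    raise-≈ : ∀ y → raise u y ≈ (ℕ→ℂ (wt y) - ℕ→ℂ r) * u y
    lower-≈ : ∀ y → lower u y ≈ (ℕ→ℂ D - ℕ→ℂ r - ℕ→ℂ (wt y)) * u y

-- Since A* is diagonal, the two equations for u are a linear system at each vertex y: raise plus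
-- lower is θᵣ u y, and raise minus lower is -θ u y with θ taken at wt y. Half the sum and half the
-- difference of the two eigenvalues give the coefficients.
highestWeight : ∀ {D} r (v : V D) → lower (proj r v) ≋ 0ⱽ → HighestWeight r (kron P₁⁻¹ (proj r v))
highestWeight {D} r v lower≋0 = record { raise-≈ = raise≈ ; lower-≈ = lower≈ }
  where
  u = kron P₁⁻¹ (proj r v)
  sum≈ : ∀ y → 1# * lower u y + 1# * raise u y ≈ ℚ→ℂ (θ D r) * u y
  sum≈ y = trans (sym (deriv-σx u y)) (σx-eigenvector r v y)
  difference≈ : ∀ y → 1# * (ℚ→ℂ (θ D (wt y)) * u y) + 1# * (1# * raise u y + - 1# * lower u y) ≈ 0#
  difference≈ y = begin
    1# * (ℚ→ℂ (θ D (wt y)) * u y) + 1# * (1# * raise u y + - 1# * lower u y)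
      ≈⟨ +-cong (*-congˡ (deriv-σz u y)) (*-congˡ (deriv-linᴹ 1# e₁₀ (- 1#) e₀₁ u y)) ⟨
    1# * deriv σz u y + 1# * deriv (linᴹ 1# e₁₀ (- 1#) e₀₁) u y
      ≈⟨ deriv-linᴹ 1# σz 1# (linᴹ 1# e₁₀ (- 1#) e₀₁) u y ⟨
    deriv σz+e₁₀-e₀₁ u y
      ≈⟨ kron-deriv P₁⁻¹ (linᴹ 𝐢 e₀₁ 𝐢 e₀₁) σz+e₁₀-e₀₁ P₁⁻¹⊙e₀₁ (proj r v) y ⟨
    kron P₁⁻¹ (deriv (linᴹ 𝐢 e₀₁ 𝐢 e₀₁) (proj r v)) y
      -- The matrix is 2𝐢 times `e₀₁`, so its derivation is a multiple of `lower`, which kills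
      -- `proj r v`.
      ≈⟨ kron-cong P₁⁻¹ (≋-trans (deriv-linᴹ 𝐢 e₀₁ 𝐢 e₀₁ (proj r v)) (≋-trans
           (lin-cong 𝐢 𝐢 lower≋0 lower≋0) (lin-0 𝐢 𝐢))) y ⟩
    kron P₁⁻¹ 0ⱽ y
      ≈⟨ kron-0ⱽ P₁⁻¹ y ⟩
    0# ∎
  raise≈ : ∀ y → raise u y ≈ (ℕ→ℂ (wt y) - ℕ→ℂ r) * u y
  raise≈ y = begin
    raise u y
      ≈⟨ solve 4 (λ l s t u → s := :½ :*
          ((:1 :* l :+ :1 :* s) :+ (:1 :* (t :* u) :+ :1 :* (:1 :* s :+ (:- :1) :* l)) :- t :* u))
           refl (lower u y) (raise u y) (ℚ→ℂ (θ D (wt y))) (u y) ⟩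
    ℚ→ℂ ½ * (1# * lower u y + 1# * raise u y + (1# * (ℚ→ℂ (θ D (wt y)) * u y)
      + 1# * (1# * raise u y + - 1# * lower u y)) - ℚ→ℂ (θ D (wt y)) * u y)
      ≈⟨ *-congˡ (+-cong (+-cong (trans (sum≈ y) (*-congʳ (θ-≈ D r))) (difference≈ y))
           (ℂᴿ.-‿cong (*-congʳ (θ-≈ D (wt y))))) ⟩
    ℚ→ℂ ½ * ((ℕ→ℂ D - (ℕ→ℂ r + ℕ→ℂ r)) * u y + 0# - (ℕ→ℂ D - (ℕ→ℂ (wt y) + ℕ→ℂ (wt y))) * u y)
      ≈⟨ solve 4 (λ d r w u → :½ :* ((d :- (r :+ r)) :* u :+ :0 :- (d :- (w :+ w)) :* u)
           := (w :- r) :* u) refl (ℕ→ℂ D) (ℕ→ℂ r) (ℕ→ℂ (wt y)) (u y) ⟩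
    (ℕ→ℂ (wt y) - ℕ→ℂ r) * u y ∎
  lower≈ : ∀ y → lower u y ≈ (ℕ→ℂ D - ℕ→ℂ r - ℕ→ℂ (wt y)) * u y
  lower≈ y = begin
    lower u y
      ≈⟨ solve 2 (λ l s → l := (:1 :* l :+ :1 :* s) :- s) refl (lower u y) (raise u y) ⟩
    1# * lower u y + 1# * raise u y - raise u y
      ≈⟨ +-cong (trans (sum≈ y) (*-congʳ (θ-≈ D r))) (ℂᴿ.-‿cong (raise≈ y)) ⟩
    (ℕ→ℂ D - (ℕ→ℂ r + ℕ→ℂ r)) * u y - (ℕ→ℂ (wt y) - ℕ→ℂ r) * u y
      ≈⟨ solve 4 (λ d r w u → (d :- (r :+ r)) :* u :- (w :- r) :* u := (d :- r :- w) :* u) refl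
           (ℕ→ℂ D) (ℕ→ℂ r) (ℕ→ℂ (wt y)) (u y) ⟩
    (ℕ→ℂ D - ℕ→ℂ r - ℕ→ℂ (wt y)) * u y ∎

module _ {D r : ℕ} {u : V D} (hw : HighestWeight r u) where
  open HighestWeight hw

  -- The factor in `raise-≈` depends on the weight alone, so it is a scalar on each component. It is
  -- evaluated at the target weight r + j + 1; for `lower-component` the target is r + j, which
  -- gives d - j.
  raise-component : ∀ j → raise (proj (r ℕ.+ j) u) ≋ ℕ→ℂ (suc j) •ⱽ proj (r ℕ.+ suc j) u
  raise-component j = ≋-trans (raise-proj (r ℕ.+ j) u) (≋-trans
    (λ y → ≡⇒≈ (≡.cong (λ k → proj k (raise u) y) (≡.sym (ℕ.+-suc r j))))
    (≋-trans (proj-cong-on (r ℕ.+ suc j) λ y eq → trans (raise-≈ y) (*-congʳ (coefficient y eq)))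
      (proj-• (r ℕ.+ suc j) (ℕ→ℂ (suc j)) u)))
    where
    coefficient : ∀ y → wt y ≡ r ℕ.+ suc j → ℕ→ℂ (wt y) - ℕ→ℂ r ≈ ℕ→ℂ (suc j)
    coefficient y eq = trans (+-congʳ (trans (≡⇒≈ (≡.cong ℕ→ℂ eq)) (ℕ→ℂ-+ r (suc j))))
      (solve 2 (λ r j → r :+ j :- r := j) refl (ℕ→ℂ r) (ℕ→ℂ (suc j)))

  lower-component : ∀ {d} → D ≡ r ℕ.+ r ℕ.+ d → ∀ j →
    lower (proj (r ℕ.+ suc j) u) ≋ ℚ→ℂ (ℕ→ℚ d ℚ.- ℕ→ℚ j) •ⱽ proj (r ℕ.+ j) u
  lower-component {d} D≡ j = ≋-trans
    (λ y → ≡⇒≈ (≡.cong (λ k → lower (proj k u) y) (ℕ.+-suc r j)))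
    (≋-trans (lower-proj (r ℕ.+ j) u)
    (≋-trans (proj-cong-on (r ℕ.+ j) λ y eq → trans (lower-≈ y) (*-congʳ (coefficient y eq)))
      (proj-• (r ℕ.+ j) (ℚ→ℂ (ℕ→ℚ d ℚ.- ℕ→ℚ j)) u)))
    where
    coefficient : ∀ y → wt y ≡ r ℕ.+ j → ℕ→ℂ D - ℕ→ℂ r - ℕ→ℂ (wt y) ≈ ℚ→ℂ (ℕ→ℚ d ℚ.- ℕ→ℚ j)
    coefficient y eq = begin
      ℕ→ℂ D - ℕ→ℂ r - ℕ→ℂ (wt y)
        ≈⟨ +-cong (+-congʳ (trans (≡⇒≈ (≡.cong ℕ→ℂ D≡))
             (trans (ℕ→ℂ-+ (r ℕ.+ r) d) (+-congʳ (ℕ→ℂ-+ r r)))))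
             (ℂᴿ.-‿cong (trans (≡⇒≈ (≡.cong ℕ→ℂ eq)) (ℕ→ℂ-+ r j))) ⟩
      ℕ→ℂ r + ℕ→ℂ r + ℕ→ℂ d - ℕ→ℂ r - (ℕ→ℂ r + ℕ→ℂ j)
        ≈⟨ solve 3 (λ r d j → r :+ r :+ d :- r :- (r :+ j) := d :- j) refl (ℕ→ℂ r) (ℕ→ℂ d) (ℕ→ℂ j) ⟩
      ℕ→ℂ d - ℕ→ℂ j
        ≈⟨ ℚ→ℂ-- (ℕ→ℚ d) (ℕ→ℚ j) ⟨
      ℚ→ℂ (ℕ→ℚ d ℚ.- ℕ→ℚ j) ∎

-- Endpoint and diameter

flip : ∀ {D} → X D → X D
flip = Vec.map Fin.opposite

flip-involutive : ∀ {D} (y : X D) → flip (flip y) ≡ y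
flip-involutive []       = ≡.refl
flip-involutive (0F ∷ y) = ≡.cong (0F ∷_) (flip-involutive y)
flip-involutive (1F ∷ y) = ≡.cong (1F ∷_) (flip-involutive y)

wt-flip : ∀ {D} (y : X D) → wt y ℕ.+ wt (flip y) ≡ D
wt-flip []       = ≡.refl
wt-flip (0F ∷ y) = ≡.trans (ℕ.+-suc (wt y) (wt (flip y))) (≡.cong suc (wt-flip y))
wt-flip (1F ∷ y) = ≡.cong suc (wt-flip y)

kron-σx-flip : ∀ {D} (v : V D) y → kron σx v y ≈ v (flip y)
kron-σx-flip v []       = refl
kron-σx-flip v (0F ∷ y) = trans (solve 2 (λ p q → :0 :* p :+ :1 :* q := q) refl _ _)
  (kron-σx-flip (v ∘ (1F ∷_)) y)
kron-σx-flip v (1F ∷ y) = trans (solve 2 (λ p q → :1 :* p :+ :0 :* q := p) refl _ _)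
  (kron-σx-flip (v ∘ (0F ∷_)) y)

∣interval∣ : ∀ {n} (S : Subset n) a b → b ℕ.≤ n →
  (∀ i → i ∈ˢ S ⇔ (a ℕ.≤ toℕ i × toℕ i ℕ.< b)) → ∣ S ∣ ≡ b ℕ.∸ a
∣interval∣ [] a zero z≤n S⇔ = ≡.sym (ℕ.0∸n≡0 a)
∣interval∣ (inside ∷ S) a zero _ S⇔ with () ← proj₂ (Equivalence.to (S⇔ 0F) here)
∣interval∣ (outside ∷ S) a zero _ S⇔ = ∣interval∣ S a zero z≤n λ i →
  mk⇔ (λ i∈S → contradiction (proj₂ (Equivalence.to (S⇔ (Fin.suc i)) (there i∈S))) ℕ.n≮0) (λ ())
∣interval∣ (outside ∷ S) zero (suc b) _ S⇔ with () ← Equivalence.from (S⇔ 0F) (z≤n , s≤s z≤n)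
∣interval∣ (inside ∷ S) zero (suc b) (s≤s b≤n) S⇔ = ≡.cong suc (∣interval∣ S zero b b≤n λ i →
  mk⇔ (λ i∈S → z≤n , ℕ.s≤s⁻¹ (proj₂ (Equivalence.to (S⇔ (Fin.suc i)) (there i∈S))))
      (λ (_ , i<b) → drop-there (Equivalence.from (S⇔ (Fin.suc i)) (z≤n , s≤s i<b))))
∣interval∣ (inside ∷ S) (suc a) (suc b) _ S⇔ with () ← proj₁ (Equivalence.to (S⇔ 0F) here)
∣interval∣ (outside ∷ S) (suc a) (suc b) (s≤s b≤n) S⇔ = ∣interval∣ S a b b≤n λ i →
  mk⇔ (λ i∈S → let a≤i , i<b = Equivalence.to (S⇔ (Fin.suc i)) (there i∈S) in ℕ.s≤s⁻¹ a≤i , ℕ.s≤s⁻¹ i<b)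
      (λ (a≤i , i<b) → drop-there (Equivalence.from (S⇔ (Fin.suc i)) (s≤s a≤i , s≤s i<b)))

module Endpoint {D} {W : Pred (V D) 0ℓ} (isTModule : IsTModule W) {r}
  (vanishing : ∀ {i v} → i ℕ.< r → v ∈ W → proj i v ≋ 0ⱽ) where
  open IsTModule isTModule
  open TModule isTModule

  -- Applied to E*ᵣv, A splits into lower, which lands in weight r - 1, and raise, which lands in
  -- weight r + 1. So `lower` is the component in weight r - 1 of a vector of W, and that component
  -- vanishes by the choice of r.
  lower-endpoint : ∀ {v} → v ∈ W → lower (proj r v) ≋ 0ⱽ
  lower-endpoint = go r ≡.refl
    where
    -- The equation permits a case distinction on r, which is fixed by the module.
    go : ∀ s → s ≡ r → ∀ {v} → v ∈ W → lower (proj s v) ≋ 0ⱽ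
    go zero    _      {v} _   = lower-proj-0 v
    go (suc s) ≡.refl {v} v∈W y = begin
      lower x y
        ≈⟨ lower≋ y ⟩
      proj s (lower x) y
        ≈⟨ solve 1 (λ p → p := :1 :* p :+ :1 :* :0) refl _ ⟩
      1# * proj s (lower x) y + 1# * 0#
        ≈⟨ +-congˡ (*-congˡ (trans (proj-cong s (raise-proj (suc s) v) y)
             (proj-proj≢ (raise v) (λ eq → ℕ.<⇒≢ (ℕ.m<n⇒m<1+n (ℕ.n<1+n s)) eq) y))) ⟨
      1# * proj s (lower x) y + 1# * proj s (raise x) y
        ≈⟨ trans (proj-cong s (deriv-σx x) y) (proj-lin s 1# (lower x) 1# (raise x) y) ⟨
      proj s (deriv σx x) y
        ≈⟨ vanishing (ℕ.n<1+n s) (σx-closed (proj-closed (suc s) v∈W)) y ⟩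
      0# ∎
      where
      x = proj (suc s) v
      lower≋ : lower x ≋ proj s (lower x)
      lower≋ = ≋-trans (lower-proj s v) (≋-trans (≋-sym (proj-proj s (lower v)))
        (proj-cong s (≋-sym (lower-proj s v))))

  highestWeight-∈ : ∀ {v} → v ∈ W → HighestWeight r (kron P₁⁻¹ (proj r v))
  highestWeight-∈ {v} v∈W = highestWeight r v (lower-endpoint v∈W)

  -- The antipodal map kron σx lies in T and interchanges E*ᵢ and E*_{D-i}.
  vanishing-above : ∀ {i v} → D ℕ.< r ℕ.+ i → v ∈ W → proj i v ≋ 0ⱽ
  vanishing-above {i} {v} D<r+i v∈W y = case wt y ℕ.≟ i of λ where
    (no ≢i) → proj-off i v y ≢i
    (yes ≡.refl) → begin
      proj (wt y) v y             ≈⟨ proj-on (wt y) v y ≡.refl ⟩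
      v y                         ≡⟨ ≡.cong v (flip-involutive y) ⟨
      v (flip (flip y))           ≈⟨ kron-σx-flip v (flip y) ⟨
      kron σx v (flip y)            ≈⟨ proj-on (wt (flip y)) (kron σx v) (flip y) ≡.refl ⟨
      proj (wt (flip y)) (kron σx v) (flip y)
        ≈⟨ vanishing (ℕ.+-cancelʳ-< (wt y) (wt (flip y)) r
             (≡.subst (ℕ._< r ℕ.+ wt y) (≡.sym
                 (≡.trans (ℕ.+-comm (wt (flip y)) (wt y)) (wt-flip y))) D<r+i))
             (σx-flip-closed v∈W) (flip y) ⟩
      0#                          ∎

  module _ {u} (u∈W : u ∈ W) (hw : HighestWeight r u) where

    component-suc : ∀ j → proj (r ℕ.+ j) u ≋ 0ⱽ → proj (r ℕ.+ suc j) u ≋ 0ⱽ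
    component-suc j p≋0 y = ℕ→ℂ-cancel j (trans (sym (raise-component hw j y))
      (trans (trans (deriv-cong e₁₀ p≋0 y) (deriv-0ⱽ e₁₀ y)) (sym (zeroʳ (ℕ→ℂ (suc j))))))

    component-pred : ∀ {d} → D ≡ r ℕ.+ r ℕ.+ d → ∀ {j} → suc j ℕ.≤ d →
      proj (r ℕ.+ suc j) u ≋ 0ⱽ → proj (r ℕ.+ j) u ≋ 0ⱽ
    component-pred {d} D≡ {j} j<d p≋0 y = ℕ→ℂ-cancel m (begin
      ℕ→ℂ (suc m) * proj (r ℕ.+ j) u y
        ≡⟨ ≡.cong (λ p → ℚ→ℂ p * proj (r ℕ.+ j) u y) d-j ⟨
      ℚ→ℂ (ℕ→ℚ d ℚ.- ℕ→ℚ j) * proj (r ℕ.+ j) u y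
        ≈⟨ lower-component hw D≡ j y ⟨
      lower (proj (r ℕ.+ suc j) u) y
        ≈⟨ trans (deriv-cong e₀₁ p≋0 y) (deriv-0ⱽ e₀₁ y) ⟩
      0#
        ≈⟨ zeroʳ (ℕ→ℂ (suc m)) ⟨
      ℕ→ℂ (suc m) * 0# ∎)
      where
      m = d ℕ.∸ suc j
      d-j : ℕ→ℚ d ℚ.- ℕ→ℚ j ≡ ℕ→ℚ (suc m)
      d-j = ≡.trans (≡.cong (λ n → ℕ→ℚ n ℚ.- ℕ→ℚ j)
          (≡.sym (≡.trans (≡.sym (ℕ.+-suc m j)) (ℕ.m∸n+n≡m j<d))))
        (≡.trans (≡.cong (ℚ._- ℕ→ℚ j) (ℕ→ℚ-+ (suc m) j))
        (≡.trans (ℚ.+-assoc (ℕ→ℚ (suc m)) (ℕ→ℚ j) (ℚ.- ℕ→ℚ j))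
        (≡.trans (≡.cong (ℕ→ℚ (suc m) ℚ.+_) (ℚ.+-inverseʳ (ℕ→ℚ j))) (ℚ.+-identityʳ (ℕ→ℚ (suc m))))))

    -- One zero component kills the vector. `lower`, with coefficients d - j > 0, carries the zero
    -- down to weight r; from there `raise` carries it up to all higher weights, and the weights
    -- below r are empty by the choice of r.
    components-vanish : ∀ {d} → D ≡ r ℕ.+ r ℕ.+ d → ∀ j → j ℕ.≤ d →
      proj (r ℕ.+ j) u ≋ 0ⱽ → u ≋ 0ⱽ
    components-vanish D≡ (suc j) j<d p≋0 =
      components-vanish D≡ j (ℕ.<⇒≤ j<d) (component-pred D≡ j<d p≋0)
    components-vanish D≡ zero _ p≋0 y = trans (sym (proj-on (wt y) u y ≡.refl))
      (case r ℕ.≤? wt y of λ where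
        (yes r≤wt) → trans (≡⇒≈ (≡.cong (λ k → proj k u y) (≡.sym (ℕ.m+[n∸m]≡n r≤wt))))
            (above (wt y ℕ.∸ r) y)
        (no r≰wt)  → vanishing (ℕ.≰⇒> r≰wt) u∈W y)
      where
      above : ∀ j → proj (r ℕ.+ j) u ≋ 0ⱽ
      above zero    = p≋0
      above (suc j) = component-suc j (above j)

module _ {D} {W : Pred (V D) 0ℓ} where

  E*-nonvanishing : ∀ {i} → ¬ (∀ {v} → v ∈ W → proj i v ≋ 0ⱽ) → ¬ (E* i ⟪ W ⟫ ≐ 𝟎)
  E*-nonvanishing {i} ¬vanishing (⊆𝟎 , _) = ¬vanishing λ {v} v∈W →
    ≋-trans (≋-sym (E*-· i v)) (⊆𝟎 (v , v∈W , ≋-refl))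

  E*-vanishing : IsTModule W → ∀ {i} → (∀ {v} → v ∈ W → proj i v ≋ 0ⱽ) → E* i ⟪ W ⟫ ≐ 𝟎
  E*-vanishing isTModule {i} vanishing =
    (λ (w , w∈W , v≋) → ≋-trans v≋ (≋-trans (E*-· i w) (vanishing w∈W))) ,
    (λ v≋0 → 0ⱽ , 0-closed , ≋-trans v≋0 (≋-sym (≋-trans (E*-· i 0ⱽ) (vanishing 0-closed))))
    where open IsSubspace (IsTModule.isSubspace isTModule)

  -- Minimality of r merely refutes nonvanishing; stability of equality turns this into an equation
  -- at every vertex.
  endpoint-vanishing : ∀ {r} → IsEndpoint W r → ∀ {i v} → i ℕ.< r → v ∈ W → proj i v ≋ 0ⱽ
  endpoint-vanishing {r} (r≤D , _ , minimal) {i} {v} i<r v∈W y = ≈-stable λ ¬≈0 →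
    ℕ.<⇒≱ i<r (minimal i (ℕ.≤-trans (ℕ.<⇒≤ i<r) r≤D)
      (E*-nonvanishing λ vanishing → ¬≈0 (vanishing v∈W y)))

  -- The weights that occur in W are exactly those from r to D - r: smaller ones are excluded by the
  -- endpoint, larger ones by the antipodal map, and in between no component of the nonzero vector u
  -- can vanish. Counting S then determines d.
  diameter : IsTModule W → ∀ {r d} → IsEndpoint W r → IsDiameter W d →
    ∀ {u} → u ∈ W → HighestWeight r u → ¬ (u ≋ 0ⱽ) → D ≡ r ℕ.+ r ℕ.+ d
  diameter isTModule {r} {d} endpoint@(_ , nonvanishing , _) (S , S⇔ , ∣S∣≡) {u} u∈W hw u≢0 =
    ≡.trans D≡ (≡.cong (r ℕ.+ r ℕ.+_) (ℕ.suc-injective (≡.trans (≡.sym ∣S∣≡′) ∣S∣≡)))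
    where
    open TModule isTModule
    open Endpoint isTModule {r} (endpoint-vanishing endpoint)
    2r≤D : r ℕ.+ r ℕ.≤ D
    2r≤D with r ℕ.+ r ℕ.≤? D
    ... | yes le = le
    -- Otherwise weight r itself would exceed D - r, and the antipodal map would give E*ᵣW = 0.
    ... | no ≰D = contradiction (E*-vanishing isTModule (vanishing-above (ℕ.≰⇒> ≰D))) nonvanishing
    e = D ℕ.∸ (r ℕ.+ r)
    D≡ : D ≡ r ℕ.+ r ℕ.+ e
    D≡ = ≡.sym (ℕ.m+[n∸m]≡n 2r≤D)
    inside⇒ : ∀ i → ¬ (E* i ⟪ W ⟫ ≐ 𝟎) → r ℕ.≤ i × i ℕ.< suc (r ℕ.+ e)
    inside⇒ i ≢𝟎 = ℕ.≮⇒≥ (λ i<r → ≢𝟎 (E*-vanishing isTModule (endpoint-vanishing endpoint i<r))) ,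
      ℕ.≰⇒> (λ r+e<i → ≢𝟎 (E*-vanishing isTModule (vanishing-above
        (≡.subst (ℕ._< r ℕ.+ i) (≡.sym (≡.trans D≡ (ℕ.+-assoc r r e))) (ℕ.+-monoʳ-< r r+e<i)))))
    ⇒inside : ∀ i → r ℕ.≤ i → i ℕ.< suc (r ℕ.+ e) → ¬ (E* i ⟪ W ⟫ ≐ 𝟎)
    ⇒inside i r≤i i≤r+e = E*-nonvanishing λ vanishing → u≢0
      (components-vanish u∈W hw D≡ (i ℕ.∸ r)
        (ℕ.m≤n+o⇒m∸n≤o i r (ℕ.s≤s⁻¹ i≤r+e))
        (≡.subst (λ k → proj k u ≋ 0ⱽ) (≡.sym (ℕ.m+[n∸m]≡n r≤i)) (vanishing u∈W)))
    ∣S∣≡′ : ∣ S ∣ ≡ suc e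
    ∣S∣≡′ = ≡.trans (∣interval∣ S r (suc (r ℕ.+ e))
      (s≤s (≡.subst (r ℕ.+ e ℕ.≤_) (≡.sym (≡.trans D≡ (ℕ.+-assoc r r e))) (ℕ.m≤n+m (r ℕ.+ e) r)))
      λ i → mk⇔ (λ i∈S → inside⇒ (toℕ i) (Equivalence.to (S⇔ i) i∈S))
                (λ (r≤i , i<) → Equivalence.from (S⇔ i) (⇒inside (toℕ i) r≤i i<)))
      (≡.trans (≡.cong (ℕ._∸ r) (≡.sym (ℕ.+-suc r e))) (ℕ.m+n∸m≡n r (suc e)))

-- The inner products

conj-gaussian : ∀ {z w} a b → z ≈ gaussian (a , b) → w ≈ gaussian (a , ℚ.- b) → z ≈ conj w
conj-gaussian a b z≈ w≈ = trans z≈ (sym (trans (conj-cong w≈)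
  (ℝᴿ.refl , ℝᴿ.trans (ℝᴿ.sym (ℚ→ℝ-neg (ℚ.- b))) (ℝᴿ.reflexive (≡.cong ℚ→ℝ (neg-neg b))))))
  where
  neg-neg : ∀ b → ℚ.- (ℚ.- b) ≡ b
  neg-neg = solveℚ 1 (λ b → ⊖ (⊖ b) == b) ≡.refl
    where open ℚ-Solver

P₁⁻¹-adjoint : ∀ a b → P₁⁻¹ a b ≈ conj (scale (ℚ→ℂ ½) P₁ b a)
P₁⁻¹-adjoint 0F 0F = conj-gaussian ½ 0ℚ refl (solve 0 (:½ :* :1 := con (½ , 0ℚ)) refl)
P₁⁻¹-adjoint 0F 1F = conj-gaussian 0ℚ ½ (solve 0 (:½ :* :𝐢 := con (0ℚ , ½)) refl)
  (solve 0 (:½ :* (:- :𝐢) := con (0ℚ , ℚ.- ½)) refl)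
P₁⁻¹-adjoint 1F 0F = conj-gaussian ½ 0ℚ refl (solve 0 (:½ :* :1 := con (½ , 0ℚ)) refl)
P₁⁻¹-adjoint 1F 1F = conj-gaussian 0ℚ (ℚ.- ½) (solve 0 (:- (:½ :* :𝐢) := con (0ℚ , ℚ.- ½)) refl)
  (solve 0 (:½ :* :𝐢 := con (0ℚ , ½)) refl)

σx-adjoint : ∀ a b → σx a b ≈ conj (σx b a)
σx-adjoint 0F 0F = conj-gaussian 0ℚ 0ℚ refl refl
σx-adjoint 0F 1F = conj-gaussian 1ℚ 0ℚ refl refl
σx-adjoint 1F 0F = conj-gaussian 1ℚ 0ℚ refl refl
σx-adjoint 1F 1F = conj-gaussian 0ℚ 0ℚ refl refl

σz-adjoint : ∀ a b → σz a b ≈ conj (σz b a)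
σz-adjoint 0F 0F = conj-gaussian 1ℚ 0ℚ refl refl
σz-adjoint 0F 1F = conj-gaussian 0ℚ 0ℚ refl refl
σz-adjoint 1F 0F = conj-gaussian 0ℚ 0ℚ refl refl
σz-adjoint 1F 1F = conj-gaussian (ℚ.- 1ℚ) 0ℚ (sym (ℚ→ℂ-neg 1ℚ)) (sym (ℚ→ℂ-neg 1ℚ))

⟨⟩-•ˡ : ∀ {D} c (v w : V D) → ⟨ c •ⱽ v , w ⟩ ≈ c * ⟨ v , w ⟩
⟨⟩-•ˡ c v w = trans (∑-cong λ y → *-assoc c (v y) (conj (w y)))
    (*-distribˡ-∑ c (λ y → v y * conj (w y)))

⟨⟩-•ʳ : ∀ {D} c (v w : V D) → conj c ≈ c → ⟨ v , c •ⱽ w ⟩ ≈ c * ⟨ v , w ⟩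
⟨⟩-•ʳ c v w real = trans
  (∑-cong λ y → trans (*-congˡ (trans (conj-* c (w y)) (*-congʳ real)))
    (solve 3 (λ v c w → v :* (c :* w) := c :* (v :* w)) refl (v y) c (conj (w y))))
  (*-distribˡ-∑ c (λ y → v y * conj (w y)))

⟨⟩-0ʳ : ∀ {D} (v : V D) → ⟨ v , 0ⱽ ⟩ ≈ 0#
⟨⟩-0ʳ v = ∑-zero λ y → trans (*-congˡ (conj-ℚ→ℂ 0ℚ)) (zeroʳ (v y))

real-^ : ∀ {c} → conj c ≈ c → ∀ n → conj (c ^ n) ≈ c ^ n
real-^ real zero    = conj-ℚ→ℂ 1ℚ
real-^ {c} real (suc n) = trans (conj-* c (c ^ n)) (*-cong real (real-^ real n))

-- The adjoint of P₁⁻¹ is ½P₁, so every tensor factor contributes ½.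
kron-P⁻¹-isometry : ∀ {D} (v w : V D) → ⟨ kron P₁⁻¹ v , kron P₁⁻¹ w ⟩ ≈ ℚ→ℂ ½ ^ D * ⟨ v , w ⟩
kron-P⁻¹-isometry {D} v w = begin
  ⟨ kron P₁⁻¹ v , kron P₁⁻¹ w ⟩
    ≈⟨ kron-adjoint P₁⁻¹ (scale (ℚ→ℂ ½) P₁) P₁⁻¹-adjoint v (kron P₁⁻¹ w) ⟩
  ⟨ v , kron (scale (ℚ→ℂ ½) P₁) (kron P₁⁻¹ w) ⟩
    ≈⟨ ⟨⟩-cong {v = v} ≋-refl (λ y → trans (kron-scale (ℚ→ℂ ½) P₁ (kron P₁⁻¹ w) y)
        (*-congˡ (kron-P-P⁻¹ w y))) ⟩
  ⟨ v , ℚ→ℂ ½ ^ D •ⱽ w ⟩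
    ≈⟨ ⟨⟩-•ʳ (ℚ→ℂ ½ ^ D) v w (real-^ (conj-ℚ→ℂ ½) D) ⟩
  ℚ→ℂ ½ ^ D * ⟨ v , w ⟩ ∎

proj-adjoint : ∀ {D} k (v w : V D) → ⟨ proj k v , w ⟩ ≈ ⟨ v , proj k w ⟩
proj-adjoint k v w = ∑-cong λ y → case wt y ℕ.≟ k of λ where
  (yes eq) → *-cong (proj-on k v y eq) (conj-cong (sym (proj-on k w y eq)))
  (no ≢k) → trans (trans (*-congʳ (proj-off k v y ≢k)) (zeroˡ (conj (w y))))
    (sym (trans (*-congˡ (trans (conj-cong (proj-off k w y ≢k)) (conj-ℚ→ℂ 0ℚ))) (zeroʳ (v y))))

½^n*2^n≈1 : ∀ n → ℚ→ℂ ½ ^ n * ℕ→ℂ (2 ℕ.^ n) ≈ 1#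
½^n*2^n≈1 zero    = *-identityˡ 1#
½^n*2^n≈1 (suc n) = begin
  ℚ→ℂ ½ * ℚ→ℂ ½ ^ n * ℕ→ℂ (2 ℕ.* 2 ℕ.^ n)
    ≈⟨ *-congˡ (trans (≡⇒≈ (≡.cong ℚ→ℂ (ℕ→ℚ-* 2 (2 ℕ.^ n)))) (ℚ→ℂ-* (ℕ→ℚ 2) (ℕ→ℚ (2 ℕ.^ n)))) ⟩
  ℚ→ℂ ½ * ℚ→ℂ ½ ^ n * (ℕ→ℂ 2 * ℕ→ℂ (2 ℕ.^ n))
    ≈⟨ solve 2 (λ p q → :½ :* p :* (con (ℕ→ℚ 2 , 0ℚ) :* q) := p :* q) refl _ _ ⟩
  ℚ→ℂ ½ ^ n * ℕ→ℂ (2 ℕ.^ n)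
    ≈⟨ ½^n*2^n≈1 n ⟩
  1# ∎

binomialSum : ℕ → ℕ → ℕ
binomialSum d zero    = 0
binomialSum d (suc n) = binomialSum d n ℕ.+ (d C n)

binomialSum-pascal : ∀ d n → binomialSum (suc d) (suc n) ≡ binomialSum d (suc n) ℕ.+ binomialSum d n
binomialSum-pascal d zero    = ≡.refl
binomialSum-pascal d (suc n) = ≡.trans
  (≡.cong₂ ℕ._+_ (binomialSum-pascal d n) (≡.sym (nCk+nC[k+1]≡[n+1]C[k+1] d n)))
  (≡.trans (≡.sym (ℕ.+-assoc (b ℕ.+ (d C n) ℕ.+ b) (d C n) (d C suc n)))
  (≡.trans (≡.cong (ℕ._+ (d C suc n)) (ℕ.+-assoc (b ℕ.+ (d C n)) b (d C n)))
  (≡.trans (ℕ.+-assoc (b ℕ.+ (d C n)) (b ℕ.+ (d C n)) (d C suc n))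
  (≡.trans (≡.cong ((b ℕ.+ (d C n)) ℕ.+_) (ℕ.+-comm (b ℕ.+ (d C n)) (d C suc n)))
    (≡.sym (ℕ.+-assoc (b ℕ.+ (d C n)) (d C suc n) (b ℕ.+ (d C n))))))))
  where
  b = binomialSum d n

binomialSum≡2^d : ∀ d → binomialSum d (suc d) ≡ 2 ℕ.^ d
binomialSum≡2^d zero    = ≡.refl
binomialSum≡2^d (suc d) = ≡.trans (binomialSum-pascal d (suc d)) (≡.cong₂ ℕ._+_
  -- The first partial sum runs one index too far, but the extra term `d C suc d` is 0.
  (≡.trans (≡.cong₂ ℕ._+_ (binomialSum≡2^d d) (k>n⇒nCk≡0 (ℕ.n<1+n d))) (ℕ.+-identityʳ (2 ℕ.^ d)))
  (≡.trans (binomialSum≡2^d d) (≡.sym (ℕ.+-identityʳ (2 ℕ.^ d)))))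

module Formula {D} {W : Pred (V D) 0ℓ} (isTModule : IsTModule W) {r d}
  (vanishing : ∀ {i v} → i ℕ.< r → v ∈ W → proj i v ≋ 0ⱽ) (D≡ : D ≡ r ℕ.+ r ℕ.+ d) where
  open IsTModule isTModule
  open IsSubspace isSubspace
  open TModule isTModule
  open Endpoint isTModule {r} vanishing

  -- Here w plays the part of P uᵋ and P⁻¹E*ᵣz that of u. Then E_{r+i}uᵋ = P⁻¹E*_{r+i}w, so both
  -- arguments of the inner product come from weight components of highest weight vectors.
  module _ {w z} (w∈W : w ∈ W) (w-hw : HighestWeight r w) (z∈W : z ∈ W) where
    private
      u = kron P₁⁻¹ (proj r z)
      u∈W : u ∈ W
      u∈W = P⁻¹-closed (proj-closed r z∈W)
      u-hw : HighestWeight r u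
      u-hw = highestWeight-∈ z∈W

      left right : ℕ → V D
      left i  = kron P₁⁻¹ (proj (r ℕ.+ i) w)
      right j = proj (r ℕ.+ j) u

      f : ℕ → ℕ → ℂ
      f i j = ⟨ left i , right j ⟩

      r+0 : ∀ (v : V D) → proj (r ℕ.+ 0) v ≋ proj r v
      r+0 v y = ≡⇒≈ (≡.cong (λ k → proj k v y) (ℕ.+-identityʳ r))

      lower-first : ∀ {v} → v ∈ W → lower (proj (r ℕ.+ 0) v) ≋ 0ⱽ
      lower-first {v} v∈W = ≋-trans (deriv-cong e₀₁ (r+0 v)) (lower-endpoint v∈W)

      θ≡ : ∀ i → θ D (r ℕ.+ i) ≡ ℕ→ℚ d ℚ.- 2ℚ ℚ.* ℕ→ℚ i
      θ≡ i = ≡.trans (≡.cong₂ (λ p q → p ℚ.- q)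
          (≡.trans (≡.cong ℕ→ℚ D≡) (≡.trans (ℕ→ℚ-+ (r ℕ.+ r) d) (≡.cong (ℚ._+ ℕ→ℚ d) (ℕ→ℚ-+ r r))))
          (≡.trans (ℕ→ℚ-* 2 (r ℕ.+ i)) (≡.cong (ℕ→ℚ 2 ℚ.*_) (ℕ→ℚ-+ r i))))
        (solveℚ 3 (λ r d i → r ⊕ r ⊕ d ⊖ conℚ (ℕ→ℚ 2) ⊛ (r ⊕ i) == d ⊖ conℚ 2ℚ ⊛ i) ≡.refl
          (ℕ→ℚ r) (ℕ→ℚ d) (ℕ→ℚ i))
        where
        open ℚ-Solver

      σx-move : ∀ i j → ℚ→ℂ (ℕ→ℚ d ℚ.- 2ℚ ℚ.* ℕ→ℚ i) * f i j ≈ ⟨ left i , deriv σx (right j) ⟩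
      σx-move i j = begin
        ℚ→ℂ (ℕ→ℚ d ℚ.- 2ℚ ℚ.* ℕ→ℚ i) * f i j
          ≡⟨ ≡.cong (λ p → ℚ→ℂ p * f i j) (θ≡ i) ⟨
        ℚ→ℂ (θ D (r ℕ.+ i)) * f i j
          ≈⟨ ⟨⟩-•ˡ (ℚ→ℂ (θ D (r ℕ.+ i))) (left i) (right j) ⟨
        ⟨ ℚ→ℂ (θ D (r ℕ.+ i)) •ⱽ left i , right j ⟩
          ≈⟨ ⟨⟩-cong {w = right j} (σx-eigenvector (r ℕ.+ i) w) ≋-refl ⟨
        ⟨ deriv σx (left i) , right j ⟩
          ≈⟨ deriv-adjoint σx σx σx-adjoint (left i) (right j) ⟩
        ⟨ left i , deriv σx (right j) ⟩ ∎

      recurrenceʳ-zero : ∀ i → ℚ→ℂ (ℕ→ℚ d ℚ.- 2ℚ ℚ.* ℕ→ℚ i) * f i 0 ≈ f i 1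
      recurrenceʳ-zero i = trans (σx-move i 0) (⟨⟩-cong {v = left i} ≋-refl λ y → begin
        deriv σx (right 0) y                             ≈⟨ deriv-σx (right 0) y ⟩
        1# * lower (right 0) y + 1# * raise (right 0) y ≈⟨ +-cong (*-congˡ (lower-first u∈W y))
            (*-congˡ (raise-component u-hw 0 y)) ⟩
        1# * 0# + 1# * (1# * right 1 y)                ≈⟨ solve 1
            (λ p → :1 :* :0 :+ :1 :* (:1 :* p) := p) refl (right 1 y) ⟩
        right 1 y                                      ∎)

      recurrenceʳ-suc : ∀ i j → ℚ→ℂ (ℕ→ℚ d ℚ.- 2ℚ ℚ.* ℕ→ℚ i) * f i (suc j)
        ≈ ℕ→ℂ (suc (suc j)) * f i (suc (suc j)) + ℚ→ℂ (ℕ→ℚ d ℚ.- ℕ→ℚ j) * f i j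
      recurrenceʳ-suc i j = begin
        ℚ→ℂ (ℕ→ℚ d ℚ.- 2ℚ ℚ.* ℕ→ℚ i) * f i (suc j)
          ≈⟨ σx-move i (suc j) ⟩
        ⟨ left i , deriv σx (right (suc j)) ⟩
          ≈⟨ ⟨⟩-cong {v = left i} ≋-refl step ⟩
        ⟨ left i , lin (ℕ→ℂ (suc (suc j))) (right (suc (suc j))) (ℚ→ℂ (ℕ→ℚ d ℚ.- ℕ→ℚ j)) (right j) ⟩
          ≈⟨ ⟨⟩-linʳ (left i) (ℕ→ℂ (suc (suc j))) (right (suc (suc j))) (ℚ→ℂ (ℕ→ℚ d ℚ.- ℕ→ℚ j))
              (right j) ⟩
        conj (ℕ→ℂ (suc (suc j))) * f i (suc (suc j)) + conj (ℚ→ℂ (ℕ→ℚ d ℚ.- ℕ→ℚ j)) * f i j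
          ≈⟨ +-cong (*-congʳ (conj-ℚ→ℂ (ℕ→ℚ (suc (suc j))))) (*-congʳ (conj-ℚ→ℂ (ℕ→ℚ d ℚ.- ℕ→ℚ j))) ⟩
        ℕ→ℂ (suc (suc j)) * f i (suc (suc j)) + ℚ→ℂ (ℕ→ℚ d ℚ.- ℕ→ℚ j) * f i j ∎
        where
        step : deriv σx (right (suc j)) ≋ lin (ℕ→ℂ (suc (suc j))) (right (suc (suc j)))
            (ℚ→ℂ (ℕ→ℚ d ℚ.- ℕ→ℚ j)) (right j)
        step y = trans (deriv-σx (right (suc j)) y)
          (trans (+-cong (*-congˡ (lower-component u-hw D≡ j y))
              (*-congˡ (raise-component u-hw (suc j) y)))
            (solve 4 (λ a b p q → :1 :* (a :* p) :+ :1 :* (b :* q) := b :* q :+ a :* p) refl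
              (ℚ→ℂ (ℕ→ℚ d ℚ.- ℕ→ℚ j)) (ℕ→ℂ (suc (suc j))) (right j y) (right (suc (suc j)) y)))

      -- The leading coefficient j + 2 of the recurrence is invertible, so f i 0 determines all f i
      -- j. The Krawtchouk numbers solve the same recurrence with initial values 1 and d - 2i.
      right-determined : ∀ i → i ℕ.≤ d → ∀ j → f i j ≈ ℚ→ℂ (krawtchouk d i j) * f i 0
      right-determined i i≤d j = proj₁ (go j)
        where
        determined : ℕ → Set
        determined j = f i j ≈ ℚ→ℂ (krawtchouk d i j) * f i 0
        step : ∀ j → determined j → determined (suc j) → determined (suc (suc j))
        step j p q = ℕ→ℂ-cancel (suc j) (begin
          n * f i (suc (suc j))
            ≈⟨ solve 2 (λ x y → x := (x :+ y) :- y) refl (n * f i (suc (suc j))) (m * f i j) ⟩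
          (n * f i (suc (suc j)) + m * f i j) - m * f i j
            ≈⟨ +-cong (sym (recurrenceʳ-suc i j)) (ℂᴿ.-‿cong (*-congˡ p)) ⟩
          l * f i (suc j) - m * (ℚ→ℂ (k j) * f i 0)
            ≈⟨ +-congʳ (*-congˡ q) ⟩
          l * (ℚ→ℂ (k (suc j)) * f i 0) - m * (ℚ→ℂ (k j) * f i 0)
            ≈⟨ solve 5 (λ l a m b g → l :* (a :* g) :- m :* (b :* g) := (l :* a :- m :* b) :* g) refl
                 l (ℚ→ℂ (k (suc j))) m (ℚ→ℂ (k j)) (f i 0) ⟩
          (l * ℚ→ℂ (k (suc j)) - m * ℚ→ℂ (k j)) * f i 0
            ≈⟨ *-congʳ (+-congʳ recurrence) ⟩
          (n * ℚ→ℂ (k (suc (suc j))) + m * ℚ→ℂ (k j) - m * ℚ→ℂ (k j)) * f i 0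
            ≈⟨ solve 4 (λ n a b g → (n :* a :+ b :- b) :* g := n :* (a :* g)) refl
                 n (ℚ→ℂ (k (suc (suc j)))) (m * ℚ→ℂ (k j)) (f i 0) ⟩
          n * (ℚ→ℂ (k (suc (suc j))) * f i 0) ∎)
          where
          k = krawtchouk d i
          l m n : ℂ
          l = ℚ→ℂ (ℕ→ℚ d ℚ.- 2ℚ ℚ.* ℕ→ℚ i)
          m = ℚ→ℂ (ℕ→ℚ d ℚ.- ℕ→ℚ j)
          n = ℕ→ℂ (suc (suc j))
          recurrence : l * ℚ→ℂ (k (suc j)) ≈ n * ℚ→ℂ (k (suc (suc j))) + m * ℚ→ℂ (k j)
          recurrence = begin
            l * ℚ→ℂ (k (suc j))
              ≈⟨ ℚ→ℂ-* (ℕ→ℚ d ℚ.- 2ℚ ℚ.* ℕ→ℚ i) (k (suc j)) ⟨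
            ℚ→ℂ ((ℕ→ℚ d ℚ.- 2ℚ ℚ.* ℕ→ℚ i) ℚ.* k (suc j))
              ≡⟨ ≡.cong ℚ→ℂ (krawtchouk-recurrence d i j i≤d) ⟩
            ℚ→ℂ (ℕ→ℚ (suc (suc j)) ℚ.* k (suc (suc j)) ℚ.+ (ℕ→ℚ d ℚ.- ℕ→ℚ j) ℚ.* k j)
              ≈⟨ trans (ℚ→ℂ-+ (ℕ→ℚ (suc (suc j)) ℚ.* k (suc (suc j))) ((ℕ→ℚ d ℚ.- ℕ→ℚ j) ℚ.* k j))
                   (+-cong (ℚ→ℂ-* (ℕ→ℚ (suc (suc j))) (k (suc (suc j))))
                       (ℚ→ℂ-* (ℕ→ℚ d ℚ.- ℕ→ℚ j) (k j))) ⟩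
            n * ℚ→ℂ (k (suc (suc j))) + m * ℚ→ℂ (k j) ∎
        go : ∀ j → determined j × determined (suc j)
        go zero = sym (trans (*-congʳ (≡⇒≈ (≡.cong ℚ→ℂ (krawtchouk-zeroʳ d i))))
            (*-identityˡ (f i 0))) ,
          trans (sym (recurrenceʳ-zero i)) (*-congʳ (≡⇒≈ (≡.cong ℚ→ℂ (≡.sym (krawtchouk-one d i i≤d)))))
        go (suc j) = let p , q = go j in q , step j p q

      -- Now the right argument is the eigenvector: `right 0` belongs to the eigenvalue d of A*.
      -- Moved to the left and through P⁻¹, A* becomes Aᵋ acting on components of w, where lowering
      -- and raising carry the coefficients 𝐢 and -𝐢. This is the origin of 𝐢ⁱ.
      σz-move : ∀ i → ℕ→ℂ d * f i 0 ≈ ⟨ kron P₁⁻¹ (deriv σy (proj (r ℕ.+ i) w)) , right 0 ⟩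
      σz-move i = begin
        ℕ→ℂ d * f i 0
          ≈⟨ ⟨⟩-•ʳ (ℕ→ℂ d) (left i) (right 0) (conj-ℚ→ℂ (ℕ→ℚ d)) ⟨
        ⟨ left i , ℕ→ℂ d •ⱽ right 0 ⟩
          ≈⟨ ⟨⟩-cong {v = left i} ≋-refl eigen ⟨
        ⟨ left i , deriv σz (right 0) ⟩
          ≈⟨ deriv-adjoint σz σz σz-adjoint (left i) (right 0) ⟨
        ⟨ deriv σz (left i) , right 0 ⟩
          ≈⟨ ⟨⟩-cong {w = right 0} (kron-deriv P₁⁻¹ σy σz P₁⁻¹⊙σy (proj (r ℕ.+ i) w)) ≋-refl ⟨
        ⟨ kron P₁⁻¹ (deriv σy (proj (r ℕ.+ i) w)) , right 0 ⟩ ∎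
        where
        θ≡d : θ D (r ℕ.+ 0) ≡ ℕ→ℚ d
        θ≡d = ≡.trans (θ≡ 0) (ℚ.+-identityʳ (ℕ→ℚ d))
        eigen : deriv σz (right 0) ≋ ℕ→ℂ d •ⱽ right 0
        eigen y = trans (deriv-σz (right 0) y) (case wt y ℕ.≟ r ℕ.+ 0 of λ where
          (yes eq) → *-congʳ (≡⇒≈ (≡.cong ℚ→ℂ (≡.trans (≡.cong (θ D) eq) θ≡d)))
          (no ≢r) → trans (*-congˡ (proj-off (r ℕ.+ 0) u y ≢r)) (trans (zeroʳ (ℚ→ℂ (θ D (wt y))))
            (sym (trans (*-congˡ (proj-off (r ℕ.+ 0) u y ≢r)) (zeroʳ (ℕ→ℂ d))))))

      recurrenceˡ-zero : ℕ→ℂ d * f 0 0 ≈ - 𝐢 * f 1 0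
      recurrenceˡ-zero = begin
        ℕ→ℂ d * f 0 0
          ≈⟨ σz-move 0 ⟩
        ⟨ kron P₁⁻¹ (deriv σy (proj (r ℕ.+ 0) w)) , right 0 ⟩
          ≈⟨ ⟨⟩-cong {w = right 0} (≋-trans (kron-cong P₁⁻¹ step)
              (kron-lin P₁⁻¹ 0# (proj (r ℕ.+ 1) w) (- 𝐢) (proj (r ℕ.+ 1) w))) ≋-refl ⟩
        ⟨ lin 0# (left 1) (- 𝐢) (left 1) , right 0 ⟩
          ≈⟨ ⟨⟩-linˡ 0# (left 1) (- 𝐢) (left 1) (right 0) ⟩
        0# * f 1 0 + - 𝐢 * f 1 0
          ≈⟨ solve 1 (λ p → :0 :* p :+ (:- :𝐢) :* p := (:- :𝐢) :* p) refl (f 1 0) ⟩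
        - 𝐢 * f 1 0 ∎
        where
        step : deriv σy (proj (r ℕ.+ 0) w) ≋ lin 0# (proj (r ℕ.+ 1) w) (- 𝐢) (proj (r ℕ.+ 1) w)
        step y = trans (deriv-σy (proj (r ℕ.+ 0) w) y)
          (trans (+-cong (*-congˡ (lower-first w∈W y)) (*-congˡ (raise-component w-hw 0 y)))
            (solve 1 (λ p → :𝐢 :* :0 :+ (:- :𝐢) :* (:1 :* p) := :0 :* p :+ (:- :𝐢) :* p) refl
                (proj (r ℕ.+ 1) w y)))

      recurrenceˡ-suc : ∀ i → ℕ→ℂ d * f (suc i) 0
        ≈ 𝐢 * ℚ→ℂ (ℕ→ℚ d ℚ.- ℕ→ℚ i) * f i 0 + - 𝐢 * ℕ→ℂ (suc (suc i)) * f (suc (suc i)) 0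
      recurrenceˡ-suc i = begin
        ℕ→ℂ d * f (suc i) 0
          ≈⟨ σz-move (suc i) ⟩
        ⟨ kron P₁⁻¹ (deriv σy (proj (r ℕ.+ suc i) w)) , right 0 ⟩
          ≈⟨ ⟨⟩-cong {w = right 0} (≋-trans (kron-cong P₁⁻¹ step)
              (kron-lin P₁⁻¹ a (proj (r ℕ.+ i) w) b (proj (r ℕ.+ suc (suc i)) w))) ≋-refl ⟩
        ⟨ lin a (left i) b (left (suc (suc i))) , right 0 ⟩
          ≈⟨ ⟨⟩-linˡ a (left i) b (left (suc (suc i))) (right 0) ⟩
        a * f i 0 + b * f (suc (suc i)) 0 ∎
        where
        a b : ℂ
        a = 𝐢 * ℚ→ℂ (ℕ→ℚ d ℚ.- ℕ→ℚ i)
        b = - 𝐢 * ℕ→ℂ (suc (suc i))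
        step : deriv σy (proj (r ℕ.+ suc i) w) ≋ lin a (proj (r ℕ.+ i) w) b (proj (r ℕ.+ suc (suc i)) w)
        step y = trans (deriv-σy (proj (r ℕ.+ suc i) w) y)
          (trans (+-cong (*-congˡ (lower-component w-hw D≡ i y))
              (*-congˡ (raise-component w-hw (suc i) y)))
            (+-cong (sym (*-assoc 𝐢 (ℚ→ℂ (ℕ→ℚ d ℚ.- ℕ→ℚ i)) (proj (r ℕ.+ i) w y)))
              (sym (*-assoc (- 𝐢) (ℕ→ℂ (suc (suc i))) (proj (r ℕ.+ suc (suc i)) w y)))))

      -- With the powers of 𝐢 removed, the recurrence reads d c₁ = (d - i)c₀ + (i + 2)c₂ for
      -- consecutive binomial coefficients, which is `C-step` used twice.
      left-determined : ∀ i → f i 0 ≈ 𝐢 ^ i * ℕ→ℂ (d C i) * f 0 0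
      left-determined i = proj₁ (go i)
        where
        determined : ℕ → Set
        determined i = f i 0 ≈ 𝐢 ^ i * ℕ→ℂ (d C i) * f 0 0
        step : ∀ i → determined i → determined (suc i) → determined (suc (suc i))
        step i p q = ℕ→ℂ-cancel (suc i) (begin
          n * f (suc (suc i)) 0
            ≈⟨ solve 3 (λ n g x → n :* g := :𝐢 :* ((x :+ (:- :𝐢) :* n :* g) :- x)) refl n
                (f (suc (suc i)) 0) (𝐢 * m * f i 0) ⟩
          𝐢 * ((𝐢 * m * f i 0 + - 𝐢 * n * f (suc (suc i)) 0) - 𝐢 * m * f i 0)
            ≈⟨ *-congˡ (+-cong (trans (sym (recurrenceˡ-suc i)) (*-congˡ q)) (ℂᴿ.-‿cong (*-congˡ p))) ⟩
          𝐢 * (ℕ→ℂ d * (𝐢 * e * c₁ * g) - 𝐢 * m * (e * c₀ * g))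
            ≈⟨ solve 6 (λ d e c₁ g m c₀ → :𝐢 :* (d :* (:𝐢 :* e :* c₁ :* g) :- :𝐢 :* m :* (e :* c₀ :* g))
                 := (:𝐢 :* (:𝐢 :* e)) :* (d :* c₁ :- m :* c₀) :* g) refl (ℕ→ℂ d) e c₁ g m c₀ ⟩
          𝐢 * (𝐢 * e) * (ℕ→ℂ d * c₁ - m * c₀) * g
            ≈⟨ *-congʳ (*-congˡ binomial) ⟩
          𝐢 * (𝐢 * e) * (n * c₂) * g
            ≈⟨ solve 4 (λ e n c g → e :* (n :* c) :* g := n :* (e :* c :* g)) refl (𝐢 * (𝐢 * e)) n
                c₂ g ⟩
          n * (𝐢 * (𝐢 * e) * c₂ * g) ∎)
          where
          e g m n c₀ c₁ c₂ : ℂ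
          e = 𝐢 ^ i
          g = f 0 0
          m = ℚ→ℂ (ℕ→ℚ d ℚ.- ℕ→ℚ i)
          n = ℕ→ℂ (suc (suc i))
          c₀ = ℕ→ℂ (d C i)
          c₁ = ℕ→ℂ (d C suc i)
          c₂ = ℕ→ℂ (d C suc (suc i))
          binomial : ℕ→ℂ d * c₁ - m * c₀ ≈ n * c₂
          binomial = begin
            ℕ→ℂ d * c₁ - m * c₀
              ≈⟨ +-congˡ (ℂᴿ.-‿cong (trans (sym (ℚ→ℂ-* (ℕ→ℚ d ℚ.- ℕ→ℚ i) (ℕ→ℚ (d C i))))
                   (trans (≡⇒≈ (≡.cong ℚ→ℂ (≡.sym (C-step d i))))
                       (ℚ→ℂ-* (ℕ→ℚ (suc i)) (ℕ→ℚ (d C suc i)))))) ⟩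
            ℕ→ℂ d * c₁ - ℕ→ℂ (suc i) * c₁
              ≈⟨ solve 3 (λ d i c → d :* c :- i :* c := (d :- i) :* c) refl (ℕ→ℂ d) (ℕ→ℂ (suc i)) c₁ ⟩
            (ℕ→ℂ d - ℕ→ℂ (suc i)) * c₁
              ≈⟨ *-congʳ (ℚ→ℂ-- (ℕ→ℚ d) (ℕ→ℚ (suc i))) ⟨
            ℚ→ℂ (ℕ→ℚ d ℚ.- ℕ→ℚ (suc i)) * c₁
              ≈⟨ ℚ→ℂ-* (ℕ→ℚ d ℚ.- ℕ→ℚ (suc i)) (ℕ→ℚ (d C suc i)) ⟨
            ℚ→ℂ ((ℕ→ℚ d ℚ.- ℕ→ℚ (suc i)) ℚ.* ℕ→ℚ (d C suc i))
              ≡⟨ ≡.cong ℚ→ℂ (C-step d (suc i)) ⟨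
            ℚ→ℂ (ℕ→ℚ (suc (suc i)) ℚ.* ℕ→ℚ (d C suc (suc i)))
              ≈⟨ ℚ→ℂ-* (ℕ→ℚ (suc (suc i))) (ℕ→ℚ (d C suc (suc i))) ⟩
            n * c₂ ∎
        go : ∀ i → determined i × determined (suc i)
        go zero = solve 1 (λ g → g := :1 :* :1 :* g) refl (f 0 0) , (begin
          f 1 0                             ≈⟨ solve 1 (λ g → g := :𝐢 :* ((:- :𝐢) :* g)) refl (f 1 0) ⟩
          𝐢 * (- 𝐢 * f 1 0)               ≈⟨ *-congˡ recurrenceˡ-zero ⟨
          𝐢 * (ℕ→ℂ d * f 0 0)              ≈⟨ solve 2 (λ d g → :𝐢 :* (d :* g) := :𝐢 :* :1 :* d :* g)
              refl (ℕ→ℂ d) (f 0 0) ⟩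
          𝐢 * 1# * ℕ→ℂ d * f 0 0          ≡⟨ ≡.cong (λ c → 𝐢 * 1# * ℕ→ℂ c * f 0 0) (nC1≡n d) ⟨
          𝐢 * 1# * ℕ→ℂ (d C 1) * f 0 0    ∎)
        go (suc i) = let p , q = go i in q , step i p q

      rightSum : ℕ → V D
      rightSum = weightedSum (λ _ → 1#) right

      rightSum-above : ∀ n y → r ℕ.+ n ℕ.≤ wt y → rightSum n y ≈ 0#
      rightSum-above zero    y _   = refl
      rightSum-above (suc n) y le = trans
        (+-cong (*-congˡ (rightSum-above n y (ℕ.≤-trans (ℕ.+-monoʳ-≤ r (ℕ.n≤1+n n)) le)))
          (*-congˡ (proj-off (r ℕ.+ n) u y λ eq → ℕ.<⇒≢
              (ℕ.≤-trans (ℕ.≤-reflexive (≡.sym (ℕ.+-suc r n))) le) (≡.sym eq))))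
        (lin-0 1# 1# y)

      rightSum-within : ∀ n y → r ℕ.≤ wt y → wt y ℕ.< r ℕ.+ n → rightSum n y ≈ u y
      rightSum-within zero    y r≤ <r = contradiction r≤
          (ℕ.<⇒≱ (≡.subst (wt y ℕ.<_) (ℕ.+-identityʳ r) <r))
      rightSum-within (suc n) y r≤ <r+1+n = case wt y ℕ.≟ r ℕ.+ n of λ where
        (yes eq) → trans (+-cong (*-congˡ (rightSum-above n y (ℕ.≤-reflexive (≡.sym eq))))
            (*-congˡ (proj-on (r ℕ.+ n) u y eq)))
          (solve 1 (λ p → :1 :* :0 :+ :1 :* p := p) refl (u y))
        (no ≢r+n) → trans (+-cong (*-congˡ (rightSum-within n y r≤
              (ℕ.≤∧≢⇒< (ℕ.s≤s⁻¹ (≡.subst (wt y ℕ.<_) (ℕ.+-suc r n) <r+1+n)) ≢r+n)))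
            (*-congˡ (proj-off (r ℕ.+ n) u y ≢r+n)))
          (solve 1 (λ p → :1 :* p :+ :1 :* :0 := p) refl (u y))

      rightSum-below : ∀ n y → u y ≈ 0# → rightSum n y ≈ 0#
      rightSum-below zero    y _   = refl
      rightSum-below (suc n) y u≈0 = trans
        (+-cong (*-congˡ (rightSum-below n y u≈0)) (*-congˡ (case wt y ℕ.≟ r ℕ.+ n of λ where
          (yes eq) → trans (proj-on (r ℕ.+ n) u y eq) u≈0
          (no ≢r+n) → proj-off (r ℕ.+ n) u y ≢r+n)))
        (lin-0 1# 1# y)

      -- u lives in the weights from r to r + d = D - r only: the endpoint excludes the lower ones
      -- and the antipodal map the higher ones.
      rightSum≋u : rightSum (suc d) ≋ u
      rightSum≋u y = case wt y ℕ.<? r of λ where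
        (yes <r) → let u≈0 = trans (sym (proj-on (wt y) u y ≡.refl)) (vanishing <r u∈W y) in
          trans (rightSum-below (suc d) y u≈0) (sym u≈0)
        (no ≮r) → case wt y ℕ.<? r ℕ.+ suc d of λ where
          (yes <r+1+d) → rightSum-within (suc d) y (ℕ.≮⇒≥ ≮r) <r+1+d
          (no ≮r+1+d) → trans (rightSum-above (suc d) y (ℕ.≮⇒≥ ≮r+1+d))
            (sym (trans (sym (proj-on (wt y) u y ≡.refl)) (vanishing-above
              (≡.subst (ℕ._< r ℕ.+ wt y) (≡.sym (≡.trans D≡ (ℕ.+-assoc r r d)))
                (ℕ.+-monoʳ-< r (≡.subst (ℕ._≤ wt y) (ℕ.+-suc r d) (ℕ.≮⇒≥ ≮r+1+d)))) u∈W y)))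

      ⟨left,rightSum⟩ : ∀ n → ⟨ left 0 , rightSum n ⟩ ≈ ℕ→ℂ (binomialSum d n) * f 0 0
      ⟨left,rightSum⟩ zero    = trans (⟨⟩-0ʳ (left 0)) (sym (zeroˡ (f 0 0)))
      ⟨left,rightSum⟩ (suc n) = begin
        ⟨ left 0 , lin 1# (rightSum n) 1# (right n) ⟩
          ≈⟨ ⟨⟩-linʳ (left 0) 1# (rightSum n) 1# (right n) ⟩
        conj 1# * ⟨ left 0 , rightSum n ⟩ + conj 1# * f 0 n
          ≈⟨ +-cong (*-cong (conj-ℚ→ℂ 1ℚ) (⟨left,rightSum⟩ n))
               (*-cong (conj-ℚ→ℂ 1ℚ) (trans (right-determined 0 z≤n n)
                 (*-congʳ (≡⇒≈ (≡.cong ℚ→ℂ (krawtchouk-zeroˡ d n)))))) ⟩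
        1# * (ℕ→ℂ (binomialSum d n) * f 0 0) + 1# * (ℕ→ℂ (d C n) * f 0 0)
          ≈⟨ solve 3 (λ a b g → :1 :* (a :* g) :+ :1 :* (b :* g) := (a :+ b) :* g) refl
               (ℕ→ℂ (binomialSum d n)) (ℕ→ℂ (d C n)) (f 0 0) ⟩
        (ℕ→ℂ (binomialSum d n) + ℕ→ℂ (d C n)) * f 0 0
          ≈⟨ *-congʳ (ℕ→ℂ-+ (binomialSum d n) (d C n)) ⟨
        ℕ→ℂ (binomialSum d (suc n)) * f 0 0 ∎

      -- `left 0` is Eᵣ applied to P⁻¹w, and u is fixed by the orthogonal projection Eᵣ.
      -- Self-adjointness is taken from E*ᵣ, through the isometry.
      ⟨left,u⟩ : ⟨ left 0 , u ⟩ ≈ ⟨ kron P₁⁻¹ w , u ⟩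
      ⟨left,u⟩ = begin
        ⟨ left 0 , kron P₁⁻¹ (proj r z) ⟩
          ≈⟨ ⟨⟩-cong {w = u} (kron-cong P₁⁻¹ (r+0 w)) ≋-refl ⟩
        ⟨ kron P₁⁻¹ (proj r w) , kron P₁⁻¹ (proj r z) ⟩
          ≈⟨ kron-P⁻¹-isometry (proj r w) (proj r z) ⟩
        ℚ→ℂ ½ ^ D * ⟨ proj r w , proj r z ⟩
          ≈⟨ *-congˡ (trans (proj-adjoint r w (proj r z)) (⟨⟩-cong {v = w} ≋-refl (proj-proj r z))) ⟩
        ℚ→ℂ ½ ^ D * ⟨ w , proj r z ⟩
          ≈⟨ kron-P⁻¹-isometry w (proj r z) ⟨
        ⟨ kron P₁⁻¹ w , kron P₁⁻¹ (proj r z) ⟩ ∎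

      -- The coefficients `d C j` of f 0 0 in the expansion of u sum to 2ᵈ; this is where the factor
      -- 2⁻ᵈ arises.
      f₀₀ : f 0 0 ≈ ℚ→ℂ ½ ^ d * ⟨ kron P₁⁻¹ w , u ⟩
      f₀₀ = begin
        f 0 0
          ≈⟨ trans (*-congʳ (½^n*2^n≈1 d)) (*-identityˡ (f 0 0)) ⟨
        ℚ→ℂ ½ ^ d * ℕ→ℂ (2 ℕ.^ d) * f 0 0
          ≈⟨ *-assoc (ℚ→ℂ ½ ^ d) (ℕ→ℂ (2 ℕ.^ d)) (f 0 0) ⟩
        ℚ→ℂ ½ ^ d * (ℕ→ℂ (2 ℕ.^ d) * f 0 0)
          ≡⟨ ≡.cong (λ n → ℚ→ℂ ½ ^ d * (ℕ→ℂ n * f 0 0)) (binomialSum≡2^d d) ⟨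
        ℚ→ℂ ½ ^ d * (ℕ→ℂ (binomialSum d (suc d)) * f 0 0)
          ≈⟨ *-congˡ (⟨left,rightSum⟩ (suc d)) ⟨
        ℚ→ℂ ½ ^ d * ⟨ left 0 , rightSum (suc d) ⟩
          ≈⟨ *-congˡ (trans (⟨⟩-cong {v = left 0} ≋-refl rightSum≋u) ⟨left,u⟩) ⟩
        ℚ→ℂ ½ ^ d * ⟨ kron P₁⁻¹ w , u ⟩ ∎

    formula : ∀ i j → i ℕ.≤ d →
      ⟨ kron P₁⁻¹ (proj (r ℕ.+ i) w) , proj (r ℕ.+ j) (kron P₁⁻¹ (proj r z)) ⟩
        ≈ 𝐢 ^ i * ℚ→ℂ ½ ^ d * ⟨ kron P₁⁻¹ w , kron P₁⁻¹ (proj r z) ⟩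
          * ℕ→ℂ (d C i) * ℕ→ℂ (d C j) * ℚ→ℂ (₂F₁ d i j)
    formula i j i≤d = begin
      f i j
        ≈⟨ right-determined i i≤d j ⟩
      ℚ→ℂ (krawtchouk d i j) * f i 0
        ≈⟨ *-cong (ℚ→ℂ-* (ℕ→ℚ (d C j)) (₂F₁ d i j)) (trans (left-determined i) (*-congˡ f₀₀)) ⟩
      ℕ→ℂ (d C j) * ℚ→ℂ (₂F₁ d i j) * (𝐢 ^ i * ℕ→ℂ (d C i) * (ℚ→ℂ ½ ^ d * ⟨ kron P₁⁻¹ w , u ⟩))
        ≈⟨ solve 6 (λ c h e b p s → c :* h :* (e :* b :* (p :* s)) := e :* p :* s :* b :* c :* h) refl
             (ℕ→ℂ (d C j)) (ℚ→ℂ (₂F₁ d i j)) (𝐢 ^ i) (ℕ→ℂ (d C i)) (ℚ→ℂ ½ ^ d) ⟨ kron P₁⁻¹ w , u ⟩ ⟩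
      𝐢 ^ i * ℚ→ℂ ½ ^ d * ⟨ kron P₁⁻¹ w , u ⟩ * ℕ→ℂ (d C i) * ℕ→ℂ (d C j) * ℚ→ℂ (₂F₁ d i j) ∎

-- Cyclic symmetry and the three formulas

P₁⊙P₁ : scale 2[1-𝐢] P₁⁻¹ ≈ᴹ P₁ ⊙ P₁
P₁⊙P₁ = matrix-≈
  (solve 0 ((:1 :+ :1) :* (:1 :- :𝐢) :* :½ := :1 :* :1 :+ :1 :* (:- :𝐢)) refl)
  (solve 0 ((:1 :+ :1) :* (:1 :- :𝐢) :* (:½ :* :𝐢) := :1 :* :1 :+ :1 :* :𝐢) refl)
  (solve 0 ((:1 :+ :1) :* (:1 :- :𝐢) :* :½ := (:- :𝐢) :* :1 :+ :𝐢 :* (:- :𝐢)) refl)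
  (solve 0 ((:1 :+ :1) :* (:1 :- :𝐢) :* (:- (:½ :* :𝐢)) := (:- :𝐢) :* :1 :+ :𝐢 :* :𝐢) refl)

P₁⁻¹⊙P₁⁻¹ : scale ¼[1+𝐢] P₁ ≈ᴹ P₁⁻¹ ⊙ P₁⁻¹
P₁⁻¹⊙P₁⁻¹ = matrix-≈
  (solve 0 (:½ :* :½ :* (:1 :+ :𝐢) :* :1 := :½ :* :½ :+ :½ :* :𝐢 :* :½) refl)
  (solve 0 (:½ :* :½ :* (:1 :+ :𝐢) :* :1 := :½ :* (:½ :* :𝐢) :+ :½ :* :𝐢 :* (:- (:½ :* :𝐢))) refl)
  (solve 0 (:½ :* :½ :* (:1 :+ :𝐢) :* (:- :𝐢) := :½ :* :½ :+ (:- (:½ :* :𝐢)) :* :½) refl)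
  (solve 0 (:½ :* :½ :* (:1 :+ :𝐢) :* :𝐢 := :½ :* (:½ :* :𝐢) :+ (:- (:½ :* :𝐢)) :* (:- (:½ :* :𝐢)))
      refl)

kron-P² : ∀ {D} (v : V D) → kron P₁ (kron P₁ v) ≋ 2[1-𝐢] ^ D •ⱽ kron P₁⁻¹ v
kron-P² v = ≋-trans (kron-kron P₁ P₁ v) (≋-sym (kron-scale-≋ 2[1-𝐢] P₁⊙P₁ v))

kron-P⁻² : ∀ {D} (v : V D) → kron P₁⁻¹ (kron P₁⁻¹ v) ≋ ¼[1+𝐢] ^ D •ⱽ kron P₁ v
kron-P⁻² v = ≋-trans (kron-kron P₁⁻¹ P₁⁻¹ v) (≋-sym (kron-scale-≋ ¼[1+𝐢] P₁⁻¹⊙P₁⁻¹ v))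

¼[1+𝐢]^n*2[1-𝐢]^n≈1 : ∀ n → ¼[1+𝐢] ^ n * 2[1-𝐢] ^ n ≈ 1#
¼[1+𝐢]^n*2[1-𝐢]^n≈1 zero    = *-identityˡ 1#
¼[1+𝐢]^n*2[1-𝐢]^n≈1 (suc n) = trans
  (solve 2 (λ p q → :½ :* :½ :* (:1 :+ :𝐢) :* p :* ((:1 :+ :1) :* (:1 :- :𝐢) :* q) := p :* q) refl
    (¼[1+𝐢] ^ n) (2[1-𝐢] ^ n))
  (¼[1+𝐢]^n*2[1-𝐢]^n≈1 n)

-- Eᵋₖ = P⁻¹EₖP = P⁻²E*ₖP², and P⁻² and P² are multiples of P and P⁻¹ by inverse scalars.
Eᵋ-kron : ∀ {D} k (v : V D) → Eᵋ k · v ≋ kron P₁ (proj k (kron P₁⁻¹ v))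
Eᵋ-kron {D} k v y = begin
  (Eᵋ k · v) y
    ≈⟨ Eᵋ-· k v y ⟩
  kron P₁⁻¹ (E k · kron P₁ v) y
    ≈⟨ kron-cong P₁⁻¹ (E-· k (kron P₁ v)) y ⟩
  kron P₁⁻¹ (kron P₁⁻¹ (proj k (kron P₁ (kron P₁ v)))) y
    ≈⟨ kron-P⁻² (proj k (kron P₁ (kron P₁ v))) y ⟩
  ¼[1+𝐢] ^ D * kron P₁ (proj k (kron P₁ (kron P₁ v))) y
    ≈⟨ *-congˡ (kron-cong P₁ (≋-trans (proj-cong k (kron-P² v))
        (proj-• k (2[1-𝐢] ^ D) (kron P₁⁻¹ v))) y) ⟩
  ¼[1+𝐢] ^ D * kron P₁ (2[1-𝐢] ^ D •ⱽ proj k (kron P₁⁻¹ v)) y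
    ≈⟨ *-congˡ (kron-• P₁ (2[1-𝐢] ^ D) (proj k (kron P₁⁻¹ v)) y) ⟩
  ¼[1+𝐢] ^ D * (2[1-𝐢] ^ D * kron P₁ (proj k (kron P₁⁻¹ v)) y)
    ≈⟨ *-assoc (¼[1+𝐢] ^ D) (2[1-𝐢] ^ D) _ ⟨
  ¼[1+𝐢] ^ D * 2[1-𝐢] ^ D * kron P₁ (proj k (kron P₁⁻¹ v)) y
    ≈⟨ trans (*-congʳ (¼[1+𝐢]^n*2[1-𝐢]^n≈1 D)) (*-identityˡ _) ⟩
  kron P₁ (proj k (kron P₁⁻¹ v)) y ∎

-- With the next two lemmas: P⁻¹ maps the images of E* to those of E, these to the images of Eᵋ, and
-- these back to those of E*.
E-P⁻¹ : ∀ {D} k (v : V D) → E k · kron P₁⁻¹ v ≋ kron P₁⁻¹ (E* k · v)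
E-P⁻¹ k v = ≋-trans (E-kron k v) (kron-cong P₁⁻¹ (≋-sym (E*-· k v)))

E*-P⁻¹ : ∀ {D} k (v : V D) → E* k · kron P₁⁻¹ v ≋ kron P₁⁻¹ (Eᵋ k · v)
E*-P⁻¹ k v = ≋-trans (E*-· k (kron P₁⁻¹ v)) (≋-sym
  (≋-trans (kron-cong P₁⁻¹ (Eᵋ-kron k v)) (kron-P⁻¹-P (proj k (kron P₁⁻¹ v)))))

Eᵋ-P⁻¹ : ∀ {D} k (v : V D) → Eᵋ k · kron P₁⁻¹ v ≋ kron P₁⁻¹ (E k · v)
Eᵋ-P⁻¹ k v = ≋-trans (Eᵋ-· k (kron P₁⁻¹ v)) (kron-cong P₁⁻¹ (·-cong (E k) (kron-P-P⁻¹ v)))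

rhs : (d i j : ℕ) → ℂ → ℂ
rhs d i j s = 𝐢 ^ i * ℚ→ℂ ½ ^ d * s * ℕ→ℂ (d C i) * ℕ→ℂ (d C j) * ℚ→ℂ (₂F₁ d i j)

rhs-cong : ∀ d i j {s t} → s ≈ t → rhs d i j s ≈ rhs d i j t
rhs-cong d i j s≈t = *-congʳ (*-congʳ (*-congʳ (*-congˡ s≈t)))

½^-cancel : ∀ n {z w} → ℚ→ℂ ½ ^ n * z ≈ ℚ→ℂ ½ ^ n * w → z ≈ w
½^-cancel n {z} {w} eq = trans (sym (cancel z)) (trans (*-congˡ eq) (cancel w))
  where
  cancel : ∀ z → ℕ→ℂ (2 ℕ.^ n) * (ℚ→ℂ ½ ^ n * z) ≈ z
  cancel z = trans (solve 3 (λ p h z → p :* (h :* z) := h :* p :* z) refl (ℕ→ℂ (2 ℕ.^ n)) (ℚ→ℂ ½ ^ n) z)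
    (trans (*-congʳ (½^n*2^n≈1 n)) (*-identityˡ z))

-- Both sides are linear in an inner product and P⁻¹ scales all inner products by ½ᴰ, so the formula
-- for the images under P⁻¹ gives the formula for the vectors themselves.
rhs-P⁻¹ : ∀ {D} d i j {F F′ G G′ : Mat D} →
  (∀ v → F′ · kron P₁⁻¹ v ≋ kron P₁⁻¹ (F · v)) → (∀ v → G′ · kron P₁⁻¹ v ≋ kron P₁⁻¹ (G · v)) →
  ∀ v w → ⟨ F′ · kron P₁⁻¹ v , G′ · kron P₁⁻¹ w ⟩ ≈ rhs d i j ⟨ kron P₁⁻¹ v , kron P₁⁻¹ w ⟩ →
  ⟨ F · v , G · w ⟩ ≈ rhs d i j ⟨ v , w ⟩
rhs-P⁻¹ {D} d i j {F} {F′} {G} {G′} F-P⁻¹ G-P⁻¹ v w eq = ½^-cancel D (begin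
  h * ⟨ F · v , G · w ⟩
    ≈⟨ sym (kron-P⁻¹-isometry (F · v) (G · w)) ⟩
  ⟨ kron P₁⁻¹ (F · v) , kron P₁⁻¹ (G · w) ⟩
    ≈⟨ sym (⟨⟩-cong (F-P⁻¹ v) (G-P⁻¹ w)) ⟩
  ⟨ F′ · kron P₁⁻¹ v , G′ · kron P₁⁻¹ w ⟩
    ≈⟨ eq ⟩
  rhs d i j ⟨ kron P₁⁻¹ v , kron P₁⁻¹ w ⟩
    ≈⟨ rhs-cong d i j (kron-P⁻¹-isometry v w) ⟩
  rhs d i j (h * ⟨ v , w ⟩)
    ≈⟨ solve 7 (λ e p h s b c k → e :* p :* (h :* s) :* b :* c :* k := h :*
        (e :* p :* s :* b :* c :* k)) refl
         (𝐢 ^ i) (ℚ→ℂ ½ ^ d) h ⟨ v , w ⟩ (ℕ→ℂ (d C i)) (ℕ→ℂ (d C j)) (ℚ→ℂ (₂F₁ d i j)) ⟩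
  h * rhs d i j ⟨ v , w ⟩ ∎)
  where
  h = ℚ→ℂ ½ ^ D

theorem11p7 : (D : ℕ) .{{_ : NonZero D}}
    (W : Pred (V D) 0ℓ) (r d : ℕ) →
    IsIrreducible W → IsEndpoint W r → IsDiameter W d →
    (i j : ℕ) → i ℕ.≤ d → j ℕ.≤ d →
    (u u* uᵋ : V D) →
    u ∈ E r ⟪ W ⟫ → ¬ (u ≋ 0ⱽ) →
    u* ∈ E* r ⟪ W ⟫ → ¬ (u* ≋ 0ⱽ) →
    uᵋ ∈ Eᵋ r ⟪ W ⟫ → ¬ (uᵋ ≋ 0ⱽ) →
    (⟨ E (r ℕ.+ i) · uᵋ , E* (r ℕ.+ j) · u ⟩
    ≈ 𝐢 ^ i * ℚ→ℂ ½ ^ d * ⟨ uᵋ , u ⟩ * ℕ→ℂ (d C i) * ℕ→ℂ (d C j) * ℚ→ℂ (₂F₁ d i j))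
    × (⟨ E* (r ℕ.+ i) · u , Eᵋ (r ℕ.+ j) · u* ⟩
    ≈ 𝐢 ^ i * ℚ→ℂ ½ ^ d * ⟨ u , u* ⟩ * ℕ→ℂ (d C i) * ℕ→ℂ (d C j) * ℚ→ℂ (₂F₁ d i j))
    × (⟨ Eᵋ (r ℕ.+ i) · u* , E (r ℕ.+ j) · uᵋ ⟩
    ≈ 𝐢 ^ i * ℚ→ℂ ½ ^ d * ⟨ u* , uᵋ ⟩ * ℕ→ℂ (d C i) * ℕ→ℂ (d C j) * ℚ→ℂ (₂F₁ d i j))
theorem11p7 D W r d irreducible endpoint isDiameter i j i≤d _ u u* uᵋ
  u∈@(v , v∈W , u≋) u≢0 u*∈ _ uᵋ∈ _ =
  part-i uᵋ∈ u∈ , part-ii u∈ u*∈ ,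
  -- Under P⁻¹ the pair u*, uᵋ goes to a vector of EᵣW and one of E*ᵣW, as in part (ii).
  rhs-P⁻¹ d i j (E*-P⁻¹ (r ℕ.+ i)) (Eᵋ-P⁻¹ (r ℕ.+ j)) u* uᵋ
    (part-ii (P⁻¹-∈ (E-P⁻¹ r) u*∈) (P⁻¹-∈ (E*-P⁻¹ r) uᵋ∈))
  where
  open IsIrreducible irreducible
  open IsTModule isTModule
  open TModule isTModule
  open Endpoint isTModule {r} (endpoint-vanishing endpoint)

  E⇒ : ∀ {u v} → u ≋ E r · v → u ≋ kron P₁⁻¹ (proj r (kron P₁ v))
  E⇒ {v = v} u≋ = ≋-trans u≋ (E-· r v)

  D≡ : D ≡ r ℕ.+ r ℕ.+ d
  -- The nonzero highest weight vector is u itself, written as P⁻¹E*ᵣP v.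
  D≡ = diameter isTModule endpoint isDiameter
    (P⁻¹-closed (proj-closed r (P-closed v∈W))) (highestWeight-∈ (P-closed v∈W))
    (λ ≋0 → u≢0 (≋-trans (E⇒ u≋) ≋0))
  open Formula isTModule {r} (endpoint-vanishing endpoint) D≡

  P⁻¹-∈ : ∀ {F F′ : Mat D} → (∀ v → F′ · kron P₁⁻¹ v ≋ kron P₁⁻¹ (F · v)) →
    ∀ {u} → u ∈ F ⟪ W ⟫ → kron P₁⁻¹ u ∈ F′ ⟪ W ⟫
  P⁻¹-∈ F-P⁻¹ (v , v∈W , u≋) = kron P₁⁻¹ v , P⁻¹-closed v∈W ,
    ≋-trans (kron-cong P₁⁻¹ u≋) (≋-sym (F-P⁻¹ v))

  part-i : ∀ {uᵋ u} → uᵋ ∈ Eᵋ r ⟪ W ⟫ → u ∈ E r ⟪ W ⟫ →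
    ⟨ E (r ℕ.+ i) · uᵋ , E* (r ℕ.+ j) · u ⟩ ≈ rhs d i j ⟨ uᵋ , u ⟩
  part-i {uᵋ} {u} (x , x∈W , uᵋ≋) (v , v∈W , u≋) = begin
    ⟨ E (r ℕ.+ i) · uᵋ , E* (r ℕ.+ j) · u ⟩
      ≈⟨ ⟨⟩-cong (≋-trans (E-· (r ℕ.+ i) uᵋ) (kron-cong P₁⁻¹ (proj-cong (r ℕ.+ i) Puᵋ≋)))
           (≋-trans (E*-· (r ℕ.+ j) u) (proj-cong (r ℕ.+ j) (E⇒ u≋))) ⟩
    ⟨ kron P₁⁻¹ (proj (r ℕ.+ i) w) , proj (r ℕ.+ j) (kron P₁⁻¹ (proj r (kron P₁ v))) ⟩
      ≈⟨ formula (P⁻¹-closed (proj-closed r (P-closed (P-closed x∈W))))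
           (highestWeight-∈ (P-closed (P-closed x∈W))) (P-closed v∈W) i j i≤d ⟩
    rhs d i j ⟨ kron P₁⁻¹ w , kron P₁⁻¹ (proj r (kron P₁ v)) ⟩
      ≈⟨ rhs-cong d i j (⟨⟩-cong (≋-trans (≋-sym (kron-P⁻¹-P uᵋ)) (kron-cong P₁⁻¹ Puᵋ≋)) (E⇒ u≋)) ⟨
    rhs d i j ⟨ uᵋ , u ⟩ ∎
    where
    -- From uᵋ = P⁻¹EᵣP x one gets P uᵋ = EᵣP x = P⁻¹E*ᵣP(P x), the shape to which `highestWeight-∈`
    -- applies.
    w = kron P₁⁻¹ (proj r (kron P₁ (kron P₁ x)))
    Puᵋ≋ : kron P₁ uᵋ ≋ w
    Puᵋ≋ = ≋-trans (kron-cong P₁ (≋-trans uᵋ≋ (Eᵋ-· r x)))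
      (≋-trans (kron-P-P⁻¹ (E r · kron P₁ x)) (E-· r (kron P₁ x)))

  part-ii : ∀ {u u*} → u ∈ E r ⟪ W ⟫ → u* ∈ E* r ⟪ W ⟫ →
    ⟨ E* (r ℕ.+ i) · u , Eᵋ (r ℕ.+ j) · u* ⟩ ≈ rhs d i j ⟨ u , u* ⟩
  part-ii {u} {u*} u∈ u*∈ = rhs-P⁻¹ d i j (E-P⁻¹ (r ℕ.+ i)) (E*-P⁻¹ (r ℕ.+ j)) u u*
    (part-i (P⁻¹-∈ (Eᵋ-P⁻¹ r) u∈) (P⁻¹-∈ (E-P⁻¹ r) u*∈))
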